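{- For every $v\equiv 1$ or $5\pmod{10}$ with $v\notin\{5,15,11,91\}$, there exists a super-simple $2$-$(v,5,1)$DD $\mathcal{D}$ with $f(\mathcal{D})\geq\frac12$.
   Context: A $2$-$(v,5,1)$ directed design ($2$-$(v,5,1)$DD) is a pair $(V,\mathcal{B})$ where $|V|=v$ and $\mathcal{B}$ is a collection of ordered $5$-tuples of distinct elements of $V$ (blocks) such that every ordered pair $(x,y)$ of distinct elements of $V$ occurs in exactly one block as a subsequence. It is super-simple if, after forgetting the order in blocks (giving a $2$-$(v,5,2)$-BIBD), any two blocks intersect in at most two points. A defining set of a $2$-$(v,5,1)$DD $\mathcal{D}=(V,\mathcal{B})$ is a subset $S\subseteq\mathcal{B}$ such that $\mathcal{D}$ is the unique $2$-$(v,5,1)$DD on $V$ whose block collection contains $S$. Define $f(\mathcal{D})$ as the number of blocks in a smallest defining set of $\mathcal{D}$ divided by $|\mathcal{B}|$. -}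

module Defs where

open import Data.Nat using (ℕ; _<_; _≤_; _*_)
open import Data.Fin using (Fin) renaming (_<_ to _<ᶠ_)
open import Data.Fin.Subset using (Subset; _∈_; ∣_∣)
open import Data.Vec using (Vec; lookup)
open import Data.Product using (Σ; ∃; ∃-syntax; _×_; _,_)
open import Relation.Binary.PropositionalEquality using (_≡_; _≢_)
open import Relation.Nullary using (¬_)
open import Data.Empty using (⊥)

Block : ℕ → Set
Block v = Vec (Fin v) 5

record Collection (v : ℕ) : Set where
  constructor mkCollection
  field
    size   : ℕ
    blocks : Fin size → Block v
open Collection public

DistinctEntries : ∀ {v} → Block v → Set
DistinctEntries t = ∀ i j → lookup t i ≡ lookup t j → i ≡ j

OccursIn : ∀ {v} → Fin v → Fin v → Block v → Set
OccursIn x y t = ∃[ i ] ∃[ j ] (i <ᶠ j × lookup t i ≡ x × lookup t j ≡ y)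

IsDD : ∀ {v} → Collection v → Set
IsDD {v} D =
  (∀ k → DistinctEntries (blocks D k)) ×
  (∀ (x y : Fin v) → x ≢ y →
     ∃[ k ] (OccursIn x y (blocks D k) ×
             (∀ k′ → OccursIn x y (blocks D k′) → k′ ≡ k)))

PointIn : ∀ {v} → Fin v → Block v → Set
PointIn x t = ∃[ i ] (lookup t i ≡ x)

MeetInAtMostTwo : ∀ {v} → Block v → Block v → Set
MeetInAtMostTwo s t =
  ∀ x y z → x ≢ y → x ≢ z → y ≢ z →
  PointIn x s → PointIn y s → PointIn z s →
  PointIn x t → PointIn y t → PointIn z t → ⊥

SuperSimple : ∀ {v} → Collection v → Set
SuperSimple D = ∀ k k′ → k ≢ k′ → MeetInAtMostTwo (blocks D k) (blocks D k′)

BlockOf : ∀ {v} → Block v → Collection v → Set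
BlockOf t D = ∃[ k ] (blocks D k ≡ t)

-- Same block collection (directed designs have no repeated blocks,
-- since each block covers 20 ordered pairs each exactly once).
SameBlocks : ∀ {v} → Collection v → Collection v → Set
SameBlocks D E = (∀ k → BlockOf (blocks D k) E) × (∀ k → BlockOf (blocks E k) D)

IsDefiningSet : ∀ {v} → (D : Collection v) → Subset (size D) → Set
IsDefiningSet {v} D S =
  ∀ (E : Collection v) → IsDD E →
  (∀ k → k ∈ S → BlockOf (blocks D k) E) → SameBlocks E D

-- f(D) ≥ 1/2 : every defining set (in particular a smallest one)
-- has at least half of the blocks, i.e. |B| ≤ 2 |S|.
fAtLeastHalf : ∀ {v} → Collection v → Set
fAtLeastHalf D = ∀ S → IsDefiningSet D S → size D ≤ 2 * ∣ S ∣

{-# OPTIONS --safe #-}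
-- Two blocks of a directed design that share two points, adjacent in both and in
-- opposite orders, can be traded: exchange these points in both blocks. Hence a
-- defining set meets every such pair of blocks, and if some permutation sends
-- every block to a block that it can be traded with, the complement of a defining
-- set injects into it, so that f ≥ 1/2.
--
-- Designs with such a permutation of mates are closed under decomposing the set
-- of pairs to be covered, because blocks of different pieces share at most one
-- point. Give weight g to the points of five groups of a transversal design TD(6, q)
-- and weights g, …, g, e, 0, …, 0 to those of the sixth group. Group divisible
-- designs of types g⁵ g¹, g⁵ e¹ and g⁵ and one further point then yield the order
-- 5gq + gm + e + 1 from the orders gq + 1 and gm + e + 1, here with (g, e) among
-- (10, 4), (4, 2), (6, 2), (8, 2). For v ≥ 1800 the weight 10 and q = 6t − 1
-- suffice; below, a search over the possible steps leaves finitely many orders,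
-- for which base blocks of a design with a cyclic group of automorphisms are given.
module Submission where

open import Defs
open import Data.Bool using (Bool; T; _∧_; _∨_; false; if_then_else_; not; true)
open import Data.Bool.ListAction using (all; any)
open import Data.Bool.Properties using (T-∧; T-∨)
open import Data.Empty using (⊥; ⊥-elim)
open import Data.Fin using (#_; Fin; _↑ˡ_; _≟_; fromℕ<; inject₁; suc; toℕ; zero) renaming (_<_ to _<ᶠ_)
open import Data.Fin.Properties using (*↔×; +↔⊎; all?; any?; injective⇒≤; punchOut-injective; toℕ-combine; toℕ-fromℕ<; toℕ-injective; toℕ<n)
open import Data.Fin.Subset using (Subset; inside; outside; ∣_∣) renaming (_∈_ to _∈ˢ_; _∉_ to _∉ˢ_)
open import Data.Fin.Subset.Properties using (_∈?_)
open import Data.List using (List; []; _++_; _∷_; allFin; cartesianProduct; downFrom; filter; foldr; length; map)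
open import Data.List.Membership.Propositional using (_∈_)
open import Data.List.Membership.Propositional.Properties using (∈-++⁺ʳ; ∈-++⁺ˡ; ∈-allFin; ∈-cartesianProduct⁺; ∈-downFrom⁺; ∈-filter⁺; ∈-map⁺)
open import Data.List.Relation.Unary.Any using (here; there)
open import Data.Maybe using (Maybe; just; nothing)
open import Data.Maybe.Properties using (just-injective)
open import Data.Nat using (NonZero; _%_; _*_; _+_; _/_; _<?_; _<_; _<ᵇ_; _∸_; _≡ᵇ_; _≤_; nonZero; s<s⁻¹; suc; s≤s; zero; z≤n; ℕ)
open import Data.Nat.DivMod
open import Data.Nat.Divisibility using (divides; m%n≡0⇒n∣m)
open import Data.Nat.Induction using (<-rec)
open import Data.Nat.Solver using (module +-*-Solver)
open import Data.Product using (_,_; _×_; proj₁; proj₂; Σ; ∃; ∃₂)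
open import Data.Product.Function.Dependent.Propositional using (Σ-↔)
open import Data.Product.Function.NonDependent.Propositional using (_×-↔_)
open import Data.Product.Properties using (,-injectiveˡ)
open import Data.Product.Properties.WithK using (,-injectiveʳ)
open import Data.Sum using ([_,_]′; _⊎_; inj₁; inj₂)
open import Data.Sum.Function.Propositional using (_⊎-↔_)
open import Data.Sum.Properties using (inj₂-injective)
open import Data.Unit using (tt; ⊤)
open import Data.Vec using (Vec; []; _∷_; here; lookup; tabulate; there)
open import Data.Vec.Properties using (lookup∘tabulate; tabulate-cong)
open import Function using (Equivalence; Inverse; _↔_; _∘_; mk↔ₛ′)
open import Function.Construct.Composition using (_↔-∘_)
open import Function.Construct.Identity using (↔-id)
open import Function.Construct.Symmetry using (↔-sym)
open import Relation.Binary.Definitions using (tri<; tri>; tri≈)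
open import Relation.Binary.PropositionalEquality
open import Relation.Nullary using (Dec; contradiction; no; yes; ¬_)
open import Relation.Nullary.Decidable using (_×-dec_; _→-dec_; _⊎-dec_; from-yes; map′)
import Data.Fin as Fin
import Data.Fin.Properties as Fin
import Data.List as List
import Data.List.Relation.Unary.All as All
import Data.List.Relation.Unary.All.Properties as All
import Data.Maybe as Maybe
import Data.Nat.Properties as ℕ

-- A design is taken relative to a relation R, the set of pairs to be covered. For a directed design
-- R is inequality, for a group divisible design it is membership in different groups; both can then
-- serve as pieces of one decomposition. The mates need not form disjoint couples. The complement of
-- a defining set only has to be mapped injectively into the set, so mates may run through cycles of
-- any length. This permits designs in which an odd number of orbits of blocks is permuted
-- cyclically. Trades cost nothing in the recursive steps, because a block and its mate always lie
-- in the same piece. The work therefore lies in the finite designs, and their verification is cut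
-- down to one representative of each orbit of ordered pairs.

record Design {P : Set} (R : P → P → Set) : Set₁ where
  field
    Index       : Set
    count       : ℕ
    enum        : Index ↔ Fin count
    block       : Index → Fin 5 → P
    distinct    : ∀ k {i j} → block k i ≡ block k j → i ≡ j
    related     : ∀ k {i j} → i ≢ j → R (block k i) (block k j)
    covered     : ∀ {x y} → R x y →
                  ∃ λ k → ∃₂ λ i j → i <ᶠ j × block k i ≡ x × block k j ≡ y
    unique      : ∀ {k k′ i j i′ j′} → i <ᶠ j → i′ <ᶠ j′ →
                  block k i ≡ block k′ i′ → block k j ≡ block k′ j′ → k ≡ k′
    superSimple : ∀ {k k′} → k ≢ k′ → ∀ {a b c a′ b′ c′} → a ≢ b → a ≢ c → b ≢ c →
                  block k a ≡ block k′ a′ → block k b ≡ block k′ b′ →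
                  block k c ≡ block k′ c′ → ⊥
    -- A block and its mate share two points that are adjacent in both, in
    -- opposite orders; exchanging them in both blocks covers the same pairs.
    mate        : Index → Index
    mate-inj    : ∀ {k k′} → mate k ≡ mate k′ → k ≡ k′
    swap        : ∀ k → ∃₂ λ a b → block k (inject₁ a) ≡ block (mate k) (suc b) ×
                                   block k (suc a) ≡ block (mate k) (inject₁ b)

Complete : Set → Set₁
Complete P = Design (λ (x y : P) → x ≢ y)

-- Exchanging two adjacent points in a block and in its mate

transpose : Fin 4 → Fin 5 → Fin 5
transpose a i with i ≟ inject₁ a | i ≟ suc a
... | yes _ | _     = suc a
... | no _  | yes _ = inject₁ a
... | no _  | no _  = i

transpose-mono : ∀ a i j → i <ᶠ j →
                 transpose a i <ᶠ transpose a j ⊎ i ≡ inject₁ a × j ≡ suc a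
transpose-mono = from-yes (all? λ a → all? λ i → all? λ j → (i Fin.<? j) →-dec
  ((transpose a i Fin.<? transpose a j) ⊎-dec ((i ≟ inject₁ a) ×-dec (j ≟ suc a))))

transpose-involutive : ∀ a i → transpose a (transpose a i) ≡ i
transpose-involutive = from-yes (all? λ a → all? λ i → transpose a (transpose a i) ≟ i)

transpose-left : ∀ a → transpose a (inject₁ a) ≡ suc a
transpose-left = from-yes (all? λ a → transpose a (inject₁ a) ≟ suc a)

transpose-right : ∀ a → transpose a (suc a) ≡ inject₁ a
transpose-right = from-yes (all? λ a → transpose a (suc a) ≟ inject₁ a)

adjacent-< : ∀ (a : Fin 4) → inject₁ a <ᶠ suc a
adjacent-< = from-yes (all? λ (a : Fin 4) → inject₁ a Fin.<? suc a)

-- Every transposition of neighbours leaves the order of some pair alone.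
transpose-fixes : ∀ a → ∃₂ λ i j → i <ᶠ j × transpose a i <ᶠ transpose a j
transpose-fixes = from-yes (all? λ a → Fin.any? λ i → Fin.any? λ j →
  (i Fin.<? j) ×-dec (transpose a i Fin.<? transpose a j))

data Order {n} (i j : Fin n) : Set where
  below : i <ᶠ j → Order i j
  above : j <ᶠ i → Order i j

order : ∀ {n} {i j : Fin n} → i ≢ j → Order i j
order {i = i} {j} i≢j with Fin.<-cmp i j
... | tri< p _ _ = below p
... | tri≈ _ p _ = contradiction p i≢j
... | tri> _ _ p = above p

module Trade {P : Set} {R : P → P → Set} (D : Design R) (k₀ : Design.Index D)
             (_≟ⁱ_ : (k k′ : Design.Index D) → Dec (k ≡ k′)) where
  open Design D

  k₁ = mate k₀
  a  = proj₁ (swap k₀)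
  b  = proj₁ (proj₂ (swap k₀))

  swap-left : block k₀ (inject₁ a) ≡ block k₁ (suc b)
  swap-left = proj₁ (proj₂ (proj₂ (swap k₀)))

  swap-right : block k₀ (suc a) ≡ block k₁ (inject₁ b)
  swap-right = proj₂ (proj₂ (proj₂ (swap k₀)))

  positions : ∀ {k i j i′ j′} → i <ᶠ j → i′ <ᶠ j′ → ∀ {k′} →
              block k i ≡ block k′ i′ → block k j ≡ block k′ j′ →
              k ≡ k′ × i ≡ i′ × j ≡ j′
  positions i<j i′<j′ p q with unique i<j i′<j′ p q
  ... | refl = refl , distinct _ p , distinct _ q

  k₀≢k₁ : k₀ ≢ k₁
  k₀≢k₁ k₀≡k₁ = ℕ.<-asym (adjacent-< a) (subst₂ _<ᶠ_ (sym eq₂) (sym eq₁) (adjacent-< b))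
    where
    eq₁ : inject₁ a ≡ suc b
    eq₁ = distinct k₀ (trans swap-left (cong (λ k → block k (suc b)) (sym k₀≡k₁)))
    eq₂ : suc a ≡ inject₁ b
    eq₂ = distinct k₀ (trans swap-right (cong (λ k → block k (inject₁ b)) (sym k₀≡k₁)))

  data Role (k : Index) : Set where
    first  : k ≡ k₀ → Role k
    second : k ≡ k₁ → Role k
    other  : k ≢ k₀ → k ≢ k₁ → Role k

  role : ∀ k → Role k
  role k with k ≟ⁱ k₀ | k ≟ⁱ k₁
  ... | yes p | _     = first p
  ... | no _  | yes q = second q
  ... | no p  | no q  = other p q

  shuffle : ∀ {k} → Role k → Fin 5 → Fin 5
  shuffle (first _)   = transpose a
  shuffle (second _)  = transpose b
  shuffle (other _ _) = λ i → i

  shuffle-involutive : ∀ {k} (r : Role k) i → shuffle r (shuffle r i) ≡ i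
  shuffle-involutive (first _)   = transpose-involutive a
  shuffle-involutive (second _)  = transpose-involutive b
  shuffle-involutive (other _ _) = λ _ → refl

  block′ : Index → Fin 5 → P
  block′ k i = block k (shuffle (role k) i)

  distinct′ : ∀ k {i j} → block′ k i ≡ block′ k j → i ≡ j
  distinct′ k {i} {j} p = trans (sym (shuffle-involutive (role k) i))
    (trans (cong (shuffle (role k)) (distinct k p)) (shuffle-involutive (role k) j))

  -- Witnesses that the ordered pair at positions i, j of the new block k is the pair at i*, j* of
  -- the old block k*. Only the exchanged pair changes its block: its new order is the one it had in
  -- the other block.
  data Source {k} (r : Role k) (i j : Fin 5) (k* : Index) (i* j* : Fin 5) : Set where
    kept   : k* ≡ k → i* ≡ shuffle r i → j* ≡ shuffle r j → Source r i j k* i* j*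
    cross₁ : k ≡ k₀ → k* ≡ k₁ → i* ≡ inject₁ b → j* ≡ suc b → Source r i j k* i* j*
    cross₂ : k ≡ k₁ → k* ≡ k₀ → i* ≡ inject₁ a → j* ≡ suc a → Source r i j k* i* j*

  source : ∀ {k} (r : Role k) {i j} → i <ᶠ j → ∃ λ k* → ∃₂ λ i* j* →
           Source r i j k* i* j* × i* <ᶠ j* ×
           block k (shuffle r i) ≡ block k* i* × block k (shuffle r j) ≡ block k* j*
  source (first refl) {i} {j} i<j with transpose-mono a i j i<j
  ... | inj₁ lt = _ , _ , _ , kept refl refl refl , lt , refl , refl
  ... | inj₂ (refl , refl) rewrite transpose-left a | transpose-right a =
    _ , _ , _ , cross₁ refl refl refl refl , adjacent-< b , swap-right , swap-left
  source (second refl) {i} {j} i<j with transpose-mono b i j i<j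
  ... | inj₁ lt = _ , _ , _ , kept refl refl refl , lt , refl , refl
  ... | inj₂ (refl , refl) rewrite transpose-left b | transpose-right b =
    _ , _ , _ , cross₂ refl refl refl refl , adjacent-< a , sym swap-left , sym swap-right
  source (other _ _) i<j = _ , _ , _ , kept refl refl refl , i<j , refl , refl

  crossing : ∀ c {i j : Fin 5} → i <ᶠ j → transpose c i ≡ inject₁ c → transpose c j ≡ suc c → ⊥
  crossing c {i} {j} i<j p q = ℕ.<-asym (adjacent-< c) (subst₂ _<ᶠ_
    (trans (sym (transpose-involutive c i)) (trans (cong (transpose c) p) (transpose-left c)))
    (trans (sym (transpose-involutive c j)) (trans (cong (transpose c) q) (transpose-right c))) i<j)

  at-k₀ : ∀ {k} (r : Role k) → k ≡ k₀ → ∀ i → shuffle r i ≡ transpose a i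
  at-k₀ (first _)   _ i = refl
  at-k₀ (second p)  q i = contradiction (trans (sym q) p) k₀≢k₁
  at-k₀ (other p _) q i = contradiction q p

  at-k₁ : ∀ {k} (r : Role k) → k ≡ k₁ → ∀ i → shuffle r i ≡ transpose b i
  at-k₁ (first p)   q i = contradiction (trans (sym p) q) k₀≢k₁
  at-k₁ (second _)  _ i = refl
  at-k₁ (other _ p) q i = contradiction q p

  -- If a kept and a crossed pair had the same origin, the kept one would be the traded pair, whose
  -- order its own block has just reversed. Two crossings with the same origin end in the same block
  -- because `k₀≢k₁`.
  source-inj : ∀ {k k′} (r : Role k) (r′ : Role k′) {i j i′ j′ k* i* j*} → i <ᶠ j → i′ <ᶠ j′ →
               Source r i j k* i* j* → Source r′ i′ j′ k* i* j* → k ≡ k′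
  source-inj r r′ i<j i′<j′ (kept p _ _) (kept p′ _ _) = trans (sym p) p′
  source-inj r r′ {i} {j} i<j _ (kept p q s) (cross₁ _ p′ q′ s′) = ⊥-elim (crossing b i<j
    (trans (sym (at-k₁ r (trans (sym p) p′) i)) (trans (sym q) q′))
    (trans (sym (at-k₁ r (trans (sym p) p′) j)) (trans (sym s) s′)))
  source-inj r r′ {i} {j} i<j _ (kept p q s) (cross₂ _ p′ q′ s′) = ⊥-elim (crossing a i<j
    (trans (sym (at-k₀ r (trans (sym p) p′) i)) (trans (sym q) q′))
    (trans (sym (at-k₀ r (trans (sym p) p′) j)) (trans (sym s) s′)))
  source-inj r r′ i<j i′<j′ f@(cross₁ _ _ _ _) g@(kept _ _ _) = sym (source-inj r′ r i′<j′ i<j g f)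
  source-inj r r′ _ _ (cross₁ p _ _ _) (cross₁ p′ _ _ _) = trans p (sym p′)
  source-inj r r′ _ _ (cross₁ _ q _ _) (cross₂ _ q′ _ _) = contradiction (trans (sym q′) q) k₀≢k₁
  source-inj r r′ i<j i′<j′ f@(cross₂ _ _ _ _) g@(kept _ _ _) = sym (source-inj r′ r i′<j′ i<j g f)
  source-inj r r′ _ _ (cross₂ _ q _ _) (cross₁ _ q′ _ _) = contradiction (trans (sym q) q′) k₀≢k₁
  source-inj r r′ _ _ (cross₂ p _ _ _) (cross₂ p′ _ _ _) = trans p (sym p′)

  unique′ : ∀ {k k′ i j i′ j′} → i <ᶠ j → i′ <ᶠ j′ →
            block′ k i ≡ block′ k′ i′ → block′ k j ≡ block′ k′ j′ → k ≡ k′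
  unique′ {k} {k′} i<j i′<j′ p q with source (role k) i<j | source (role k′) i′<j′
  ... | k* , i* , j* , s , lt , eq₁ , eq₂ | k*′ , i*′ , j*′ , s′ , lt′ , eq₁′ , eq₂′
    with positions lt lt′ (trans (sym eq₁) (trans p eq₁′)) (trans (sym eq₂) (trans q eq₂′))
  ... | refl , refl , refl = source-inj (role k) (role k′) i<j i′<j′ s s′

  at-block₀ : ∀ i → block′ k₀ i ≡ block k₀ (transpose a i)
  at-block₀ i = cong (block k₀) (at-k₀ (role k₀) refl i)

  at-block₁ : ∀ i → block′ k₁ i ≡ block k₁ (transpose b i)
  at-block₁ i = cong (block k₁) (at-k₁ (role k₁) refl i)

  covered′ : ∀ {x y} → R x y →
             ∃ λ k → ∃₂ λ i j → i <ᶠ j × block′ k i ≡ x × block′ k j ≡ y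
  covered′ xRy with covered xRy
  ... | k , i , j , i<j , refl , refl = by (role k) refl
    where
    by : ∀ r → role k ≡ r → ∃ λ k* → ∃₂ λ i* j* → i* <ᶠ j* × block′ k* i* ≡ block k i ×
         block′ k* j* ≡ block k j
    by (first refl) eq with transpose-mono a i j i<j
    ... | inj₁ lt = k₀ , _ , _ , lt , back i , back j
      where
      back : ∀ i → block′ k₀ (transpose a i) ≡ block k₀ i
      back i = trans (at-block₀ _) (cong (block k₀) (transpose-involutive a i))
    ... | inj₂ (refl , refl) = k₁ , inject₁ b , suc b , adjacent-< b ,
      trans (at-block₁ _) (trans (cong (block k₁) (transpose-left b)) (sym swap-left)) ,
      trans (at-block₁ _) (trans (cong (block k₁) (transpose-right b)) (sym swap-right))
    by (second refl) eq with transpose-mono b i j i<j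
    ... | inj₁ lt = k₁ , _ , _ , lt , back i , back j
      where
      back : ∀ i → block′ k₁ (transpose b i) ≡ block k₁ i
      back i = trans (at-block₁ _) (cong (block k₁) (transpose-involutive b i))
    ... | inj₂ (refl , refl) = k₀ , inject₁ a , suc a , adjacent-< a ,
      trans (at-block₀ _) (trans (cong (block k₀) (transpose-left a)) swap-right) ,
      trans (at-block₀ _) (trans (cong (block k₀) (transpose-right a)) swap-left)
    by r@(other _ _) eq = k , i , j , i<j , back i , back j
      where
      back : ∀ i → block′ k i ≡ block k i
      back i = cong (λ r → block k (shuffle r i)) eq

  -- Some pair of positions keeps its order under the exchange. An old block equal to the new one
  -- therefore shares an ordered pair with block k₀ and must be k₀ itself, whose exchanged points
  -- have moved.
  new-block : ∀ k → ¬ (∀ i → block k i ≡ block′ k₀ i)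
  new-block k same with transpose-fixes a
  ... | i , j , i<j , lt
    with unique i<j lt (trans (same i) (at-block₀ i)) (trans (same j) (at-block₀ j))
  ... | refl = ℕ.<⇒≢ (adjacent-< a) (cong toℕ (trans
    (distinct k (trans (same (inject₁ a)) (at-block₀ _))) (transpose-left a)))

-- Congruences, Boolean tests and a search tree

module Modular (m : ℕ) .{{_ : NonZero m}} where

  infix 4 _≋_
  _≋_ : ℕ → ℕ → Set
  a ≋ b = a % m ≡ b % m

  +-cong : ∀ {a b c d} → a ≋ b → c ≋ d → a + c ≋ b + d
  +-cong {a} {b} {c} {d} p q = trans (%-distribˡ-+ a c m)
    (trans (cong₂ (λ x y → (x + y) % m) p q) (sym (%-distribˡ-+ b d m)))

  *-cong : ∀ {a b c d} → a ≋ b → c ≋ d → a * c ≋ b * d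
  *-cong {a} {b} {c} {d} p q = trans (%-distribˡ-* a c m)
    (trans (cong₂ (λ x y → (x * y) % m) p q) (sym (%-distribˡ-* b d m)))

  reduce : ∀ a → a % m ≋ a
  reduce a = m%n%n≡m%n a m

  period : m ≋ 0
  period = [m+n]%n≡m%n 0 m

  complement : ∀ a → a % m + (m ∸ a % m) ≡ m
  complement a = ℕ.m+[n∸m]≡n (ℕ.<⇒≤ (m%n<n a m))

  +-cancelʳ : ∀ {a b} c → a + c ≋ b + c → a ≋ b
  +-cancelʳ {a} {b} c p = trans (sym (undo a)) (trans (+-cong p refl) (undo b))
    where
    undo : ∀ a → a + c + (m ∸ c % m) ≋ a
    undo a = begin
      (a + c + (m ∸ c % m)) % m       ≡⟨ cong (_% m) (ℕ.+-assoc a c _) ⟩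
      (a + (c + (m ∸ c % m))) % m     ≡⟨ +-cong {a} refl (+-cong {c} (sym (reduce c)) refl) ⟩
      (a + (c % m + (m ∸ c % m))) % m ≡⟨ cong (λ x → (a + x) % m) (complement c) ⟩
      (a + m) % m                     ≡⟨ [m+n]%n≡m%n a m ⟩
      a % m                           ∎
      where open ≡-Reasoning

  small : ∀ {a b} → a < m → b < m → a ≋ b → a ≡ b
  small a<m b<m p = trans (sym (m<n⇒m%n≡m a<m)) (trans p (m<n⇒m%n≡m b<m))

∧-split : ∀ {x y} → T (x ∧ y) → T x × T y
∧-split = Equivalence.to T-∧

Separate : (points size : ℕ) .{{_ : NonZero size}} → ℕ → ℕ → Set
Separate v h x y = x < v × y < v × x / h ≢ y / h

pairs : List (Fin 5 × Fin 5)
pairs = filter (λ p → proj₁ p Fin.<? proj₂ p) (cartesianProduct (allFin 5) (allFin 5))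

∈-pairs : ∀ {i j} → i <ᶠ j → (i , j) ∈ pairs
∈-pairs {i} {j} i<j = ∈-filter⁺ (λ p → proj₁ p Fin.<? proj₂ p)
  (∈-cartesianProduct⁺ (∈-allFin i) (∈-allFin j)) i<j

all-∈ : ∀ {A : Set} (p : A → Bool) xs {x} → T (all p xs) → x ∈ xs → T (p x)
all-∈ p xs t = All.lookup (All.all⁺ p xs t)

distinctKeys : ∀ {A : Set} → List (ℕ × A) → Bool
distinctKeys []             = true
distinctKeys ((n , _) ∷ xs) = all (λ x → not (n ≡ᵇ proj₁ x)) xs ∧ distinctKeys xs

not-T : ∀ {b} → T (not b) → ¬ T b
not-T {false} _ ()

distinctKeys-sound : ∀ {A : Set} (xs : List (ℕ × A)) → T (distinctKeys xs) →
                     ∀ {n a a′} → (n , a) ∈ xs → (n , a′) ∈ xs → a ≡ a′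
distinctKeys-sound (x ∷ xs) t (here refl) (here refl) = refl
distinctKeys-sound (x ∷ xs) t {n} (here refl) (there q) =
  ⊥-elim (not-T (all-∈ _ xs (proj₁ (∧-split t)) q) (ℕ.≡⇒≡ᵇ n n refl))
distinctKeys-sound (x ∷ xs) t {n} (there p) (here refl) =
  ⊥-elim (not-T (all-∈ _ xs (proj₁ (∧-split t)) p) (ℕ.≡⇒≡ᵇ n n refl))
distinctKeys-sound (x ∷ xs) t (there p) (there q) = distinctKeys-sound xs (proj₂ (∧-split t)) p q

data Trie (A : Set) : Set where
  leaf : Trie A
  node : Maybe A → Trie A → Trie A → Trie A

insert : ∀ {A} → ℕ → ℕ → A → Trie A → Trie A
branch : ∀ {A} → ℕ → ℕ → ℕ → A → Maybe A → Trie A → Trie A → Trie A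
insert zero    _ a _            = node (just a) leaf leaf
insert (suc d) n a leaf         = branch d (n % 2) (n / 2) a nothing leaf leaf
insert (suc d) n a (node x l r) = branch d (n % 2) (n / 2) a x l r
branch d zero    n a x l r = node x (insert d n a l) r
branch d (suc _) n a x l r = node x l (insert d n a r)

search : ∀ {A} → ℕ → ℕ → Trie A → Maybe A
search _       _ leaf         = nothing
search zero    _ (node x _ _) = x
search (suc d) n (node _ l r) with n % 2
... | zero  = search d (n / 2) l
... | suc _ = search d (n / 2) r

-- The cyclic group of order m acts on 0, …, v − 1: it rotates each of the c
-- columns [j m, (j + 1) m) and fixes the other points. Points x, y with
-- x / h = y / h belong to the same group of the design. A row consists of a base
-- block followed by a position a, a row number k and a position b: the points at
-- a, a + 1 occur in the opposite order at b, b + 1 in a translate of row k.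
record Family : Set where
  constructor family
  field
    m c h v : ℕ
    {{m≢0}} : NonZero m
    {{h≢0}} : NonZero h
    rows    : List (Vec ℕ 8)

-- Finite tests on base blocks

module Cyclic (F : Family) where
  open Family F
  open Modular m public

  b : ℕ
  b = length rows

  row : Fin b → Vec ℕ 8
  row = List.lookup rows

  point : Vec ℕ 8 → Fin 5 → ℕ
  point r i = lookup r (i ↑ˡ 3)

  base : Fin b → Fin 5 → ℕ
  base k = point (row k)

  rotate : ℕ → ℕ → ℕ
  rotate t x = if x <ᵇ c * m then (x % m + t) % m + x / m * m else x

  -- A fixed point has no residue to normalise by, so y takes over when x is fixed. Rotating by
  -- `shift x y` brings the anchoring point to the start of its column, which selects one pair from
  -- each orbit.
  anchor : ℕ → ℕ → ℕ
  anchor x y = if x <ᵇ c * m then x % m else y % m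

  -- All orders treated here are below 1024, so a key has 20 binary digits, the depth passed to
  -- `insert` and `search`. A collision of keys could only make the test fail.
  shift norm₁ norm₂ key : ℕ → ℕ → ℕ
  shift x y = m ∸ anchor x y
  norm₁ x y = rotate (shift x y) x
  norm₂ x y = rotate (shift x y) y
  key x y = norm₁ x y * 1024 + norm₂ x y

  separate : ℕ → ℕ → Bool
  separate x y = (x <ᵇ v) ∧ (y <ᵇ v) ∧ not (x / h ≡ᵇ y / h)

  Entry : Set
  Entry = Fin b × Fin 5 × Fin 5

  rowKey : Vec ℕ 8 → Fin 5 → Fin 5 → ℕ
  rowKey r i j = key (point r i) (point r j)

  entryKey reverseKey : Entry → ℕ
  entryKey   (k , i , j) = rowKey (row k) i j
  reverseKey (k , i , j) = rowKey (row k) j i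

  entries : List Entry
  entries = cartesianProduct (allFin b) pairs

  -- The checks below do not depend on how this lookup structure is built: `same`
  -- verifies that every entry is found under its own key, hence keys are distinct.
  index : Trie Entry
  index = foldr (λ e → insert 20 (entryKey e) e) leaf entries

  fixed : List ℕ
  fixed = map (c * m +_) (downFrom (v ∸ c * m))

  fixedTogether : Bool
  fixedTogether = all (λ x → all (λ y → x / h ≡ᵇ y / h) fixed) fixed

  separateAt : Vec ℕ 8 → Fin 5 → Fin 5 → Bool
  separateAt r i j = (toℕ i ≡ᵇ toℕ j) ∨ separate (point r i) (point r j)

  separateRow : Vec ℕ 8 → Bool
  separateRow r = all (λ i → all (separateAt r i) (allFin 5)) (allFin 5)

  same : Entry → Maybe Entry → Bool
  same (k , i , j) nothing = false
  same (k , i , j) (just (k′ , i′ , j′)) =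
    (toℕ k ≡ᵇ toℕ k′) ∧ (toℕ i ≡ᵇ toℕ i′) ∧ (toℕ j ≡ᵇ toℕ j′)

  hit : ℕ → ℕ → Maybe Entry → Bool
  hit x y nothing = false
  hit x y (just (k , i , j)) = (toℕ i <ᵇ toℕ j)
    ∧ (norm₁ (base k i) (base k j) ≡ᵇ x) ∧ (norm₂ (base k i) (base k j) ≡ᵇ y)

  covers : Trie Entry → ℕ → ℕ → Bool
  covers t x y = not (separate x y) ∨ hit x y (search 20 (x * 1024 + y) t)

  -- A normalised pair starts with the first point `j * m` of a column, or it consists of a fixed
  -- point followed by such a point. The two lists therefore meet every orbit.
  coversColumns coversFixed : Trie Entry → Bool
  coversColumns t = all (λ j → all (covers t (j * m)) (downFrom v)) (downFrom c)
  coversFixed t = all (λ z → all (λ j → covers t z (j * m)) (downFrom c)) fixed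

  avoids : List ℕ → ℕ → Bool
  avoids ys x = all (λ y → not (y ≡ᵇ x)) ys

  onlyIn : List ℕ → Vec ℕ 8 → Fin 5 → Fin 5 → Fin 5 → Bool
  onlyIn ys r i j l = (toℕ l ≡ᵇ toℕ i) ∨ (toℕ l ≡ᵇ toℕ j) ∨ avoids ys (point r l)

  meetsOnlyIn : List ℕ → Vec ℕ 8 → Fin 5 → Fin 5 → Bool
  meetsOnlyIn ys r i j = all (onlyIn ys r i j) (allFin 5)

  translate : ℕ → Vec ℕ 8 → List ℕ
  translate t r = map (λ l → rotate t (point r l)) (allFin 5)

  -- Each ordered pair lies in only one block, so a second block through the points at i and j has
  -- them in the opposite order and is found under the reversed key. Rotated onto this row, it must
  -- avoid the three remaining points. When the search fails there is no second block, since every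
  -- entry is stored under its key.
  simpleAt : Entry → Maybe Entry → Bool
  simpleAt _ nothing = true
  simpleAt (k , i , j) (just (k′ , i′ , j′)) = meetsOnlyIn
    (translate (shift (base k′ i′) (base k′ j′) + anchor (base k j) (base k i)) (row k′)) (row k) i j

  field₄ : ℕ → Fin 4
  field₄ 0 = zero
  field₄ 1 = suc zero
  field₄ 2 = suc (suc zero)
  field₄ _ = suc (suc (suc zero))

  mateRow : Fin b → Fin b
  mateRow k with lookup (row k) (# 6) <? b
  ... | yes p = fromℕ< p
  ... | no _  = k

  left right : Fin b → Fin 4
  left  k = field₄ (lookup (row k) (# 5))
  right k = field₄ (lookup (row k) (# 7))

  trades : ℕ → ℕ → ℕ → ℕ → Bool
  trades x y x′ y′ = (norm₁ x y ≡ᵇ norm₁ x′ y′) ∧ (norm₂ x y ≡ᵇ norm₂ x′ y′)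

  tradesWith : Vec ℕ 8 → Vec ℕ 8 → Fin 4 → Fin 4 → Bool
  tradesWith r r′ a a′ =
    trades (point r (inject₁ a)) (point r (suc a)) (point r′ (suc a′)) (point r′ (inject₁ a′))

  mateKeys : List (ℕ × Fin b)
  mateKeys = map (λ k → toℕ (mateRow k) , k) (allFin b)

  rowOK rowTrades : Fin b → Bool
  rowOK k = separateRow (row k)
  rowTrades k = tradesWith (row k) (row (mateRow k)) (left k) (right k)

  entrySame entrySimple : Trie Entry → Entry → Bool
  entrySame t e = same e (search 20 (entryKey e) t)
  entrySimple t e = simpleAt e (search 20 (reverseKey e) t)

  -- The tree is an argument so that it is built once and shared by all tests.
  check : Trie Entry → Bool
  -- A pair of fixed points would be repeated in every translate of its block. Fixed points share a
  -- group, so such pairs are not to be covered.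
  check t = fixedTogether
          -- This makes rotations respect the groups: either a group is a single point, or the
          -- boundaries of groups are boundaries of columns.
          ∧ ((h ≡ᵇ 1) ∨ (h % m ≡ᵇ 0))
          ∧ not (v <ᵇ c * m)
          ∧ all rowOK (allFin b)
          ∧ all (entrySame t) entries
          ∧ coversColumns t
          ∧ coversFixed t
          ∧ all (entrySimple t) entries
          ∧ all rowTrades (allFin b)
          ∧ distinctKeys mateKeys

Valid : Family → Set
Valid F = Cyclic.check F (Cyclic.index F) ≡ true

∨-split : ∀ {x y} → T (x ∨ y) → T x ⊎ T y
∨-split = Equivalence.to T-∨

-- Soundness: base blocks that pass the tests generate a design

module Sound (F : Family) (valid : Valid F) where
  open Family F
  open Cyclic F

  Moves : ℕ → Set
  Moves x = x < c * m

  rotate-moving : ∀ t {x} → Moves x → rotate t x ≡ (x % m + t) % m + x / m * m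
  rotate-moving t {x} p with x <ᵇ c * m | ℕ.<⇒<ᵇ p
  ... | true | _ = refl

  rotate-fixed : ∀ t {x} → ¬ Moves x → rotate t x ≡ x
  rotate-fixed t {x} p with x <ᵇ c * m in eq
  ... | false = refl
  ... | true  = contradiction (ℕ.<ᵇ⇒< x (c * m) (subst T (sym eq) tt)) p

  data Kind (x : ℕ) : Set where
    moving : Moves x → Kind x
    still  : ¬ Moves x → Kind x

  kind : ∀ x → Kind x
  kind x with x ℕ.<? c * m
  ... | yes p = moving p
  ... | no p  = still p

  rotate-% : ∀ t {x} → Moves x → rotate t x % m ≡ (x % m + t) % m
  rotate-% t {x} p = trans (cong (_% m) (rotate-moving t p))
    (trans ([m+kn]%n≡m%n _ (x / m) m) (m%n%n≡m%n _ m))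

  rotate-/ : ∀ t {x} → Moves x → rotate t x / m ≡ x / m
  rotate-/ t {x} p = begin
    rotate t x / m                             ≡⟨ cong (_/ m) (rotate-moving t p) ⟩
    ((x % m + t) % m + x / m * m) / m          ≡⟨ +-distrib-/-∣ʳ ((x % m + t) % m) (divides (x / m) refl) ⟩
    (x % m + t) % m / m + x / m * m / m        ≡⟨ cong₂ _+_ (m<n⇒m/n≡0 (m%n<n _ m)) (m*n/n≡m (x / m) m) ⟩
    x / m                                      ∎
    where open ≡-Reasoning

  moves-/ : ∀ {x} → Moves x → x / m < c
  moves-/ {x} p = m<n*o⇒m/o<n p

  rotate-moves : ∀ t {x} → Moves x → Moves (rotate t x)
  rotate-moves t {x} p rewrite rotate-moving t p = ℕ.≤-trans
    (ℕ.+-monoˡ-< (x / m * m) (m%n<n (x % m + t) m))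
    (ℕ.*-monoˡ-≤ m (moves-/ p))

  rotate-≋ : ∀ {t t′} → t ≋ t′ → ∀ x → rotate t x ≡ rotate t′ x
  rotate-≋ {t} {t′} p x with kind x
  ... | moving q = trans (rotate-moving t q) (trans (cong (_+ x / m * m) (+-cong {x % m} refl p))
                     (sym (rotate-moving t′ q)))
  ... | still q  = trans (rotate-fixed t q) (sym (rotate-fixed t′ q))

  rotate-0 : ∀ {t} → t ≋ 0 → ∀ x → rotate t x ≡ x
  rotate-0 {t} p x with kind x
  ... | moving q = begin
    rotate t x                      ≡⟨ rotate-≋ p x ⟩
    rotate 0 x                      ≡⟨ rotate-moving 0 q ⟩
    (x % m + 0) % m + x / m * m     ≡⟨ cong (λ r → r % m + x / m * m) (ℕ.+-identityʳ (x % m)) ⟩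
    x % m % m + x / m * m           ≡⟨ cong (_+ x / m * m) (m%n%n≡m%n x m) ⟩
    x % m + x / m * m               ≡⟨ sym (m≡m%n+[m/n]*n x m) ⟩
    x                               ∎
    where open ≡-Reasoning
  ... | still q = rotate-fixed t q

  rotate-rotate : ∀ s t x → rotate s (rotate t x) ≡ rotate (t + s) x
  rotate-rotate s t x with kind x
  ... | moving q = begin
    rotate s (rotate t x)
      ≡⟨ rotate-moving s (rotate-moves t q) ⟩
    (rotate t x % m + s) % m + rotate t x / m * m
      ≡⟨ cong₂ (λ a d → (a + s) % m + d * m) (rotate-% t q) (rotate-/ t q) ⟩
    ((x % m + t) % m + s) % m + x / m * m
      ≡⟨ cong (_+ x / m * m) (+-cong {c = s} (reduce (x % m + t)) refl) ⟩
    (x % m + t + s) % m + x / m * m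
      ≡⟨ cong (λ a → a % m + x / m * m) (ℕ.+-assoc (x % m) t s) ⟩
    (x % m + (t + s)) % m + x / m * m
      ≡⟨ sym (rotate-moving (t + s) q) ⟩
    rotate (t + s) x ∎
    where open ≡-Reasoning
  ... | still q = trans (cong (rotate s) (rotate-fixed t q))
                    (trans (rotate-fixed s q) (sym (rotate-fixed (t + s) q)))

  rotate-free : ∀ {s t x} → Moves x → rotate s x ≡ rotate t x → s ≋ t
  rotate-free {s} {t} {x} q p = +-cancelʳ (x % m) (begin
    (s + x % m) % m  ≡⟨ cong (_% m) (ℕ.+-comm s (x % m)) ⟩
    (x % m + s) % m  ≡⟨ sym (rotate-% s q) ⟩
    rotate s x % m   ≡⟨ cong (_% m) p ⟩
    rotate t x % m   ≡⟨ rotate-% t q ⟩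
    (x % m + t) % m  ≡⟨ cong (_% m) (ℕ.+-comm (x % m) t) ⟩
    (t + x % m) % m  ∎)
    where open ≡-Reasoning

  rotate-still : ∀ t {x} → ¬ Moves x → ¬ Moves (rotate t x)
  rotate-still t q r = q (subst Moves (rotate-fixed t q) r)

  rotate-injective : ∀ t {x y} → rotate t x ≡ rotate t y → x ≡ y
  rotate-injective t {x} {y} p = trans (sym (undo x)) (trans (cong (rotate (m ∸ t % m)) p) (undo y))
    where
    undo : ∀ x → rotate (m ∸ t % m) (rotate t x) ≡ x
    undo x = trans (rotate-rotate (m ∸ t % m) t x) (rotate-0 (trans (+-cong {t} (sym (reduce t)) refl)
      (trans (cong (_% m) (complement t)) period)) x)

  ok : T (check index)
  ok = subst T (sym valid) tt

  fixed✓ : T (fixedTogether)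
  fixed✓ = proj₁ (∧-split {fixedTogether} ok)

  ok1 = proj₂ (∧-split {fixedTogether} ok)

  group✓ : T ((h ≡ᵇ 1) ∨ (h % m ≡ᵇ 0))
  group✓ = proj₁ (∧-split {(h ≡ᵇ 1) ∨ (h % m ≡ᵇ 0)} ok1)

  ok2 = proj₂ (∧-split {(h ≡ᵇ 1) ∨ (h % m ≡ᵇ 0)} ok1)

  room✓ : T (not (v <ᵇ c * m))
  room✓ = proj₁ (∧-split {not (v <ᵇ c * m)} ok2)

  ok3 = proj₂ (∧-split {not (v <ᵇ c * m)} ok2)

  rows✓ : T (all rowOK (allFin b))
  rows✓ = proj₁ (∧-split {all rowOK (allFin b)} ok3)

  ok4 = proj₂ (∧-split {all rowOK (allFin b)} ok3)

  same✓ : T (all (entrySame index) entries)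
  same✓ = proj₁ (∧-split {all (entrySame index) entries} ok4)

  ok5 = proj₂ (∧-split {all (entrySame index) entries} ok4)

  columns✓ : T (coversColumns index)
  columns✓ = proj₁ (∧-split {coversColumns index} ok5)

  ok6 = proj₂ (∧-split {coversColumns index} ok5)

  still✓ : T (coversFixed index)
  still✓ = proj₁ (∧-split {coversFixed index} ok6)

  ok7 = proj₂ (∧-split {coversFixed index} ok6)

  simple✓ : T (all (entrySimple index) entries)
  simple✓ = proj₁ (∧-split {all (entrySimple index) entries} ok7)

  ok8 = proj₂ (∧-split {all (entrySimple index) entries} ok7)

  trades✓ : T (all rowTrades (allFin b))
  trades✓ = proj₁ (∧-split {all rowTrades (allFin b)} ok8)

  ok9 = proj₂ (∧-split {all rowTrades (allFin b)} ok8)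

  mates✓ : T (distinctKeys mateKeys)
  mates✓ = ok9

  Sep : ℕ → ℕ → Set
  Sep = Separate v h

  separate-sound : ∀ {x y} → T (separate x y) → Sep x y
  separate-sound {x} {y} t with ∧-split {x <ᵇ v} t
  ... | p , q with ∧-split {y <ᵇ v} q
  ... | r , s = ℕ.<ᵇ⇒< x v p , ℕ.<ᵇ⇒< y v r , λ e → not-T s (ℕ.≡⇒≡ᵇ (x / h) (y / h) e)

  separate-complete : ∀ {x y} → Sep x y → ¬ T (not (separate x y))
  separate-complete {x} {y} (p , q , r) t with x <ᵇ v | ℕ.<⇒<ᵇ p | y <ᵇ v | ℕ.<⇒<ᵇ q | x / h ≡ᵇ y / h in eq
  ... | true | _ | true | _ | true  = r (ℕ.≡ᵇ⇒≡ (x / h) (y / h) (subst T (sym eq) tt))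
  ... | true | _ | true | _ | false = t

  in-fixed : ∀ {x} → x < v → ¬ Moves x → x ∈ fixed
  in-fixed {x} p q = subst (_∈ fixed) (ℕ.m+[n∸m]≡n (ℕ.≮⇒≥ q))
    (∈-map⁺ (c * m +_) (∈-downFrom⁺ (ℕ.∸-monoˡ-< p (ℕ.≮⇒≥ q))))

  -- Rotations act freely on moving points, so this makes every orbit of related pairs have full
  -- length m. A pair then determines not only the row but also the rotation of the block that
  -- contains it.
  one-moves : ∀ {x y} → Sep x y → Moves x ⊎ Moves y
  one-moves {x} {y} (p , q , r) with kind x | kind y
  ... | moving s | _        = inj₁ s
  ... | still _  | moving s = inj₂ s
  ... | still s  | still s′ = contradiction (ℕ.≡ᵇ⇒≡ (x / h) (y / h) (all-∈ (λ y → x / h ≡ᵇ y / h) fixed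
          (all-∈ (λ x → all (λ y → x / h ≡ᵇ y / h) fixed) fixed fixed✓ (in-fixed p s)) (in-fixed q s′))) r

  columns≤v : c * m ≤ v
  columns≤v = ℕ.≮⇒≥ λ p → not-T room✓ (ℕ.<⇒<ᵇ p)

  rotate-<v : ∀ t {x} → x < v → rotate t x < v
  rotate-<v t {x} p with kind x
  ... | moving q = ℕ.<-≤-trans (rotate-moves t q) columns≤v
  ... | still q  = subst (_< v) (sym (rotate-fixed t q)) p

  group-multiple : ∀ {x y} → x / m ≡ y / m → h % m ≡ 0 → x / h ≡ y / h
  group-multiple {x} {y} p q with m%n≡0⇒n∣m h m q
  ... | divides (suc k) refl = begin
    x / (suc k * m)  ≡⟨ /-congʳ {o = m * suc k} {{ℕ.m*n≢0 (suc k) m}} {{ℕ.m*n≢0 m (suc k)}} (ℕ.*-comm (suc k) m) ⟩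
    (x / (m * suc k)) {{_}} ≡⟨ sym (m/n/o≡m/[n*o] x m (suc k) {{_}} {{_}} {{ℕ.m*n≢0 m (suc k)}}) ⟩
    x / m / suc k    ≡⟨ cong (_/ suc k) p ⟩
    y / m / suc k    ≡⟨ m/n/o≡m/[n*o] y m (suc k) {{_}} {{_}} {{ℕ.m*n≢0 m (suc k)}} ⟩
    (y / (m * suc k)) {{_}} ≡⟨ /-congʳ {o = suc k * m} {{ℕ.m*n≢0 m (suc k)}} {{ℕ.m*n≢0 (suc k) m}} (ℕ.*-comm m (suc k)) ⟩
    y / (suc k * m)  ∎
    where open ≡-Reasoning

  rotate-Sep : ∀ t {x y} → Sep x y → Sep (rotate t x) (rotate t y)
  rotate-Sep t {x} {y} (p , q , r) = rotate-<v t p , rotate-<v t q , λ e → r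
    ([ trivial e , (λ d → grouped e (ℕ.≡ᵇ⇒≡ (h % m) 0 d)) ]′ (∨-split {h ≡ᵇ 1} group✓))
    where
    same-group : ∀ x → h % m ≡ 0 → rotate t x / h ≡ x / h
    same-group x d with kind x
    ... | moving s = group-multiple (rotate-/ t s) d
    ... | still s  = cong (_/ h) (rotate-fixed t s)
    grouped : rotate t x / h ≡ rotate t y / h → h % m ≡ 0 → x / h ≡ y / h
    grouped e d = trans (sym (same-group x d)) (trans e (same-group y d))
    whole : ∀ x → h ≡ 1 → x / h ≡ x
    whole x d = trans (/-congʳ d) (n/1≡n x)
    trivial : rotate t x / h ≡ rotate t y / h → T (h ≡ᵇ 1) → x / h ≡ y / h
    trivial e d = cong (_/ h) (rotate-injective t
      (trans (sym (whole _ (ℕ.≡ᵇ⇒≡ h 1 d))) (trans e (whole _ (ℕ.≡ᵇ⇒≡ h 1 d)))))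

  anchor-left : ∀ {x y} → Moves x → anchor x y ≡ x % m
  anchor-left {x} p with x <ᵇ c * m | ℕ.<⇒<ᵇ p
  ... | true | _ = refl

  anchor-right : ∀ {x y} → ¬ Moves x → anchor x y ≡ y % m
  anchor-right {x} p with x <ᵇ c * m in eq
  ... | false = refl
  ... | true  = contradiction (ℕ.<ᵇ⇒< x (c * m) (subst T (sym eq) tt)) p

  anchor-< : ∀ x y → anchor x y < m
  anchor-< x y with kind x
  ... | moving p = subst (_< m) (sym (anchor-left p)) (m%n<n x m)
  ... | still p  = subst (_< m) (sym (anchor-right p)) (m%n<n y m)

  anchor-rotate : ∀ t {x y} → Moves x ⊎ Moves y → anchor (rotate t x) (rotate t y) ≡ (anchor x y + t) % m
  anchor-rotate t {x} {y} s with kind x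
  ... | moving p = trans (anchor-left (rotate-moves t p)) (trans (rotate-% t p)
    (cong (λ a → (a + t) % m) (sym (anchor-left p))))
  anchor-rotate t (inj₁ q) | still p = contradiction q p
  anchor-rotate t (inj₂ q) | still p = trans (anchor-right (rotate-still t p)) (trans (rotate-% t q)
    (cong (λ a → (a + t) % m) (sym (anchor-right p))))

  shift+anchor : ∀ x y → shift x y + anchor x y ≡ m
  shift+anchor x y = ℕ.m∸n+n≡m (ℕ.<⇒≤ (anchor-< x y))

  restore : ∀ x y z → rotate (anchor x y) (rotate (shift x y) z) ≡ z
  restore x y z = trans (rotate-rotate (anchor x y) (shift x y) z)
    (rotate-0 (trans (cong (_% m) (shift+anchor x y)) period) z)

  shift-rotate : ∀ t {x y} → Moves x ⊎ Moves y → t + shift (rotate t x) (rotate t y) ≋ shift x y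
  shift-rotate t {x} {y} s = +-cancelʳ (anchor x y) (begin
    (t + (m ∸ anchor (rotate t x) (rotate t y)) + a) % m
      ≡⟨ cong (λ b → (t + (m ∸ b) + a) % m) (anchor-rotate t s) ⟩
    (t + (m ∸ (a + t) % m) + a) % m
      ≡⟨ cong (_% m) (trans (ℕ.+-comm _ a) (sym (ℕ.+-assoc a t _))) ⟩
    (a + t + (m ∸ (a + t) % m)) % m
      ≡⟨ +-cong {a + t} (sym (reduce (a + t))) refl ⟩
    ((a + t) % m + (m ∸ (a + t) % m)) % m
      ≡⟨ cong (_% m) (complement (a + t)) ⟩
    m % m
      ≡⟨ cong (_% m) (sym (shift+anchor x y)) ⟩
    (shift x y + a) % m ∎)
    where
    open ≡-Reasoning
    a = anchor x y

  -- Rotation by t adds t to the anchor and takes t off the shift, so the normal form depends only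
  -- on the orbit of the pair.
  norm-rotate : ∀ t {x y} → Moves x ⊎ Moves y → ∀ z →
                rotate (shift (rotate t x) (rotate t y)) (rotate t z) ≡ rotate (shift x y) z
  norm-rotate t s z = trans (rotate-rotate _ t z) (rotate-≋ (shift-rotate t s) z)

  -- The rotation that carries (x′, y′) to (x, y) when both pairs have the same norms: to the normal
  -- form first, then back from it to (x, y).
  transfer : ℕ → ℕ → ℕ → ℕ → ℕ
  transfer x y x′ y′ = shift x′ y′ + anchor x y

  same-norm : ∀ x y x′ y′ {z z′} → rotate (shift x y) z ≡ rotate (shift x′ y′) z′ →
              z ≡ rotate (transfer x y x′ y′) z′
  same-norm x y x′ y′ {z} {z′} p = trans (sym (restore x y z))
    (trans (cong (rotate (anchor x y)) p) (rotate-rotate (anchor x y) (shift x′ y′) z′))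

  key-rotate : ∀ t {x y} → Moves x ⊎ Moves y → key (rotate t x) (rotate t y) ≡ key x y
  key-rotate t {x} {y} s = cong₂ (λ p q → p * 1024 + q) (norm-rotate t s x) (norm-rotate t s y)

  base-separate : ∀ k {i j} → i ≢ j → Sep (base k i) (base k j)
  base-separate k {i} {j} i≢j = [ (λ e → contradiction (toℕ-injective (ℕ.≡ᵇ⇒≡ (toℕ i) (toℕ j) e)) i≢j) ,
    separate-sound ]′ (∨-split {toℕ i ≡ᵇ toℕ j} (all-∈ (separateAt (row k) i) (allFin 5)
      (all-∈ (λ i → all (separateAt (row k) i) (allFin 5)) (allFin 5)
        (all-∈ rowOK (allFin b) rows✓ (∈-allFin k)) (∈-allFin i)) (∈-allFin j)))

  base-distinct : ∀ k {i j} → base k i ≡ base k j → i ≡ j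
  base-distinct k {i} {j} p with i Fin.≟ j
  ... | yes q = q
  ... | no q  = contradiction (cong (_/ h) p) (proj₂ (proj₂ (base-separate k q)))

  ∈-entries : ∀ k {i j} → i <ᶠ j → (k , i , j) ∈ entries
  ∈-entries k i<j = ∈-cartesianProduct⁺ (∈-allFin k) (∈-pairs i<j)

  same-sound : ∀ {e} x → T (same e x) → x ≡ just e
  same-sound {k , i , j} (just (k′ , i′ , j′)) t with ∧-split {toℕ k ≡ᵇ toℕ k′} t
  ... | p , q with ∧-split {toℕ i ≡ᵇ toℕ i′} q
  ... | r , s = cong just (sym (cong₂ _,_ (toℕ-injective (ℕ.≡ᵇ⇒≡ (toℕ k) (toℕ k′) p))
          (cong₂ _,_ (toℕ-injective (ℕ.≡ᵇ⇒≡ (toℕ i) (toℕ i′) r)) (toℕ-injective (ℕ.≡ᵇ⇒≡ (toℕ j) (toℕ j′) s)))))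

  located : ∀ {e} → e ∈ entries → search 20 (entryKey e) index ≡ just e
  located {e} p = same-sound (search 20 (entryKey e) index) (all-∈ (entrySame index) entries same✓ p)

  entry-unique : ∀ {e e′} → e ∈ entries → e′ ∈ entries → entryKey e ≡ entryKey e′ → e ≡ e′
  entry-unique p q r = just-injective (trans (sym (located p)) (trans (cong (λ n → search 20 n index) r) (located q)))

  covers-sound : ∀ x y → Sep x y → T (covers index x y) → ∃ λ k → ∃₂ λ i j → i <ᶠ j ×
                 norm₁ (base k i) (base k j) ≡ x × norm₂ (base k i) (base k j) ≡ y
  covers-sound x y s t = [ (λ e → ⊥-elim (separate-complete s e)) , from (search 20 (x * 1024 + y) index) ]′
    (∨-split {not (separate x y)} t)
    where
    from : ∀ e → T (hit x y e) → ∃ λ k → ∃₂ λ i j → i <ᶠ j ×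
           norm₁ (base k i) (base k j) ≡ x × norm₂ (base k i) (base k j) ≡ y
    from (just (k , i , j)) u with ∧-split {toℕ i <ᵇ toℕ j} u
    ... | p , q with ∧-split {norm₁ (base k i) (base k j) ≡ᵇ x} q
    ... | r , w = k , i , j , ℕ.<ᵇ⇒< (toℕ i) (toℕ j) p , ℕ.≡ᵇ⇒≡ (norm₁ (base k i) (base k j)) x r ,
      ℕ.≡ᵇ⇒≡ (norm₂ (base k i) (base k j)) y w

  to-column : ∀ {x} → Moves x → ∀ {t} → t ≡ m ∸ x % m → rotate t x ≡ x / m * m
  to-column {x} p refl = trans (rotate-moving _ p) (cong (_+ x / m * m)
    (trans (cong (_% m) (complement x)) (n%n≡0 m)))

  norm-covered : ∀ {x y} → Sep x y → T (covers index (norm₁ x y) (norm₂ x y))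
  norm-covered {x} {y} s@(p , q , r) with kind x | one-moves s
  ... | moving u | _ = subst (λ z → T (covers index z (norm₂ x y)))
    (sym (to-column u (cong (m ∸_) (anchor-left u))))
    (all-∈ (covers index (x / m * m)) (downFrom v) (all-∈ (λ j → all (covers index (j * m)) (downFrom v))
      (downFrom c) columns✓ (∈-downFrom⁺ (moves-/ u)))
      (∈-downFrom⁺ (rotate-<v (shift x y) q)))
  ... | still u | inj₁ w = contradiction w u
  ... | still u | inj₂ w = subst₂ (λ a b → T (covers index a b))
    (sym (rotate-fixed (shift x y) u)) (sym (to-column w (cong (m ∸_) (anchor-right u))))
    (all-∈ (λ j → covers index x (j * m)) (downFrom c) (all-∈ (λ z → all (λ j → covers index z (j * m))
      (downFrom c)) fixed still✓ (in-fixed p u)) (∈-downFrom⁺ (moves-/ w)))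

  Position : Set
  Position = Fin b × Fin m

  block : Position → Fin 5 → ℕ
  block (k , t) i = rotate (toℕ t) (base k i)

  residue : ℕ → Fin m
  residue t = fromℕ< (m%n<n t m)

  rotate-residue : ∀ t x → rotate (toℕ (residue t)) x ≡ rotate t x
  rotate-residue t x = rotate-≋ (trans (cong (_% m) (toℕ-fromℕ< _)) (reduce t)) x

  base-moves : ∀ k {i j} → i ≢ j → Moves (base k i) ⊎ Moves (base k j)
  base-moves k i≢j = one-moves (base-separate k i≢j)

  determined : ∀ k {i j} → i ≢ j → ∀ {s t} → rotate s (base k i) ≡ rotate t (base k i) →
               rotate s (base k j) ≡ rotate t (base k j) → s ≋ t
  determined k i≢j p q = [ (λ w → rotate-free w p) , (λ w → rotate-free w q) ]′ (base-moves k i≢j)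

  fin-≋ : ∀ {s t : Fin m} → toℕ s ≋ toℕ t → s ≡ t
  fin-≋ {s} {t} p = toℕ-injective (small (toℕ<n s) (toℕ<n t) p)

  <ᶠ⇒≢ : ∀ {i j : Fin 5} → i <ᶠ j → i ≢ j
  <ᶠ⇒≢ i<j refl = ℕ.<-irrefl refl i<j

  block-key : ∀ {k t k′ t′ i j i′ j′} → i ≢ j → i′ ≢ j′ →
              block (k , t) i ≡ block (k′ , t′) i′ → block (k , t) j ≡ block (k′ , t′) j′ →
              key (base k i) (base k j) ≡ key (base k′ i′) (base k′ j′)
  block-key {k} {t} {k′} {t′} i≢j i′≢j′ p q = trans (sym (key-rotate (toℕ t) (base-moves k i≢j)))
    (trans (cong₂ key p q) (key-rotate (toℕ t′) (base-moves k′ i′≢j′)))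

  block-unique : ∀ {κ κ′ i j i′ j′} → i <ᶠ j → i′ <ᶠ j′ →
                 block κ i ≡ block κ′ i′ → block κ j ≡ block κ′ j′ → κ ≡ κ′
  block-unique {k , t} {k′ , t′} {i} {j} {i′} {j′} i<j i′<j′ p q =
    from (entry-unique (∈-entries k i<j) (∈-entries k′ i′<j′)
      (block-key {t = t} {t′ = t′} (<ᶠ⇒≢ i<j) (<ᶠ⇒≢ i′<j′) p q)) p q
    where
    from : ∀ {k′ i′ j′} → (k , i , j) ≡ (k′ , i′ , j′) → block (k , t) i ≡ block (k′ , t′) i′ →
           block (k , t) j ≡ block (k′ , t′) j′ → (k , t) ≡ (k′ , t′)
    from refl p q = cong (k ,_) (fin-≋ (determined k (<ᶠ⇒≢ i<j) p q))

  block-covered : ∀ {x y} → Sep x y → ∃ λ κ → ∃₂ λ i j → i <ᶠ j × block κ i ≡ x × block κ j ≡ y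
  block-covered {x} {y} s = from (covers-sound (norm₁ x y) (norm₂ x y) (rotate-Sep (shift x y) s) (norm-covered s))
    where
    from : (∃ λ k → ∃₂ λ i j → i <ᶠ j × norm₁ (base k i) (base k j) ≡ norm₁ x y ×
            norm₂ (base k i) (base k j) ≡ norm₂ x y) →
           ∃ λ κ → ∃₂ λ i j → i <ᶠ j × block κ i ≡ x × block κ j ≡ y
    from (k , i , j , i<j , p , q) = (k , residue t) , i , j , i<j ,
      trans (rotate-residue t _) (sym (same-norm x y (base k i) (base k j) (sym p))) ,
      trans (rotate-residue t _) (sym (same-norm x y (base k i) (base k j) (sym q)))
      where t = transfer x y (base k i) (base k j)

  norms : ∀ {x y x′ y′ s t} → Moves x ⊎ Moves y → Moves x′ ⊎ Moves y′ →
          rotate s x ≡ rotate t x′ → rotate s y ≡ rotate t y′ →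
          norm₁ x y ≡ norm₁ x′ y′ × norm₂ x y ≡ norm₂ x′ y′
  norms {x} {y} {x′} {y′} {s} {t} u w p q =
    trans (sym (norm-rotate s u x)) (trans (cong₂ norm₁ p q) (norm-rotate t w x′)) ,
    trans (sym (norm-rotate s u y)) (trans (cong₂ norm₂ p q) (norm-rotate t w y′))

  -- Two common points in the same order make the blocks equal by uniqueness. In opposite orders,
  -- the row of κ′ is found under the reversed key of κ, and the test on base blocks excludes a
  -- third common point once its rotation u is seen to be the relative rotation of the two blocks.
  no-triple : ∀ {κ κ′} → κ ≢ κ′ → ∀ {a b c a′ b′ c′} → a <ᶠ b → a ≢ c → b ≢ c →
              block κ a ≡ block κ′ a′ → block κ b ≡ block κ′ b′ → block κ c ≡ block κ′ c′ → ⊥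
  no-triple {k , t} {k′ , t′} κ≢κ′ {a} {b} {c} {a′} {b′} {c′} a<b a≢c b≢c p q r =
    from (order {i = a′} {b′} λ { refl → <ᶠ⇒≢ a<b (base-distinct k (rotate-injective (toℕ t) (trans p (sym q)))) })
    where
    from : Order a′ b′ → ⊥
    from (below a′<b′) = κ≢κ′ (block-unique a<b a′<b′ p q)
    from (above b′<a′) = not-T (all-∈ (λ y → not (y ≡ᵇ base k c)) (translate u (row k′)) avoids✓
      (∈-map⁺ (λ l → rotate u (base k′ l)) (∈-allFin c′))) (ℕ.≡⇒≡ᵇ (rotate u (base k′ c′)) (base k c) third)
      where
      e = k , a , b
      e′ = k′ , b′ , a′
      b≢a = ≢-sym (<ᶠ⇒≢ a<b)
      found : search 20 (reverseKey e) index ≡ just e′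
      found = trans (cong (λ n → search 20 n index)
        (block-key {t = t} {t′ = t′} b≢a (<ᶠ⇒≢ b′<a′) q p)) (located (∈-entries k′ b′<a′))
      u = transfer (base k b) (base k a) (base k′ b′) (base k′ a′)
      meets : T (meetsOnlyIn (translate u (row k′)) (row k) a b)
      meets = subst (λ x → T (simpleAt e x)) found (all-∈ (entrySimple index) entries simple✓ (∈-entries k a<b))
      avoids✓ : T (avoids (translate u (row k′)) (base k c))
      avoids✓ = [ (λ w → contradiction (toℕ-injective (ℕ.≡ᵇ⇒≡ (toℕ c) (toℕ a) w)) (≢-sym a≢c)) ,
        (λ w → [ (λ w′ → contradiction (toℕ-injective (ℕ.≡ᵇ⇒≡ (toℕ c) (toℕ b) w′)) (≢-sym b≢c)) , (λ w′ → w′) ]′ (∨-split {toℕ c ≡ᵇ toℕ b} w)) ]′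
        (∨-split {toℕ c ≡ᵇ toℕ a} (all-∈ (onlyIn (translate u (row k′)) (row k) a b) (allFin 5) meets (∈-allFin c)))
      nrm = norms {s = toℕ t} {t = toℕ t′} (base-moves k b≢a) (base-moves k′ (<ᶠ⇒≢ b′<a′)) q p
      at-b : base k b ≡ rotate u (base k′ b′)
      at-b = same-norm (base k b) (base k a) (base k′ b′) (base k′ a′) (proj₁ nrm)
      at-a : base k a ≡ rotate u (base k′ a′)
      at-a = same-norm (base k b) (base k a) (base k′ b′) (base k′ a′) (proj₂ nrm)
      -- A pair with a moving point determines the rotation of its block; hence what was tested with
      -- κ at rotation 0 applies to rotations t and t′.
      u+t≋t′ : u + toℕ t ≋ toℕ t′
      u+t≋t′ = determined k′ (<ᶠ⇒≢ b′<a′)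
        (trans (sym (rotate-rotate (toℕ t) u _)) (trans (cong (rotate (toℕ t)) (sym at-b)) q))
        (trans (sym (rotate-rotate (toℕ t) u _)) (trans (cong (rotate (toℕ t)) (sym at-a)) p))
      third : rotate u (base k′ c′) ≡ base k c
      third = rotate-injective (toℕ t) (trans (rotate-rotate (toℕ t) u _)
        (trans (rotate-≋ u+t≋t′ _) (sym r)))

  mateShift : Fin b → ℕ
  mateShift k = transfer (base k (inject₁ (left k))) (base k (suc (left k)))
    (base (mateRow k) (suc (right k))) (base (mateRow k) (inject₁ (right k)))

  mates : Position → Position
  mates (k , t) = mateRow k , residue (mateShift k + toℕ t)

  row-trades : ∀ k → T (rowTrades k)
  row-trades k = all-∈ rowTrades (allFin b) trades✓ (∈-allFin k)

  mateRow-injective : ∀ {k k′} → mateRow k ≡ mateRow k′ → k ≡ k′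
  mateRow-injective {k} {k′} p = distinctKeys-sound mateKeys mates✓
    (∈-map⁺ (λ k → toℕ (mateRow k) , k) (∈-allFin k))
    (subst (λ r → (toℕ r , k′) ∈ mateKeys) (sym p) (∈-map⁺ (λ k → toℕ (mateRow k) , k) (∈-allFin k′)))

  -- The rows are permuted because the keys in `mateKeys` are distinct, and within one row the
  -- rotation only changes by the constant `mateShift k`.
  mates-injective : ∀ {κ κ′} → mates κ ≡ mates κ′ → κ ≡ κ′
  mates-injective {k , t} {k′ , t′} p = from (mateRow-injective (cong proj₁ p)) p
    where
    from : ∀ {k′} → k ≡ k′ → mates (k , t) ≡ mates (k′ , t′) → (k , t) ≡ (k′ , t′)
    from refl p = cong (k ,_) (fin-≋ (+-cancelʳ (mateShift k) (begin
      (toℕ t + mateShift k) % m             ≡⟨ cong (_% m) (ℕ.+-comm (toℕ t) _) ⟩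
      (mateShift k + toℕ t) % m             ≡⟨ sym (toℕ-fromℕ< _) ⟩
      toℕ (residue (mateShift k + toℕ t))   ≡⟨ cong (toℕ ∘ proj₂) p ⟩
      toℕ (residue (mateShift k + toℕ t′))  ≡⟨ toℕ-fromℕ< _ ⟩
      (mateShift k + toℕ t′) % m            ≡⟨ cong (_% m) (ℕ.+-comm _ (toℕ t′)) ⟩
      (toℕ t′ + mateShift k) % m            ∎)))
      where open ≡-Reasoning

  swaps : ∀ κ → ∃₂ λ a a′ → block κ (inject₁ a) ≡ block (mates κ) (suc a′) ×
                            block κ (suc a) ≡ block (mates κ) (inject₁ a′)
  swaps (k , t) = left k , right k , moved (proj₁ eqs) , moved (proj₂ eqs)
    where
    x = base k (inject₁ (left k))
    y = base k (suc (left k))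
    x′ = base (mateRow k) (suc (right k))
    y′ = base (mateRow k) (inject₁ (right k))
    eqs : norm₁ x y ≡ norm₁ x′ y′ × norm₂ x y ≡ norm₂ x′ y′
    eqs = from (∧-split {norm₁ x y ≡ᵇ norm₁ x′ y′} (row-trades k))
      where
      from : T (norm₁ x y ≡ᵇ norm₁ x′ y′) × T (norm₂ x y ≡ᵇ norm₂ x′ y′) →
             norm₁ x y ≡ norm₁ x′ y′ × norm₂ x y ≡ norm₂ x′ y′
      from (p , q) = ℕ.≡ᵇ⇒≡ (norm₁ x y) (norm₁ x′ y′) p , ℕ.≡ᵇ⇒≡ (norm₂ x y) (norm₂ x′ y′) q
    moved : ∀ {z z′} → rotate (shift x y) z ≡ rotate (shift x′ y′) z′ →
            rotate (toℕ t) z ≡ rotate (toℕ (residue (mateShift k + toℕ t))) z′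
    moved {z} {z′} p = trans (cong (rotate (toℕ t)) (same-norm x y x′ y′ p))
      (trans (rotate-rotate (toℕ t) (mateShift k) z′) (sym (rotate-residue (mateShift k + toℕ t) z′)))

  design : Design Sep
  design = record
    { Index       = Position
    ; count       = b * m
    ; enum        = ↔-sym *↔×
    ; block       = block
    ; distinct    = λ { (k , t) p → base-distinct k (rotate-injective (toℕ t) p) }
    ; related     = λ { (k , t) i≢j → rotate-Sep (toℕ t) (base-separate k i≢j) }
    ; covered     = block-covered
    ; unique      = block-unique
    ; superSimple = triple
    ; mate        = mates
    ; mate-inj    = mates-injective
    ; swap        = swaps
    }
    where
    triple : ∀ {κ κ′} → κ ≢ κ′ → ∀ {a b c a′ b′ c′} → a ≢ b → a ≢ c → b ≢ c →
             block κ a ≡ block κ′ a′ → block κ b ≡ block κ′ b′ → block κ c ≡ block κ′ c′ → ⊥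
    triple κ≢κ′ a≢b a≢c b≢c p q r with order a≢b
    ... | below a<b = no-triple κ≢κ′ a<b a≢c b≢c p q r
    ... | above b<a = no-triple κ≢κ′ b<a b≢c a≢c q p r

-- Decomposing and transporting designs

↔-injective : ∀ {A B : Set} (e : A ↔ B) {x y} → Inverse.to e x ≡ Inverse.to e y → x ≡ y
↔-injective e p = trans (sym (Inverse.strictlyInverseʳ e _))
  (trans (cong (Inverse.from e) p) (Inverse.strictlyInverseʳ e _))

Finite : Set → Set
Finite A = ∃ λ n → A ↔ Fin n

Σ-suc : ∀ {n} (Y : Fin (suc n) → Set) → Σ (Fin (suc n)) Y ↔ (Y zero ⊎ Σ (Fin n) (Y ∘ suc))
Σ-suc Y = mk↔ₛ′ (λ { (zero , y) → inj₁ y ; (suc i , y) → inj₂ (i , y) })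
  (λ { (inj₁ y) → zero , y ; (inj₂ (i , y)) → suc i , y })
  (λ { (inj₁ y) → refl ; (inj₂ y) → refl }) (λ { (zero , y) → refl ; (suc i , y) → refl })

Σ-Fin-finite : ∀ n (Y : Fin n → Set) → (∀ i → Finite (Y i)) → Finite (Σ (Fin n) Y)
Σ-Fin-finite zero    Y f = 0 , mk↔ₛ′ (λ { (() , _) }) (λ ()) (λ ()) (λ { (() , _) })
Σ-Fin-finite (suc n) Y f with f zero | Σ-Fin-finite n (Y ∘ suc) (f ∘ suc)
... | a , p | b , q = a + b , ↔-sym +↔⊎ ↔-∘ ((p ⊎-↔ q) ↔-∘ Σ-suc Y)

Σ-finite : ∀ {I : Set} → Finite I → (X : I → Set) → (∀ i → Finite (X i)) → Finite (Σ I X)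
Σ-finite (n , e) X f with Σ-Fin-finite n (X ∘ Inverse.from e) (f ∘ Inverse.from e)
... | c , p = c , p ↔-∘ ↔-sym (Σ-↔ (↔-sym e) (↔-id _))

-- A decomposition of a relation into pieces with designs has a design. Blocks
-- of different pieces share at most one point, so super-simplicity is inherited.
module Amalgam {P I : Set} (R : P → P → Set) (fin : Finite I)
  {Q : I → Set} {S : ∀ i → Q i → Q i → Set} (D : ∀ i → Design (S i)) (f : ∀ i → Q i → P)
  (injective : ∀ i {p q p′ q′} → S i p q → S i p′ q′ → f i p ≡ f i p′ → p ≡ p′)
  (sound     : ∀ i {p q} → S i p q → R (f i p) (f i q))
  (complete  : ∀ {x y} → R x y → ∃ λ i → ∃₂ λ p q → S i p q × f i p ≡ x × f i q ≡ y)
  (separate  : ∀ {i j p q p′ q′} → S i p q → S j p′ q′ → f i p ≡ f j p′ → f i q ≡ f j q′ → i ≡ j)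
  where
  open Design

  Position : Set
  Position = Σ I (Index ∘ D)

  blk : Position → Fin 5 → P
  blk (i , k) a = f i (block (D i) k a)

  -- Injectivity of the embeddings is assumed only for points that occur in a related pair. A second
  -- position of the block supplies such a pair for each of its points.
  another : (a : Fin 5) → ∃ λ b → a ≢ b
  another zero    = suc zero , λ ()
  another (suc a) = zero , λ ()

  point-injective : ∀ i {k k′ a a′} → blk (i , k) a ≡ blk (i , k′) a′ → block (D i) k a ≡ block (D i) k′ a′
  point-injective i {k} {k′} {a} {a′} = injective i (related (D i) k (proj₂ (another a)))
    (related (D i) k′ (proj₂ (another a′)))

  same-piece : ∀ {i k j k′ a b a′ b′} → a ≢ b → a′ ≢ b′ → blk (i , k) a ≡ blk (j , k′) a′ →
               blk (i , k) b ≡ blk (j , k′) b′ → i ≡ j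
  same-piece {i} {k} {j} {k′} a≢b a′≢b′ = separate (related (D i) k a≢b) (related (D j) k′ a′≢b′)

  blk-distinct : ∀ κ {a b} → blk κ a ≡ blk κ b → a ≡ b
  blk-distinct (i , k) p = distinct (D i) k (point-injective i p)

  mate′ : Position → Position
  mate′ (i , k) = i , mate (D i) k

  amalgam : Design R
  amalgam = record
    { Index       = Position
    ; count       = proj₁ finite
    ; enum        = proj₂ finite
    ; block       = blk
    ; distinct    = blk-distinct
    ; related     = λ { (i , k) a≢b → sound i (related (D i) k a≢b) }
    ; covered     = covered′
    ; unique      = unique′
    ; superSimple = superSimple′
    ; mate        = mate′
    ; mate-inj    = mate-inj′
    ; swap        = λ { (i , k) → let a , b , p , q = swap (D i) k in a , b , cong (f i) p , cong (f i) q }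
    }
    where
    finite = Σ-finite fin (Index ∘ D) (λ i → count (D i) , enum (D i))
    covered′ : ∀ {x y} → R x y → ∃ λ κ → ∃₂ λ a b → a <ᶠ b × blk κ a ≡ x × blk κ b ≡ y
    covered′ xRy with complete xRy
    ... | i , p , q , s , refl , refl with covered (D i) s
    ... | k , a , b , a<b , u , w = (i , k) , a , b , a<b , cong (f i) u , cong (f i) w
    unique′ : ∀ {κ κ′ a b a′ b′} → a <ᶠ b → a′ <ᶠ b′ → blk κ a ≡ blk κ′ a′ → blk κ b ≡ blk κ′ b′ → κ ≡ κ′
    unique′ {i , k} {j , k′} a<b a′<b′ p q
      with same-piece (Fin.<⇒≢ a<b) (Fin.<⇒≢ a′<b′) p q
    ... | refl = cong (i ,_) (unique (D i) a<b a′<b′ (point-injective i p) (point-injective i q))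
    superSimple′ : ∀ {κ κ′} → κ ≢ κ′ → ∀ {a b c a′ b′ c′} → a ≢ b → a ≢ c → b ≢ c →
      blk κ a ≡ blk κ′ a′ → blk κ b ≡ blk κ′ b′ → blk κ c ≡ blk κ′ c′ → ⊥
    superSimple′ {i , k} {j , k′} κ≢κ′ a≢b a≢c b≢c p q r
      with same-piece a≢b (λ { refl → a≢b (blk-distinct (i , k) (trans p (sym q))) }) p q
    ... | refl = superSimple (D i) (κ≢κ′ ∘ cong (i ,_)) a≢b a≢c b≢c
      (point-injective i p) (point-injective i q) (point-injective i r)
    mate-inj′ : ∀ {κ κ′} → mate′ κ ≡ mate′ κ′ → κ ≡ κ′
    mate-inj′ {i , k} {j , k′} p with ,-injectiveˡ p
    ... | refl = cong (i ,_) (mate-inj (D i) (,-injectiveʳ p))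

-- Only points that occur in a related pair need a preimage under e. So the designs built on ℕ,
-- whose relation confines points to those below v, can be moved to `Fin v` or to `Points g z`.
pullback : ∀ {P P′ : Set} {R : P → P → Set} {R′ : P′ → P′ → Set} (e : P′ → P) →
           (∀ {x y} → e x ≡ e y → x ≡ y) → (∀ {x y} → R′ x y → R (e x) (e y)) →
           (∀ {x y} → R (e x) (e y) → R′ x y) → (∀ {p q} → R p q → ∃ λ x → e x ≡ p) →
           Design R → Design R′
pullback {P} {P′} {R} {R′} e e-inj to from image D = record
  { Index       = Index
  ; count       = count
  ; enum        = enum
  ; block       = blk
  ; distinct    = λ k {a} {b} p → distinct k (trans (sym (eq k a)) (trans (cong e p) (eq k b)))
  ; related     = λ k {a} {b} a≢b → from (subst₂ R (sym (eq k a)) (sym (eq k b)) (related k a≢b))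
  ; covered     = λ xRy → let k , a , b , a<b , p , q = covered (to xRy) in
                    k , a , b , a<b , e-inj (trans (eq k a) p) , e-inj (trans (eq k b) q)
  ; unique      = λ a<b a′<b′ p q → unique a<b a′<b′ (down p) (down q)
  ; superSimple = λ k≢k′ a≢b a≢c b≢c p q r → superSimple k≢k′ a≢b a≢c b≢c (down p) (down q) (down r)
  ; mate        = mate
  ; mate-inj    = mate-inj
  ; swap        = λ k → let a , b , p , q = swap k in a , b , up p , up q
  }
  where
  open Design D
  another : (a : Fin 5) → ∃ λ b → a ≢ b
  another zero    = suc zero , λ ()
  another (suc a) = zero , λ ()
  blk : Index → Fin 5 → P′
  blk k a = proj₁ (image (related k (proj₂ (another a))))
  eq : ∀ k a → e (blk k a) ≡ block k a
  eq k a = proj₂ (image (related k (proj₂ (another a))))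
  down : ∀ {k k′ a a′} → blk k a ≡ blk k′ a′ → block k a ≡ block k′ a′
  down {k} {k′} {a} {a′} p = trans (sym (eq k a)) (trans (cong e p) (eq k′ a′))
  up : ∀ {k k′ a a′} → block k a ≡ block k′ a′ → blk k a ≡ blk k′ a′
  up {k} {k′} {a} {a′} p = e-inj (trans (eq k a) (trans p (sym (eq k′ a′))))

rename : ∀ {P P′ : Set} → P ↔ P′ → Complete P → Complete P′
rename e = pullback (Inverse.from e) (↔-injective (↔-sym e)) (λ x≢y p → x≢y (↔-injective (↔-sym e) p))
  (λ p q → p (cong (Inverse.from e) q)) (λ {p} _ → Inverse.to e p , Inverse.strictlyInverseʳ e p)

Good : ℕ → Set₁
Good v = Complete (Fin v)

-- Defining sets and the bound one half

rank : ∀ {n} (S : Subset n) {x} → x ∈ˢ S → Fin ∣ S ∣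
rank (inside ∷ S)  {zero}  here      = zero
rank (inside ∷ S)  {suc x} (there p) = suc (rank S p)
rank (outside ∷ S) {suc x} (there p) = rank S p

rank-injective : ∀ {n} (S : Subset n) {x y} (p : x ∈ˢ S) (q : y ∈ˢ S) → rank S p ≡ rank S q → x ≡ y
rank-injective (inside ∷ S)  here      here      e = refl
rank-injective (inside ∷ S)  (there p) (there q) e = cong suc (rank-injective S p q (Fin.suc-injective e))
rank-injective (outside ∷ S) (there p) (there q) e = cong suc (rank-injective S p q e)

-- Members of S go to one copy of S by their own rank, all others to a second copy by the rank of
-- their image under f. Both parts are injective, so n is at most the size of two copies.
half : ∀ {n} (S : Subset n) (f : Fin n → Fin n) → (∀ {k k′} → f k ≡ f k′ → k ≡ k′) →
       (∀ k → k ∉ˢ S → f k ∈ˢ S) → n ≤ 2 * ∣ S ∣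
half {n} S f f-inj hits = subst (n ≤_) (cong (∣ S ∣ +_) (sym (ℕ.+-identityʳ ∣ S ∣)))
  (injective⇒≤ {f = Fin.join ∣ S ∣ ∣ S ∣ ∘ side} (λ {x} {y} p → side-inj x y
    (trans (sym (Fin.splitAt-join _ _ (side x))) (trans (cong (Fin.splitAt ∣ S ∣) p) (Fin.splitAt-join _ _ (side y))))))
  where
  side : Fin n → Fin ∣ S ∣ ⊎ Fin ∣ S ∣
  side k with k ∈? S
  ... | yes p = inj₁ (rank S p)
  ... | no p  = inj₂ (rank S (hits k p))
  inj₁≡ : ∀ {A B : Set} {a b : A} → inj₁ {B = B} a ≡ inj₁ b → a ≡ b
  inj₁≡ refl = refl
  inj₂≡ : ∀ {A B : Set} {a b : B} → inj₂ {A = A} a ≡ inj₂ b → a ≡ b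
  inj₂≡ refl = refl
  side-inj : ∀ x y → side x ≡ side y → x ≡ y
  side-inj x y e with x ∈? S | y ∈? S
  ... | yes p | yes q = rank-injective S p q (inj₁≡ e)
  side-inj x y () | yes p | no q
  side-inj x y () | no p | yes q
  ... | no p  | no q  = f-inj (rank-injective S (hits x p) (hits y q) (inj₂≡ e))

module Final {v} (D : Good v) where
  open Design D

  to : Index → Fin count
  to = Inverse.to enum
  from : Fin count → Index
  from = Inverse.from enum

  from-inj : ∀ {k k′} → from k ≡ from k′ → k ≡ k′
  from-inj = ↔-injective (↔-sym enum)
  to-inj : ∀ {k k′} → to k ≡ to k′ → k ≡ k′
  to-inj = ↔-injective enum
  from-to : ∀ k → from (to k) ≡ k
  from-to = Inverse.strictlyInverseʳ enum

  _≟ⁱ_ : (k k′ : Index) → Dec (k ≡ k′)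
  k ≟ⁱ k′ = map′ to-inj (cong to) (to k Fin.≟ to k′)

  collect : (Index → Fin 5 → Fin v) → Collection v
  collect B = mkCollection count (λ k → tabulate (B (from k)))

  at : ∀ B k i → lookup (blocks (collect B) k) i ≡ B (from k) i
  at B k = lookup∘tabulate (B (from k))

  isDD : ∀ B → (∀ k {i j} → B k i ≡ B k j → i ≡ j) →
         (∀ {x y} → x ≢ y → ∃ λ k → ∃₂ λ i j → i <ᶠ j × B k i ≡ x × B k j ≡ y) →
         (∀ {k k′ i j i′ j′} → i <ᶠ j → i′ <ᶠ j′ → B k i ≡ B k′ i′ → B k j ≡ B k′ j′ → k ≡ k′) →
         IsDD (collect B)
  isDD B B-distinct B-covered B-unique =
    (λ k i j p → B-distinct (from k) (trans (sym (at B k i)) (trans p (at B k j)))) , pair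
    where
    pair : ∀ x y → x ≢ y → ∃ λ k → OccursIn x y (blocks (collect B) k) ×
           (∀ k′ → OccursIn x y (blocks (collect B) k′) → k′ ≡ k)
    pair x y x≢y with B-covered x≢y
    ... | k , i , j , i<j , p , q = to k , (i , j , i<j , trans (at′ i) p , trans (at′ j) q) ,
      λ { k′ (i′ , j′ , i′<j′ , p′ , q′) → from-inj (B-unique i′<j′ i<j
            (trans (sym (at B k′ i′)) (trans p′ (trans (sym p) (sym (back i)))))
            (trans (sym (at B k′ j′)) (trans q′ (trans (sym q) (sym (back j)))))) }
      where
      back : ∀ i → B (from (to k)) i ≡ B k i
      back i = cong (λ k → B k i) (from-to k)
      at′ : ∀ i → lookup (blocks (collect B) (to k)) i ≡ B k i
      at′ i = trans (at B (to k) i) (back i)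

  directed : IsDD (collect block)
  directed = isDD block distinct covered unique

  simple : SuperSimple (collect block)
  simple k k′ k≢k′ x y z x≢y x≢z y≢z (a , p) (b , q) (c , r) (a′ , p′) (b′ , q′) (c′ , r′) =
    superSimple (k≢k′ ∘ from-inj) (apart a b p q x≢y) (apart a c p r x≢z) (apart b c q r y≢z)
      (meet a a′ p p′) (meet b b′ q q′) (meet c c′ r r′)
    where
    apart : ∀ {x y} a b → lookup (blocks (collect block) k) a ≡ x → lookup (blocks (collect block) k) b ≡ y →
            x ≢ y → a ≢ b
    apart a b p q x≢y refl = x≢y (trans (sym p) q)
    meet : ∀ {x} a a′ → lookup (blocks (collect block) k) a ≡ x → lookup (blocks (collect block) k′) a′ ≡ x →
           block (from k) a ≡ block (from k′) a′
    meet a a′ p p′ = trans (sym (at block k a)) (trans p (trans (sym p′) (at block k′ a′)))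

  -- If S misses a block and its mate, then exchanging the two common points in
  -- both gives another directed design containing S.
  meets-pairs : ∀ S → IsDefiningSet (collect block) S → ∀ k → k ∉ˢ S → to (mate (from k)) ∈ˢ S
  meets-pairs S defining k k∉S with to (mate (from k)) ∈? S
  ... | yes p = p
  ... | no p  = ⊥-elim (clash (proj₁ same k))
    where
    open Trade D (from k) _≟ⁱ_
    E = collect block′
    unchanged : ∀ j → j ∈ˢ S → BlockOf (blocks (collect block) j) E
    unchanged j j∈S = j , tabulate-cong (λ i → by i (role (from j)))
      where
      by : ∀ i (r : Role (from j)) → block (from j) (shuffle r i) ≡ block (from j) i
      by i (first q)   = contradiction (subst (_∈ˢ S) (from-inj q) j∈S) k∉S
      by i (second q)  = contradiction (subst (_∈ˢ S) (trans (sym (Inverse.strictlyInverseˡ enum j)) (cong to q)) j∈S) p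
      by i (other _ _) = refl
    same : SameBlocks E (collect block)
    same = defining E (isDD block′ distinct′ covered′ unique′) unchanged
    clash : ¬ BlockOf (blocks E k) (collect block)
    clash (j , q) = new-block (from j) λ i → trans (sym (at block j i))
      (trans (cong (λ t → lookup t i) q) (at block′ k i))

  atLeastHalf : fAtLeastHalf (collect block)
  atLeastHalf S defining = half S (λ k → to (mate (from k))) (from-inj ∘ mate-inj ∘ to-inj) (meets-pairs S defining)

  witness : Σ (Collection v) (λ D → IsDD D × SuperSimple D × fAtLeastHalf D)
  witness = collect block , directed , simple , atLeastHalf

-- Transversal designs and Wilson's weighting construction

injective⇒surjective : ∀ {n} (f : Fin n → Fin n) → (∀ {x y} → f x ≡ f y → x ≡ y) → ∀ y → ∃ λ x → f x ≡ y
injective⇒surjective {suc n} f f-inj y with any? (λ x → f x Fin.≟ y)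
... | yes p = p
... | no p  = contradiction (injective⇒≤ {f = λ x → Fin.punchOut {i = y} {f x} (λ e → p (x , sym e))}
  (λ {x} {x′} e → f-inj (punchOut-injective {i = y} _ _ e))) ℕ.1+n≰n

-- Transversal designs with six groups of size q; the group `nothing` is the one
-- that gets truncated.
record TD (q : ℕ) : Set where
  field
    column      : Maybe (Fin 5) → Fin q × Fin q → Fin q
    independent : ∀ {i j} → i ≢ j → ∀ {w w′} → column i w ≡ column i w′ → column j w ≡ column j w′ → w ≡ w′

  -- Two columns together inject the q² blocks into the q² pairs of points, hence are onto. The
  -- record asks only that two points lie in at most one common block; existence follows by
  -- counting.
  solve : ∀ {i j} → i ≢ j → ∀ s t → ∃ λ w → column i w ≡ s × column j w ≡ t
  solve {i} {j} i≢j s t = let x , p = injective⇒surjective code code-inj (Fin.combine s t) in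
    Fin.remQuot {q} q x , Fin.combine-injective _ _ _ _ p
    where
    code : Fin (q * q) → Fin (q * q)
    code x = Fin.combine (column i (Fin.remQuot {q} q x)) (column j (Fin.remQuot {q} q x))
    code-inj : ∀ {x y} → code x ≡ code y → x ≡ y
    code-inj e with Fin.combine-injective _ _ _ _ e
    ... | p , r = ↔-injective (*↔× {q} {q}) (independent i≢j p r)

Points : ℕ → ℕ → Set
Points g z = (Fin 5 × Fin g) ⊎ Fin z

group : ∀ {g z} → Points g z → Maybe (Fin 5)
group (inj₁ (i , _)) = just i
group (inj₂ _)       = nothing

-- Super-simple directed group divisible designs of type g⁵ z¹.
GDD : ℕ → ℕ → Set₁
GDD g z = Design (λ (x y : Points g z) → group x ≢ group y)

module Wilson {q} (td : TD q) (g : ℕ) (w : Fin q → ℕ) (ingredient : ∀ x → GDD g (w x))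
  (fill : Complete (Maybe (Fin q × Fin g))) (fill-last : Complete (Maybe (Σ (Fin q) (Fin ∘ w)))) where
  open TD td

  Point : Set
  Point = Maybe ((Fin 5 × Fin q × Fin g) ⊎ Σ (Fin q) (Fin ∘ w))

  -- The q² blocks of the transversal design, each replaced by an ingredient; then the five full
  -- groups and the sixth one, each filled together with the further point `nothing`.
  Piece : Set
  Piece = (Fin q × Fin q) ⊎ (Fin 5 ⊎ ⊤)

  piece-finite : Finite Piece
  piece-finite = q * q + (5 + 1) ,
    ↔-sym +↔⊎ ↔-∘ (↔-sym *↔× ⊎-↔ (↔-sym +↔⊎ ↔-∘ (↔-id _ ⊎-↔ ↔-sym Fin.1↔⊤)))

  Domain : Piece → Set
  Domain (inj₁ u)        = Points g (w (column nothing u))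
  Domain (inj₂ (inj₁ _)) = Maybe (Fin q × Fin g)
  Domain (inj₂ (inj₂ _)) = Maybe (Σ (Fin q) (Fin ∘ w))

  Related : ∀ i → Domain i → Domain i → Set
  Related (inj₁ _)        x y = group x ≢ group y
  Related (inj₂ (inj₁ _)) x y = x ≢ y
  Related (inj₂ (inj₂ _)) x y = x ≢ y

  designs : ∀ i → Design (Related i)
  designs (inj₁ u)        = ingredient (column nothing u)
  designs (inj₂ (inj₁ _)) = fill
  designs (inj₂ (inj₂ _)) = fill-last

  embed : ∀ i → Domain i → Point
  embed (inj₁ u)        (inj₁ (i , a)) = just (inj₁ (i , column (just i) u , a))
  embed (inj₁ u)        (inj₂ a)       = just (inj₂ (column nothing u , a))
  embed (inj₂ (inj₁ i)) nothing        = nothing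
  embed (inj₂ (inj₁ i)) (just x)       = just (inj₁ (i , x))
  embed (inj₂ (inj₂ _)) nothing        = nothing
  embed (inj₂ (inj₂ _)) (just x)       = just (inj₂ x)

  embed-inj : ∀ i {x y} → embed i x ≡ embed i y → x ≡ y
  embed-inj (inj₁ u) {inj₁ _} {inj₁ _} refl = refl
  embed-inj (inj₁ u) {inj₂ _} {inj₂ _} e = cong inj₂ (,-injectiveʳ (inj₂-injective (just-injective e)))
  embed-inj (inj₂ (inj₁ i)) {nothing} {nothing} _ = refl
  embed-inj (inj₂ (inj₁ i)) {just _} {just _} refl = refl
  embed-inj (inj₂ (inj₂ i)) {nothing} {nothing} _ = refl
  embed-inj (inj₂ (inj₂ i)) {just _} {just _} refl = refl

  place : Point → Maybe (Maybe (Fin 5) × Fin q)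
  place nothing                     = nothing
  place (just (inj₁ (i , x , _)))   = just (just i , x)
  place (just (inj₂ (x , _)))       = just (nothing , x)

  place-embed : ∀ u x → place (embed (inj₁ u) x) ≡ just (group x , column (group x) u)
  place-embed u (inj₁ _) = refl
  place-embed u (inj₂ _) = refl

  sector : Fin 5 ⊎ ⊤ → Maybe (Fin 5)
  sector (inj₁ i) = just i
  sector (inj₂ _) = nothing

  sector-inj : ∀ {i j} → sector i ≡ sector j → i ≡ j
  sector-inj {inj₁ _} {inj₁ _} refl = refl
  sector-inj {inj₂ _} {inj₂ _} refl = refl

  place-fill : ∀ i x → embed (inj₂ i) x ≡ nothing ⊎ ∃ λ y → place (embed (inj₂ i) x) ≡ just (sector i , y)
  place-fill (inj₁ i) nothing  = inj₁ refl
  place-fill (inj₁ i) (just x) = inj₂ (_ , refl)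
  place-fill (inj₂ i) nothing  = inj₁ refl
  place-fill (inj₂ i) (just x) = inj₂ (_ , refl)

  fill-related : ∀ i {x y} → Related (inj₂ i) x y → x ≢ y
  fill-related (inj₁ _) p = p
  fill-related (inj₂ _) p = p


  in-sector : ∀ i {x p} → place (embed (inj₂ i) x) ≡ just p → sector i ≡ proj₁ p
  in-sector i {x} e with place-fill i x
  ... | inj₁ n       = contradiction (trans (sym (cong place n)) e) λ ()
  ... | inj₂ (y , f) = cong proj₁ (just-injective (trans (sym f) e))

  -- Apart from the further point, a filled group has points of one group only, while an inflated
  -- block has no further point and its related points lie in different groups.
  mixed : ∀ u i {x x′ y y′} → group x ≢ group y → embed (inj₁ u) x ≡ embed (inj₂ i) x′ →
          embed (inj₁ u) y ≡ embed (inj₂ i) y′ → ⊥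
  mixed u i {x} {x′} {y} {y′} x≁y p q = x≁y (trans
    (sym (in-sector i {x′} (trans (cong place (sym p)) (place-embed u x))))
    (in-sector i {y′} (trans (cong place (sym q)) (place-embed u y))))

  -- Two inflated blocks with a related pair in common lie over blocks that agree in two groups,
  -- which are equal by `independent`. Two filled groups share at most the further point, so one of
  -- two distinct common points names the group.
  separate : ∀ {i j x y x′ y′} → Related i x y → Related j x′ y′ →
             embed i x ≡ embed j x′ → embed i y ≡ embed j y′ → i ≡ j
  separate {inj₁ u} {inj₁ u′} {x} {y} {x′} {y′} x≁y _ p q = cong inj₁ (independent x≁y (same x x′ p) (same y y′ q))
    where
    same : ∀ x x′ → embed (inj₁ u) x ≡ embed (inj₁ u′) x′ → column (group x) u ≡ column (group x) u′
    same x x′ p = trans (,-injectiveʳ′ e) (cong (λ i → column i u′) (sym (,-injectiveˡ e)))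
      where
      e = just-injective (trans (sym (place-embed u x)) (trans (cong place p) (place-embed u′ x′)))
      ,-injectiveʳ′ : ∀ {A B : Set} {a a′ : A} {b b′ : B} → (a , b) ≡ (a′ , b′) → b ≡ b′
      ,-injectiveʳ′ refl = refl
  separate {inj₁ u} {inj₂ i} {x} {y} {x′} {y′} x≁y _ p q = ⊥-elim (mixed u i {x} {x′} {y} {y′} x≁y p q)
  separate {inj₂ i} {inj₁ u} {x} {y} {x′} {y′} _ x≁y p q = ⊥-elim (mixed u i {x′} {x} {y′} {y} x≁y (sym p) (sym q))
  separate {inj₂ i} {inj₂ j} {x} {y} {x′} {y′} r _ p q with place-fill i x | place-fill i y
  ... | inj₂ (_ , e) | _            = cong inj₂ (sym (sector-inj (in-sector j {x′} (trans (cong place (sym p)) e))))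
  ... | inj₁ _       | inj₂ (_ , e) = cong inj₂ (sym (sector-inj (in-sector j {y′} (trans (cong place (sym q)) e))))
  ... | inj₁ a       | inj₁ b       = contradiction (embed-inj (inj₂ i) (trans a (sym b))) (fill-related i r)

  sound : ∀ i {x y} → Related i x y → embed i x ≢ embed i y
  sound (inj₁ u)        x≁y e = x≁y (cong group (embed-inj (inj₁ u) e))
  sound (inj₂ (inj₁ i)) x≢y e = x≢y (embed-inj (inj₂ (inj₁ i)) e)
  sound (inj₂ (inj₂ i)) x≢y e = x≢y (embed-inj (inj₂ (inj₂ i)) e)

  complete : ∀ {x y} → x ≢ y → ∃ λ i → ∃₂ λ a b → Related i a b × embed i a ≡ x × embed i b ≡ y
  complete {nothing} {nothing} x≢y = contradiction refl x≢y
  complete {nothing} {just (inj₁ (i , a))} x≢y = inj₂ (inj₁ i) , nothing , just a , (λ ()) , refl , refl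
  complete {just (inj₁ (i , a))} {nothing} x≢y = inj₂ (inj₁ i) , just a , nothing , (λ ()) , refl , refl
  complete {nothing} {just (inj₂ a)} x≢y = inj₂ (inj₂ tt) , nothing , just a , (λ ()) , refl , refl
  complete {just (inj₂ a)} {nothing} x≢y = inj₂ (inj₂ tt) , just a , nothing , (λ ()) , refl , refl
  complete {just (inj₂ a)} {just (inj₂ b)} x≢y =
    inj₂ (inj₂ tt) , just a , just b , (λ e → x≢y (cong (λ z → just (inj₂ z)) (just-injective e))) , refl , refl
  complete {just (inj₁ (i , a))} {just (inj₁ (j , b))} x≢y with i Fin.≟ j
  ... | yes refl = inj₂ (inj₁ i) , just a , just b ,
    (λ e → x≢y (cong (λ z → just (inj₁ (i , z))) (just-injective e))) , refl , refl
  complete {just (inj₁ (i , s , a))} {just (inj₁ (j , t , b))} x≢y | no i≢j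
    with solve {just i} {just j} (i≢j ∘ just-injective) s t
  ... | u , refl , refl = inj₁ u , inj₁ (i , a) , inj₁ (j , b) , (i≢j ∘ just-injective) , refl , refl
  complete {just (inj₁ (i , s , a))} {just (inj₂ (t , b))} x≢y with solve {just i} {nothing} (λ ()) s t
  ... | u , refl , refl = inj₁ u , inj₁ (i , a) , inj₂ b , (λ ()) , refl , refl
  complete {just (inj₂ (t , b))} {just (inj₁ (i , s , a))} x≢y with solve {just i} {nothing} (λ ()) s t
  ... | u , refl , refl = inj₁ u , inj₂ b , inj₁ (i , a) , (λ ()) , refl , refl

  design : Complete Point
  design = Amalgam.amalgam _≢_ piece-finite designs embed (λ i _ _ → embed-inj i) sound complete separate

maybe↔suc : ∀ {n} → Maybe (Fin n) ↔ Fin (suc n)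
maybe↔suc = mk↔ₛ′ (λ { nothing → zero ; (just i) → suc i }) (λ { zero → nothing ; (suc i) → just i })
  (λ { zero → refl ; (suc _) → refl }) (λ { nothing → refl ; (just _) → refl })

maybe↔ : ∀ {A B : Set} → A ↔ B → Maybe A ↔ Maybe B
maybe↔ e = mk↔ₛ′ (Maybe.map (Inverse.to e)) (Maybe.map (Inverse.from e))
  (λ { nothing → refl ; (just x) → cong just (Inverse.strictlyInverseˡ e x) })
  (λ { nothing → refl ; (just x) → cong just (Inverse.strictlyInverseʳ e x) })

weight : (g e m : ℕ) → ∀ {q} → Fin q → ℕ
weight g e zero    zero    = e
weight g e zero    (suc x) = 0
weight g e (suc m) zero    = g
weight g e (suc m) (suc x) = weight g e m x

0⊎↔ : ∀ {A B : Set} → ¬ B → (A ⊎ B) ↔ A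
0⊎↔ ¬b = mk↔ₛ′ (λ { (inj₁ a) → a ; (inj₂ b) → contradiction b ¬b }) inj₁ (λ _ → refl)
  (λ { (inj₁ _) → refl ; (inj₂ b) → contradiction b ¬b })

-- The strict inequality m < q leaves one position for the weight e after the m positions of weight
-- g.
weight-total : ∀ g e m {q} → m < q → Σ (Fin q) (Fin ∘ weight g e m) ↔ Fin (g * m + e)
weight-total g e zero    {suc q} _ rewrite ℕ.*-zeroʳ g = 0⊎↔ (λ { (_ , ()) }) ↔-∘ Σ-suc _
weight-total g e (suc m) {suc q} m<q rewrite ℕ.*-suc g m | ℕ.+-assoc g (g * m) e =
  ↔-sym +↔⊎ ↔-∘ ((↔-id _ ⊎-↔ weight-total g e m (s<s⁻¹ m<q)) ↔-∘ Σ-suc _)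

weight-full : ∀ g e q → Σ (Fin q) (Fin ∘ weight g e q) ↔ Fin (g * q)
weight-full g e zero rewrite ℕ.*-zeroʳ g = mk↔ₛ′ (λ { (() , _) }) (λ ()) (λ ()) (λ { (() , _) })
weight-full g e (suc q) rewrite ℕ.*-suc g q =
  ↔-sym +↔⊎ ↔-∘ ((↔-id _ ⊎-↔ weight-full g e q) ↔-∘ Σ-suc _)

weight-values : ∀ g e m {q} (x : Fin q) → weight g e m x ≡ g ⊎ weight g e m x ≡ e ⊎ weight g e m x ≡ 0
weight-values g e zero    zero    = inj₂ (inj₁ refl)
weight-values g e zero    (suc x) = inj₂ (inj₂ refl)
weight-values g e (suc m) zero    = inj₁ refl
weight-values g e (suc m) (suc x) = weight-values g e m x

record Ingredients (g e : ℕ) : Set₁ where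
  field
    with-g : GDD g g
    with-e : GDD g e
    with-0 : GDD g 0

  with-weight : ∀ m {q} (x : Fin q) → GDD g (weight g e m x)
  with-weight m x with weight g e m x | weight-values g e m x
  ... | _ | inj₁ refl        = with-g
  ... | _ | inj₂ (inj₁ refl) = with-e
  ... | _ | inj₂ (inj₂ refl) = with-0

inflate : ∀ {g e q} → Ingredients g e → TD q → Good (suc (g * q)) → ∀ m s →
          Σ (Fin q) (Fin ∘ weight g e m) ↔ Fin s → Good (suc s) → Good (suc (5 * (g * q) + s))
inflate {g} {e} {q} I td full m s total last = rename
  (maybe↔suc ↔-∘ maybe↔ (↔-sym +↔⊎ ↔-∘ ((↔-sym *↔× ↔-∘ (↔-id _ ×-↔ columns)) ⊎-↔ total)))
  (Wilson.design td g (weight g e m) (Ingredients.with-weight I m)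
    (rename (↔-sym (maybe↔suc ↔-∘ maybe↔ columns)) full)
    (rename (↔-sym (maybe↔suc ↔-∘ maybe↔ total)) last))
  where
  columns : (Fin q × Fin g) ↔ Fin (g * q)
  columns rewrite ℕ.*-comm g q = ↔-sym *↔×

extend : ∀ {g e q m} → Ingredients g e → TD q → m < q → Good (suc (g * q)) →
         Good (suc (g * m + e)) → Good (suc (5 * (g * q) + (g * m + e)))
extend {g} {e} {q} {m} I td m<q full last = inflate I td full m _ (weight-total g e m m<q) last

extend-all : ∀ {g e q} → Ingredients g e → TD q → Good (suc (g * q)) → Good (suc (5 * (g * q) + g * q))
extend-all {g} {e} {q} I td full = inflate I td full q _ (weight-full g e q) full

-- Base blocks as designs on `Fin v` and on grouped points

good : (F : Family) → Valid F → Family.h F ≡ 1 → Good (Family.v F)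
good F valid h≡1 = pullback toℕ toℕ-injective
  (λ {x} {y} x≢y → toℕ<n x , toℕ<n y , λ e → x≢y (toℕ-injective (trans (sym (whole _)) (trans e (whole _)))))
  (λ { (_ , _ , r) refl → r refl })
  (λ { (p<v , _) → fromℕ< p<v , toℕ-fromℕ< p<v })
  (Sound.design F valid)
  where
  open Family F
  whole : ∀ x → x / h ≡ x
  whole x = trans (/-congʳ h≡1) (n/1≡n x)

-- Group i < 5 is coded by the interval from h i to h i + h - 1, and the sixth group starts at 5 h.
-- Because z ≤ h, division by h recovers the group for the sixth one as well.
gdd : (F : Family) → Valid F → ∀ z → Family.v F ≡ 5 * Family.h F + z → z ≤ Family.h F → GDD (Family.h F) z
gdd F valid z v≡ z≤h = pullback code code-inj
  (λ {x} {y} x≁y → code-< x , code-< y , λ e → x≁y (group-code x y e))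
  (λ {x} {y} → λ { (_ , _ , r) e → r (code-group x y e) })
  (λ { {p} (p<v , _) → decode p p<v })
  (Sound.design F valid)
  where
  open Family F renaming (v to n)
  code : Points h z → ℕ
  code (inj₁ (i , a)) = toℕ (Fin.combine i a)
  code (inj₂ a)       = 5 * h + toℕ a

  code-/ : ∀ i (a : Fin h) → code (inj₁ (i , a)) / h ≡ toℕ i
  code-/ i a = begin
    toℕ (Fin.combine i a) / h    ≡⟨ cong (_/ h) (trans (toℕ-combine i a) (ℕ.+-comm (h * toℕ i) (toℕ a))) ⟩
    (toℕ a + h * toℕ i) / h      ≡⟨ +-distrib-/-∣ʳ (toℕ a) (divides (toℕ i) (ℕ.*-comm h (toℕ i))) ⟩
    toℕ a / h + h * toℕ i / h    ≡⟨ cong₂ _+_ (m<n⇒m/n≡0 (toℕ<n a)) (trans (cong (_/ h) (ℕ.*-comm h (toℕ i))) (m*n/n≡m (toℕ i) h)) ⟩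
    toℕ i                        ∎
    where open ≡-Reasoning

  last-/ : ∀ (a : Fin z) → code (inj₂ a) / h ≡ 5
  last-/ a = begin
    (5 * h + toℕ a) / h          ≡⟨ cong (_/ h) (ℕ.+-comm (5 * h) (toℕ a)) ⟩
    (toℕ a + 5 * h) / h          ≡⟨ +-distrib-/-∣ʳ (toℕ a) (divides 5 refl) ⟩
    toℕ a / h + 5 * h / h        ≡⟨ cong₂ _+_ (m<n⇒m/n≡0 (ℕ.<-≤-trans (toℕ<n a) z≤h)) (m*n/n≡m 5 h) ⟩
    5                            ∎
    where open ≡-Reasoning

  code-inj : ∀ {x y} → code x ≡ code y → x ≡ y
  code-inj {inj₁ (i , a)} {inj₁ (j , b)} e with Fin.combine-injective i a j b (toℕ-injective e)
  ... | refl , refl = refl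
  code-inj {inj₁ (i , a)} {inj₂ b} e = contradiction
    (trans (sym (code-/ i a)) (trans (cong (_/ h) e) (last-/ b))) (ℕ.<⇒≢ (toℕ<n i))
  code-inj {inj₂ a} {inj₁ (i , b)} e = contradiction
    (trans (sym (code-/ i b)) (trans (cong (_/ h) (sym e)) (last-/ a))) (ℕ.<⇒≢ (toℕ<n i))
  code-inj {inj₂ a} {inj₂ b} e = cong inj₂ (toℕ-injective (ℕ.+-cancelˡ-≡ (5 * h) _ _ e))

  code-< : ∀ x → code x < n
  code-< (inj₁ (i , a)) = subst (toℕ (Fin.combine i a) <_) (sym v≡)
    (ℕ.<-≤-trans (toℕ<n (Fin.combine i a)) (ℕ.m≤m+n (5 * h) z))
  code-< (inj₂ a)       = subst (5 * h + toℕ a <_) (sym v≡) (ℕ.+-monoʳ-< (5 * h) (toℕ<n a))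

  group-code : ∀ (x y : Points h z) → code x / h ≡ code y / h → group x ≡ group y
  group-code (inj₁ (i , a)) (inj₁ (j , b)) e =
    cong just (toℕ-injective (trans (sym (code-/ i a)) (trans e (code-/ j b))))
  group-code (inj₁ (i , a)) (inj₂ b) e = contradiction (trans (sym (code-/ i a)) (trans e (last-/ b))) (ℕ.<⇒≢ (toℕ<n i))
  group-code (inj₂ a) (inj₁ (j , b)) e = contradiction (trans (sym (code-/ j b)) (trans (sym e) (last-/ a))) (ℕ.<⇒≢ (toℕ<n j))
  group-code (inj₂ a) (inj₂ b) e = refl

  code-group : ∀ (x y : Points h z) → group x ≡ group y → code x / h ≡ code y / h
  code-group (inj₁ (i , a)) (inj₁ (j , b)) e =
    trans (code-/ i a) (trans (cong toℕ (just-injective e)) (sym (code-/ j b)))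
  code-group (inj₂ a) (inj₂ b) e = trans (last-/ a) (sym (last-/ b))

  decode : ∀ p → p < n → ∃ λ x → code x ≡ p
  decode p p<n with p ℕ.<? 5 * h
  ... | yes q = inj₁ (Fin.remQuot h (fromℕ< q)) ,
    trans (cong toℕ (Fin.combine-remQuot {5} h (fromℕ< q))) (toℕ-fromℕ< q)
  ... | no q  = inj₂ (fromℕ< rest) , trans (cong (5 * h +_) (toℕ-fromℕ< rest)) (ℕ.m+[n∸m]≡n (ℕ.≮⇒≥ q))
    where
    rest : p ∸ 5 * h < z
    rest = subst (p ∸ 5 * h <_) (trans (cong (_∸ 5 * h) v≡) (ℕ.m+n∸m≡n (5 * h) z)) (ℕ.∸-monoˡ-< p<n (ℕ.≮⇒≥ q))

-- Transversal designs from lines modulo q and from difference matrices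

module Linear (q : ℕ) {{_ : NonZero q}} (inverse : ∀ d → 0 < d → d < 5 → ∃ λ u → u * d % q ≡ 1 % q) where
  open Modular q

  line : Maybe (Fin 5) → Fin q × Fin q → ℕ
  line (just i) (x , y) = toℕ x + toℕ i * toℕ y
  line nothing  (x , y) = toℕ y

  -- Subtracting the congruences leaves (j - i) y ≋ (j - i) y′, and j - i is one of 1, 2, 3, 4. Only
  -- these differences have to be units, so q prime to 6 suffices and q need not be prime.
  difference : ∀ {i j x y x′ y′} → i < j → j < 5 → x + i * y ≋ x′ + i * y′ → x + j * y ≋ x′ + j * y′ → y ≋ y′
  difference {i} {j} {x} {y} {x′} {y′} i<j j<5 p r with ℕ.m≤n⇒∃[o]m+o≡n i<j
  ... | o , refl = begin
    y % q                ≡⟨ cong (_% q) (sym (ℕ.*-identityˡ y)) ⟩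
    1 * y % q            ≡⟨ *-cong {1} {u * suc o} {y} (sym (proj₂ unit)) refl ⟩
    u * suc o * y % q    ≡⟨ cong (_% q) (ℕ.*-assoc u (suc o) y) ⟩
    u * (suc o * y) % q  ≡⟨ *-cong {u} refl scaled ⟩
    u * (suc o * y′) % q ≡⟨ cong (_% q) (sym (ℕ.*-assoc u (suc o) y′)) ⟩
    u * suc o * y′ % q   ≡⟨ *-cong {u * suc o} {1} {y′} (proj₂ unit) refl ⟩
    1 * y′ % q           ≡⟨ cong (_% q) (ℕ.*-identityˡ y′) ⟩
    y′ % q               ∎
    where
    open ≡-Reasoning
    open +-*-Solver
    unit = inverse (suc o) (s≤s z≤n) (ℕ.≤-<-trans (ℕ.≤-trans (ℕ.m≤n+m (suc o) i) (ℕ.≤-reflexive (ℕ.+-suc i o))) j<5)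
    u = proj₁ unit
    -- Adding this sum to both sides stands in for subtracting one congruence from the other, since
    -- (j - i) y + `common` is (x + j y) + (x′ + i y′).
    common = x + x′ + i * y + i * y′
    scaled : suc o * y ≋ suc o * y′
    scaled = +-cancelʳ common (begin
      (suc o * y + common) % q
        ≡⟨ cong (_% q) (solve 6 (λ x y x′ y′ i o → (con 1 :+ o) :* y :+ (x :+ x′ :+ i :* y :+ i :* y′) :=
             x :+ (con 1 :+ i :+ o) :* y :+ (x′ :+ i :* y′)) refl x y x′ y′ i o) ⟩
      (x + (suc i + o) * y + (x′ + i * y′)) % q
        ≡⟨ +-cong {x + (suc i + o) * y} r (sym p) ⟩
      (x′ + (suc i + o) * y′ + (x + i * y)) % q
        ≡⟨ cong (_% q) (solve 6 (λ x y x′ y′ i o → x′ :+ (con 1 :+ i :+ o) :* y′ :+ (x :+ i :* y) :=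
             (con 1 :+ o) :* y′ :+ (x :+ x′ :+ i :* y :+ i :* y′)) refl x y x′ y′ i o) ⟩
      (suc o * y′ + common) % q ∎)

  same : ∀ {w w′} → toℕ (proj₂ w) ≋ toℕ (proj₂ w′) → ∀ i → line (just i) w ≋ line (just i) w′ → w ≡ w′
  same {x , y} {x′ , y′} p i r with toℕ-injective (small (toℕ<n y) (toℕ<n y′) p)
  ... | refl = cong (_, y) (toℕ-injective (small (toℕ<n x) (toℕ<n x′) (+-cancelʳ (toℕ i * toℕ y) r)))

  independent : ∀ {i j} → i ≢ j → ∀ {w w′} → line i w ≋ line i w′ → line j w ≋ line j w′ → w ≡ w′
  independent {nothing} {nothing} i≢j p r = contradiction refl i≢j
  independent {nothing} {just j}  i≢j {w} {w′} p r = same {w} {w′} p j r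
  independent {just i}  {nothing} i≢j {w} {w′} p r = same {w} {w′} r i p
  independent {just i}  {just j}  i≢j {w} {w′} p r with order {i = i} {j} (i≢j ∘ cong just)
  ... | below i<j = same {w} {w′} (difference i<j (toℕ<n j) p r) i p
  ... | above j<i = same {w} {w′} (difference j<i (toℕ<n i) r p) i p

  td : TD q
  td = record
    { column      = λ i w → fromℕ< (m%n<n (line i w) q)
    ; independent = λ {i} {j} i≢j {w} {w′} p r → independent {i} {j} i≢j (congruent i w w′ p) (congruent j w w′ r)
    }
    where
    congruent : ∀ i w w′ → fromℕ< (m%n<n (line i w) q) ≡ fromℕ< (m%n<n (line i w′) q) → line i w ≋ line i w′
    congruent i w w′ p = trans (sym (toℕ-fromℕ< _)) (trans (cong toℕ p) (toℕ-fromℕ< _))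

inverses : ∀ q .{{_ : NonZero q}} a b → a * 2 % q ≡ 1 % q → b * 3 % q ≡ 1 % q →
           ∀ d → 0 < d → d < 5 → ∃ λ u → u * d % q ≡ 1 % q
inverses q a b p r 1 _ _ = 1 , refl
inverses q a b p r 2 _ _ = a , p
inverses q a b p r 3 _ _ = b , r
inverses q a b p r 4 _ _ = a * a , (begin
  a * a * 4 % q       ≡⟨ cong (_% q) (solve 1 (λ a → a :* a :* con 4 := (a :* con 2) :* (a :* con 2)) refl a) ⟩
  a * 2 * (a * 2) % q ≡⟨ *-cong {a * 2} {1} {a * 2} {1} p p ⟩
  1 % q               ∎)
  where
  open ≡-Reasoning
  open +-*-Solver
  open Modular q
inverses q a b p r (suc (suc (suc (suc (suc d))))) _ (s≤s (s≤s (s≤s (s≤s (s≤s ())))))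

-- With q = 6 t + 1, the inverses of 2 and 3 come from 2 (3 t + 1) = 1 + q and 3 (4 t + 1) = 1 + 2
-- q.
linear₁ : ∀ t → TD (6 * t + 1)
linear₁ t = subst TD (ℕ.+-comm 1 (6 * t)) (Linear.td (suc (6 * t)) (inverses (suc (6 * t)) (3 * t + 1) (4 * t + 1)
  (trans (cong (_% suc (6 * t)) (solve 1 (λ t → (con 3 :* t :+ con 1) :* con 2 := con 1 :+ con 1 :* (con 1 :+ con 6 :* t)) refl t))
    ([m+kn]%n≡m%n 1 1 (suc (6 * t))))
  (trans (cong (_% suc (6 * t)) (solve 1 (λ t → (con 4 :* t :+ con 1) :* con 3 := con 1 :+ con 2 :* (con 1 :+ con 6 :* t)) refl t))
    ([m+kn]%n≡m%n 1 2 (suc (6 * t))))))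
  where open +-*-Solver

-- With q = 6 t + 5, both inverses come from 6 t + 6 = 1 + q, split as 2 (3 t + 3) and as 3 (2 t +
-- 2).
linear₅ : ∀ t → TD (6 * t + 5)
linear₅ t = subst TD (ℕ.+-comm 5 (6 * t)) (Linear.td (5 + 6 * t) (inverses (5 + 6 * t) (3 * t + 3) (2 * t + 2)
  (trans (cong (_% (5 + 6 * t)) (solve 1 (λ t → (con 3 :* t :+ con 3) :* con 2 := con 1 :+ con 1 :* (con 5 :+ con 6 :* t)) refl t))
    ([m+kn]%n≡m%n 1 1 (5 + 6 * t)))
  (trans (cong (_% (5 + 6 * t)) (solve 1 (λ t → (con 2 :* t :+ con 2) :* con 3 := con 1 :+ con 1 :* (con 5 :+ con 6 :* t)) refl t))
    ([m+kn]%n≡m%n 1 1 (5 + 6 * t)))))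
  where open +-*-Solver

-- Addition in (ℤ/p)ᵏ, with vectors written in base p.
add : (p : ℕ) .{{_ : NonZero p}} → ℕ → ℕ → ℕ → ℕ
add p zero    x y = 0
add p (suc k) x y = (x % p + y % p) % p + p * add p k (x / p) (y / p)

-- Rows of a difference matrix over (ℤ/p)ᵏ, q = pᵏ.
module Table (q p k : ℕ) {{_ : NonZero q}} {{_ : NonZero p}} (rows : Vec (List ℕ) 5) where
  nth : List ℕ → ℕ → ℕ
  nth []       _       = 0
  nth (x ∷ xs) zero    = x
  nth (x ∷ xs) (suc n) = nth xs n

  entry : Maybe (Fin 5) → ℕ → ℕ → ℕ
  entry (just i) x y = add p k x (nth (lookup rows i) y) % q
  entry nothing  x y = y % q

  cells : List (Fin q × Fin q)
  cells = cartesianProduct (allFin q) (allFin q)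

  codes : Maybe (Fin 5) → Maybe (Fin 5) → List (ℕ × (Fin q × Fin q))
  codes i j = map (λ w → entry i (toℕ (proj₁ w)) (toℕ (proj₂ w)) * q + entry j (toℕ (proj₁ w)) (toℕ (proj₂ w)) , w) cells

  choices : List (Maybe (Fin 5) × Maybe (Fin 5))
  choices = map (λ p → just (proj₁ p) , just (proj₂ p)) pairs ++ map (λ i → just i , nothing) (allFin 5)

  orthogonal : Maybe (Fin 5) × Maybe (Fin 5) → Bool
  orthogonal (i , j) = distinctKeys (codes i j)

  module _ (valid : all orthogonal choices ≡ true) where
    apart : ∀ {i j} → (i , j) ∈ choices → ∀ {x y x′ y′} →
            entry i (toℕ x) (toℕ y) ≡ entry i (toℕ x′) (toℕ y′) →
            entry j (toℕ x) (toℕ y) ≡ entry j (toℕ x′) (toℕ y′) → (x , y) ≡ (x′ , y′)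
    apart {i} {j} ∈choices {x} {y} {x′} {y′} e f = distinctKeys-sound (codes i j)
      (all-∈ orthogonal choices (subst T (sym valid) tt) ∈choices) (member x y)
      (subst (λ n → (n , (x′ , y′)) ∈ codes i j) (sym (cong₂ (λ a b → a * q + b) e f)) (member x′ y′))
      where
      member : ∀ x y → (entry i (toℕ x) (toℕ y) * q + entry j (toℕ x) (toℕ y) , (x , y)) ∈ codes i j
      member x y = ∈-map⁺ (λ w → entry i (toℕ (proj₁ w)) (toℕ (proj₂ w)) * q + entry j (toℕ (proj₁ w)) (toℕ (proj₂ w)) , w)
        (∈-cartesianProduct⁺ (∈-allFin x) (∈-allFin y))

    both : ∀ {i j} → i <ᶠ j → (just i , just j) ∈ choices
    both i<j = ∈-++⁺ˡ (∈-map⁺ (λ p → just (proj₁ p) , just (proj₂ p)) (∈-pairs i<j))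

    last : ∀ i → (just i , nothing) ∈ choices
    last i = ∈-++⁺ʳ (map (λ p → just (proj₁ p) , just (proj₂ p)) pairs) (∈-map⁺ (λ i → just i , nothing) (∈-allFin i))

    entry-< : ∀ i x y → entry i x y < q
    entry-< (just i) x y = m%n<n _ q
    entry-< nothing  x y = m%n<n _ q

    column : Maybe (Fin 5) → Fin q × Fin q → Fin q
    column i (x , y) = fromℕ< (entry-< i (toℕ x) (toℕ y))

    raw : ∀ i {w w′} → column i w ≡ column i w′ → entry i (toℕ (proj₁ w)) (toℕ (proj₂ w)) ≡ entry i (toℕ (proj₁ w′)) (toℕ (proj₂ w′))
    raw i p = trans (sym (toℕ-fromℕ< _)) (trans (cong toℕ p) (toℕ-fromℕ< _))

    independent : ∀ {i j} → i ≢ j → ∀ {w w′} → column i w ≡ column i w′ → column j w ≡ column j w′ → w ≡ w′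
    independent {nothing} {nothing} i≢j e f = contradiction refl i≢j
    independent {just i}  {nothing} i≢j {w} {w′} e f = apart (last i) (raw (just i) {w} {w′} e) (raw nothing {w} {w′} f)
    independent {nothing} {just j}  i≢j {w} {w′} e f = apart (last j) (raw (just j) {w} {w′} f) (raw nothing {w} {w′} e)
    independent {just i}  {just j}  i≢j {w} {w′} e f with order {i = i} {j} (i≢j ∘ cong just)
    ... | below i<j = apart (both i<j) (raw (just i) {w} {w′} e) (raw (just j) {w} {w′} f)
    ... | above j<i = apart (both j<i) (raw (just j) {w} {w′} f) (raw (just i) {w} {w′} e)

    td : TD q
    td = record { column = column ; independent = λ {i} {j} i≢j {w} {w′} → independent {i} {j} i≢j {w} {w′} }

-- Admissible orders and the steps of the recursion

data Admissible : ℕ → Set where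
  one  : ∀ n → n ≢ 1 → Admissible (1 + 10 * n)
  five : ∀ n → 2 ≤ n → Admissible (5 + 10 * n)

-- The computable form, by which the search over steps can be evaluated. In `Admissible`, n ≢ 1
-- excludes 11, and 2 ≤ n excludes 5 and 15.
admissible : ℕ → Bool
admissible v = ((v % 10 ≡ᵇ 1) ∧ not (v ≡ᵇ 11)) ∨ ((v % 10 ≡ᵇ 5) ∧ (15 <ᵇ v))

digits : ∀ v {d} → v % 10 ≡ d → v ≡ d + 10 * (v / 10)
digits v refl = trans (m≡m%n+[m/n]*n v 10) (cong (v % 10 +_) (ℕ.*-comm (v / 10) 10))

ends-in-one : ∀ v → v % 10 ≡ 1 → v ≢ 11 → Admissible v
ends-in-one v p v≢11 = subst Admissible (sym e)
  (one (v / 10) λ n≡1 → v≢11 (trans e (cong (λ n → 1 + 10 * n) n≡1)))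
  where e = digits v p

ends-in-five : ∀ v → v % 10 ≡ 5 → v ≢ 5 → v ≢ 15 → Admissible v
ends-in-five v p v≢5 v≢15 = subst Admissible (sym e) (five (v / 10) (large (v / 10) e))
  where
  e = digits v p
  large : ∀ n → v ≡ 5 + 10 * n → 2 ≤ n
  large 0 q = contradiction q v≢5
  large 1 q = contradiction q v≢15
  large (suc (suc n)) _ = s≤s (s≤s z≤n)

admissible-sound : ∀ v → T (admissible v) → Admissible v
admissible-sound v t = [ is-one ∘ ∧-split {v % 10 ≡ᵇ 1} , is-five ∘ ∧-split {v % 10 ≡ᵇ 5} ]′
  (∨-split {(v % 10 ≡ᵇ 1) ∧ not (v ≡ᵇ 11)} t)
  where
  is-one : T (v % 10 ≡ᵇ 1) × T (not (v ≡ᵇ 11)) → Admissible v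
  is-one (p , q) = ends-in-one v (ℕ.≡ᵇ⇒≡ (v % 10) 1 p) (λ e → not-T q (ℕ.≡⇒≡ᵇ v 11 e))
  is-five : T (v % 10 ≡ᵇ 5) × T (15 <ᵇ v) → Admissible v
  is-five (p , q) = ends-in-five v (ℕ.≡ᵇ⇒≡ (v % 10) 5 p)
    (λ { refl → contradiction (ℕ.<ᵇ⇒< 15 5 q) (ℕ.<⇒≯ (ℕ.<ᵇ⇒< 5 15 tt)) })
    (λ { refl → ℕ.<-irrefl refl (ℕ.<ᵇ⇒< 15 15 q) })

remainder : ∀ r n → r < 10 → (r + 10 * n) % 10 ≡ r
remainder r n r<10 = trans (cong (λ k → (r + k) % 10) (ℕ.*-comm 10 n)) (trans ([m+kn]%n≡m%n r n 10) (m<n⇒m%n≡m r<10))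

-- There are no pairs and no blocks. Besides being an order of its own, this fills a sixth group
-- that has been truncated to nothing (m = e = 0).
good-1 : Good 1
good-1 = record
  { Index = ⊥ ; count = 0 ; enum = mk↔ₛ′ (λ ()) (λ ()) (λ ()) (λ ()) ; block = λ () ; distinct = λ ()
  ; related = λ () ; covered = λ { {zero} {zero} p → contradiction refl p } ; unique = λ { {()} }
  ; superSimple = λ { {()} } ; mate = λ () ; mate-inj = λ { {()} } ; swap = λ () }

Base : Set
Base = Σ Family λ F → Valid F × Family.h F ≡ 1

record Scheme : Set₁ where
  constructor scheme
  field
    g e         : ℕ
    ingredients : Ingredients g e

record Transversal : Set where
  constructor transversal
  field
    q  : ℕ
    td : TD q

module Plan (bases : List Base) (schemes : List Scheme) (orders : List Transversal) where


  direct : ℕ → Bool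
  direct v = any (λ F → Family.v (proj₁ F) ≡ᵇ v) bases

  step : ℕ → Scheme → Transversal → ℕ → Bool
  step v s o m = (m <ᵇ Transversal.q o)
    ∧ (suc (5 * (Scheme.g s * Transversal.q o) + (Scheme.g s * m + Scheme.e s)) ≡ᵇ v)
    ∧ (suc (Scheme.g s * Transversal.q o) <ᵇ v) ∧ admissible (suc (Scheme.g s * Transversal.q o))
    ∧ (suc (Scheme.g s * m + Scheme.e s) <ᵇ v) ∧ admissible (suc (Scheme.g s * m + Scheme.e s))

  -- The untruncated case m = q, outside the reach of `step`: all points of the sixth group have
  -- weight g and no position is left for e.
  stepAll : ℕ → Scheme → Transversal → Bool
  stepAll v s o = (suc (5 * (Scheme.g s * Transversal.q o) + Scheme.g s * Transversal.q o) ≡ᵇ v)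
    ∧ (suc (Scheme.g s * Transversal.q o) <ᵇ v) ∧ admissible (suc (Scheme.g s * Transversal.q o))

  -- The divisor is g, written so that it is visibly positive.
  guess : ℕ → Scheme → Transversal → ℕ
  guess v s o = (v ∸ suc (5 * (Scheme.g s * Transversal.q o) + Scheme.e s)) / suc (Scheme.g s ∸ 1)

  reached : ℕ → Scheme → Transversal → Bool
  reached v s o = stepAll v s o ∨ step v s o (guess v s o)

  planned : ℕ → Bool
  planned v = not (admissible v) ∨ (v ≡ᵇ 1) ∨ direct v ∨ any (λ s → any (reached v s) orders) schemes

  any-∈ : ∀ {a} {A : Set a} (p : A → Bool) xs → T (any p xs) → ∃ λ x → T (p x)
  any-∈ p (x ∷ xs) t = [ (λ u → x , u) , any-∈ p xs ]′ (∨-split {p x} t)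

  Smaller : ℕ → Set₁
  Smaller v = ∀ {u} → u < v → T (admissible u) → Good u

  step-sound : ∀ v s o m → Smaller v → T (step v s o m) → Good v
  step-sound v (scheme g e I) (transversal q td) m ih t =
    from (∧-split {m <ᵇ q} t)
    where
    a = suc (g * q)
    b = suc (g * m + e)
    n = suc (5 * (g * q) + (g * m + e))
    from : T (m <ᵇ q) × T ((n ≡ᵇ v) ∧ (a <ᵇ v) ∧ admissible a ∧ (b <ᵇ v) ∧ admissible b) → Good v
    from (m<q , t₁) =
      let v≡ , t₂ = ∧-split {n ≡ᵇ v} t₁
          a<v , t₃ = ∧-split {a <ᵇ v} t₂
          ad-a , t₄ = ∧-split {admissible a} t₃
          b<v , ad-b = ∧-split {b <ᵇ v} t₄
      in subst Good (ℕ.≡ᵇ⇒≡ n v v≡) (extend I td (ℕ.<ᵇ⇒< m q m<q)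
           (ih (ℕ.<ᵇ⇒< a v a<v) ad-a) (ih (ℕ.<ᵇ⇒< b v b<v) ad-b))

  stepAll-sound : ∀ v s o → Smaller v → T (stepAll v s o) → Good v
  stepAll-sound v (scheme g e I) (transversal q td) ih t =
    let v≡ , t₁ = ∧-split {suc (5 * (g * q) + g * q) ≡ᵇ v} t
        a<v , ad = ∧-split {suc (g * q) <ᵇ v} t₁
    in subst Good (ℕ.≡ᵇ⇒≡ (suc (5 * (g * q) + g * q)) v v≡) (extend-all I td (ih (ℕ.<ᵇ⇒< (suc (g * q)) v a<v) ad))

  direct-sound : ∀ v → T (direct v) → Good v
  direct-sound v t with any-∈ (λ F → Family.v (proj₁ F) ≡ᵇ v) bases t
  ... | (F , valid , h≡1) , e = subst Good (ℕ.≡ᵇ⇒≡ (Family.v F) v e) (good F valid h≡1)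

  planned-sound : ∀ v → T (admissible v) → Smaller v → T (planned v) → Good v
  planned-sound v ad ih t = [ (λ u → ⊥-elim (not-T u ad)) , second ]′ (∨-split {not (admissible v)} t)
    where
    fourth : T (any (λ s → any (reached v s) orders) schemes) → Good v
    fourth t = let s , u = any-∈ (λ s → any (reached v s) orders) schemes t
                   o , w = any-∈ (reached v s) orders u
               in [ stepAll-sound v s o ih , step-sound v s o (guess v s o) ih ]′ (∨-split {stepAll v s o} w)
    third : T (direct v ∨ any (λ s → any (reached v s) orders) schemes) → Good v
    third t = [ direct-sound v , fourth ]′ (∨-split {direct v} t)
    second : T ((v ≡ᵇ 1) ∨ direct v ∨ any (λ s → any (reached v s) orders) schemes) → Good v
    second t = [ (λ e → subst Good (sym (ℕ.≡ᵇ⇒≡ v 1 e)) good-1) , third ]′ (∨-split {v ≡ᵇ 1} t)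

-- Here n = s + 30 (6 + t) and q = 6 (6 + t) - 1, so 5 q = 30 (6 + t) - 5 and n = 5 q + m with m = 5
-- + s. All remainders s < 30 are served because m ≤ 34 < 35 ≤ q, which is why the quotient starts
-- at 6. Moreover q is prime to 6, and m ≥ 5 keeps the sixth group away from the order 11.
large-one : Ingredients 10 0 → ∀ t s → s < 30 →
            (∀ {u} → u < 1 + 10 * (s + (6 + t) * 30) → Admissible u → Good u) → Good (1 + 10 * (s + (6 + t) * 30))
large-one I t s s<30 ih = subst Good (eq t s) (extend I (linear₅ (5 + t)) m<q
  (subst Good refl (ih q< (one q q≢1)))
  (subst Good (cong suc (sym (ℕ.+-identityʳ (10 * m)))) (ih m< (one m λ ()))))
  where
  open +-*-Solver
  q = 6 * (5 + t) + 5
  m = 5 + s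
  m<q : m < q
  m<q = ℕ.<-≤-trans (ℕ.+-monoʳ-< 5 s<30) (ℕ.≤-trans (ℕ.m≤m+n 35 (6 * t)) (ℕ.≤-reflexive
    (solve 1 (λ t → con 35 :+ con 6 :* t := con 6 :* (con 5 :+ t) :+ con 5) refl t)))
  q≢1 : q ≢ 1
  q≢1 p = contradiction (trans (sym p) (solve 1 (λ t → con 6 :* (con 5 :+ t) :+ con 5 := con 35 :+ con 6 :* t) refl t)) λ ()
  eq : ∀ t s → suc (5 * (10 * (6 * (5 + t) + 5)) + (10 * (5 + s) + 0)) ≡ 1 + 10 * (s + (6 + t) * 30)
  eq = solve 2 (λ t s → con 1 :+ (con 5 :* (con 10 :* (con 6 :* (con 5 :+ t) :+ con 5)) :+ (con 10 :* (con 5 :+ s) :+ con 0))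
    := con 1 :+ con 10 :* (s :+ (con 6 :+ t) :* con 30)) refl
  n>q : q < s + (6 + t) * 30
  -- The summand 145 + 24 t + s is the difference between n and q.
  n>q = ℕ.<-≤-trans (ℕ.m<m+n q {145 + 24 * t + s} (s≤s z≤n)) (ℕ.≤-reflexive
    (solve 2 (λ t s → con 6 :* (con 5 :+ t) :+ con 5 :+ (con 145 :+ con 24 :* t :+ s) := s :+ (con 6 :+ t) :* con 30) refl t s))
  q< : 1 + 10 * q < 1 + 10 * (s + (6 + t) * 30)
  q< = s≤s (ℕ.*-monoʳ-< 10 n>q)
  m< : 1 + 10 * m < 1 + 10 * (s + (6 + t) * 30)
  m< = s≤s (ℕ.*-monoʳ-< 10 (ℕ.<-trans m<q n>q))

-- The same q and m, now with a point of weight 4 after the m points of weight 10: the sixth group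
-- and the further point have order 10 m + 5, and m ≥ 5 keeps it above 15.
large-five : Ingredients 10 4 → ∀ t s → s < 30 →
             (∀ {u} → u < 5 + 10 * (s + (6 + t) * 30) → Admissible u → Good u) → Good (5 + 10 * (s + (6 + t) * 30))
large-five I t s s<30 ih = subst Good (eq t s) (extend I (linear₅ (5 + t)) m<q
  (ih q< (one q q≢1))
  (subst Good (cong suc (ℕ.+-comm 4 (10 * m))) (ih m< (five m (s≤s (s≤s z≤n))))))
  where
  open +-*-Solver
  q = 6 * (5 + t) + 5
  m = 5 + s
  m<q : m < q
  m<q = ℕ.<-≤-trans (ℕ.+-monoʳ-< 5 s<30) (ℕ.≤-trans (ℕ.m≤m+n 35 (6 * t)) (ℕ.≤-reflexive
    (solve 1 (λ t → con 35 :+ con 6 :* t := con 6 :* (con 5 :+ t) :+ con 5) refl t)))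
  q≢1 : q ≢ 1
  q≢1 p = contradiction (trans (sym p) (solve 1 (λ t → con 6 :* (con 5 :+ t) :+ con 5 := con 35 :+ con 6 :* t) refl t)) λ ()
  eq : ∀ t s → suc (5 * (10 * (6 * (5 + t) + 5)) + (10 * (5 + s) + 4)) ≡ 5 + 10 * (s + (6 + t) * 30)
  eq = solve 2 (λ t s → con 1 :+ (con 5 :* (con 10 :* (con 6 :* (con 5 :+ t) :+ con 5)) :+ (con 10 :* (con 5 :+ s) :+ con 4))
    := con 5 :+ con 10 :* (s :+ (con 6 :+ t) :* con 30)) refl
  n>q : q < s + (6 + t) * 30
  n>q = ℕ.<-≤-trans (ℕ.m<m+n q {145 + 24 * t + s} (s≤s z≤n)) (ℕ.≤-reflexive
    (solve 2 (λ t s → con 6 :* (con 5 :+ t) :+ con 5 :+ (con 145 :+ con 24 :* t :+ s) := s :+ (con 6 :+ t) :* con 30) refl t s))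
  q< : 1 + 10 * q < 5 + 10 * (s + (6 + t) * 30)
  q< = ℕ.+-mono-≤-< (ℕ.<ᵇ⇒< 0 5 tt) (ℕ.*-monoʳ-< 10 n>q)
  m< : 5 + 10 * m < 5 + 10 * (s + (6 + t) * 30)
  m< = ℕ.+-monoʳ-< 5 (ℕ.*-monoʳ-< 10 (ℕ.<-trans m<q n>q))

complete : ∀ {v} → Admissible v → T (admissible v)
complete (one n n≢1) rewrite remainder 1 n (s≤s (s≤s z≤n)) with 1 + 10 * n ≡ᵇ 11 in eq
... | false = tt
... | true  = contradiction (ℕ.*-cancelˡ-≡ n 1 10 (ℕ.suc-injective (ℕ.≡ᵇ⇒≡ (1 + 10 * n) 11 (subst T (sym eq) tt)))) n≢1
complete (five n 2≤n) rewrite remainder 5 n (ℕ.<ᵇ⇒< 5 10 tt) =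
  ℕ.<⇒<ᵇ (ℕ.<-≤-trans (ℕ.<ᵇ⇒< 15 25 tt) (ℕ.+-monoʳ-≤ 5 (ℕ.*-monoʳ-≤ 10 2≤n)))

-- N stays abstract, since with a concrete bound the type of `small` would be unfolded.
module Main (bases : List Base) (schemes : List Scheme) (orders : List Transversal)
  (I₀ : Ingredients 10 0) (I₄ : Ingredients 10 4)
  (N : ℕ) (1810≤N : 1810 ≤ N) (small : all (Plan.planned bases schemes orders) (downFrom N) ≡ true) where
  open Plan bases schemes orders

  quotient-bound : ∀ c n → ¬ (c + 10 * n < N) → c < 10 → ∃₂ λ t s → s < 30 × n ≡ s + (6 + t) * 30
  quotient-bound c n big c<10 = n / 30 ∸ 6 , n % 30 , m%n<n n 30 ,
    trans (m≡m%n+[m/n]*n n 30) (cong (λ k → n % 30 + k * 30) (sym (ℕ.m+[n∸m]≡n 6≤)))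
    where
    -- The value 180 is 6 · 30, the first n with quotient 6. For smaller n and c < 10 the order c +
    -- 10 n stays below 1810, hence below N.
    180≤n : 180 ≤ n
    180≤n = ℕ.≮⇒≥ λ n<180 → big (ℕ.<-≤-trans (ℕ.+-mono-< c<10 (ℕ.*-monoʳ-< 10 n<180)) 1810≤N)
    6≤ : 6 ≤ n / 30
    6≤ = /-monoˡ-≤ 30 180≤n

  good-all : ∀ v → T (admissible v) → Good v
  good-all = <-rec (λ v → T (admissible v) → Good v) by
    where
    by : ∀ v → (∀ {u} → u < v → T (admissible u) → Good u) → T (admissible v) → Good v
    by v ih ad with v ℕ.<? N
    ... | yes v<N = planned-sound v ad ih (all-∈ planned (downFrom N) (subst T (sym small) tt) (∈-downFrom⁺ v<N))
    ... | no big     = go (admissible-sound v ad) ih big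
      where
      go : ∀ {v} → Admissible v → (∀ {u} → u < v → T (admissible u) → Good u) → ¬ v < N → Good v
      go (one n _) ih big with quotient-bound 1 n big (s≤s (s≤s z≤n))
      ... | t , s , s<30 , refl = large-one I₀ t s s<30 (λ u< a → ih u< (complete a))
      go (five n _) ih big with quotient-bound 5 n big (ℕ.<ᵇ⇒< 5 10 tt)
      ... | t , s , s<30 , refl = large-five I₄ t s s<30 (λ u< a → ih u< (complete a))

-- Base blocks of directed designs

tup : ℕ → ℕ → ℕ → ℕ → ℕ → ℕ → ℕ → ℕ → Vec ℕ 8
tup p q r s t a k b = p ∷ q ∷ r ∷ s ∷ t ∷ a ∷ k ∷ b ∷ []

-- The second row is the negative of the first. Negation reverses all differences, so each pair of a
-- block occurs in the opposite order in a translate of its negative, and these two rows are mates.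
-- The rows for 41, 61, 81, 141 and 161 form such couples too.
dd-21 : Family
dd-21 = family 21 1 1 21 (
  tup 7 20 0 17 5 0 1 0 ∷ tup 14 1 0 4 16 0 0 0 ∷ [])

dd-21-valid : Valid dd-21
dd-21-valid = refl

dd-25 : Family
dd-25 = family 5 5 1 25 (
  tup 20 3 5 11 1 1 4 0 ∷ tup 18 2 7 5 15 0 9 1 ∷ tup 24 23 5 7 12 1 8 1 ∷ tup 15 1 10 22 2 1 7 0 ∷
  tup 6 4 14 10 5 0 0 1 ∷ tup 18 16 10 14 24 1 11 1 ∷ tup 5 2 20 19 4 1 10 0 ∷ tup 12 3 23 20 10 0 3 1 ∷
  tup 6 7 20 23 18 1 2 1 ∷ tup 10 4 15 8 3 1 1 0 ∷ tup 24 1 16 15 20 0 6 1 ∷ tup 12 14 15 16 6 1 5 1 ∷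
  [])

dd-25-valid : Valid dd-25
dd-25-valid = refl

dd-31 : Family
dd-31 = family 31 1 1 31 (
  tup 3 11 30 2 0 1 2 3 ∷ tup 15 24 26 10 0 1 0 3 ∷ tup 13 27 6 19 0 1 1 3 ∷ [])

dd-31-valid : Valid dd-31
dd-31-valid = refl

dd-35 : Family
dd-35 = family 17 2 1 35 (
  tup 17 6 34 7 19 1 0 2 ∷ tup 9 2 17 1 4 0 2 0 ∷ tup 2 9 0 18 6 0 1 0 ∷ tup 17 25 3 16 22 3 6 2 ∷
  tup 21 22 31 17 14 3 5 2 ∷ tup 21 6 0 20 27 2 4 3 ∷ tup 6 30 17 11 28 2 3 3 ∷ [])

dd-35-valid : Valid dd-35
dd-35-valid = refl

dd-41 : Family
dd-41 = family 41 1 1 41 (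
  tup 32 8 6 0 27 0 2 0 ∷ tup 1 31 13 0 38 0 3 0 ∷ tup 9 33 35 0 14 0 0 0 ∷ tup 40 10 28 0 3 0 1 0 ∷
  [])

dd-41-valid : Valid dd-41
dd-41-valid = refl

dd-45 : Family
dd-45 = family 22 2 1 45 (
  tup 0 39 44 22 1 1 0 2 ∷ tup 9 11 3 8 22 2 2 3 ∷ tup 0 9 29 12 7 0 5 2 ∷ tup 14 10 18 42 22 1 1 1 ∷
  tup 25 0 23 10 31 1 6 1 ∷ tup 26 40 16 7 0 1 3 2 ∷ tup 22 25 2 13 29 1 4 1 ∷ tup 22 37 38 8 33 1 8 0 ∷
  tup 23 22 17 35 32 0 7 1 ∷ [])

dd-45-valid : Valid dd-45
dd-45-valid = refl

dd-51 : Family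
dd-51 = family 51 1 1 51 (
  tup 12 18 0 16 17 0 1 0 ∷ tup 6 0 2 46 20 3 2 0 ∷ tup 28 3 0 37 13 1 4 2 ∷ tup 0 31 15 43 22 1 0 2 ∷
  tup 0 8 29 32 19 1 3 3 ∷ [])

dd-51-valid : Valid dd-51
dd-51-valid = refl

dd-55 : Family
dd-55 = family 27 2 1 55 (
  tup 29 17 54 16 27 1 0 2 ∷ tup 48 47 52 0 49 3 8 1 ∷ tup 44 0 27 34 47 1 3 3 ∷ tup 42 14 38 27 0 3 2 1 ∷
  tup 48 2 35 43 27 0 10 1 ∷ tup 23 16 24 0 28 0 9 0 ∷ tup 1 24 27 22 45 3 7 2 ∷ tup 53 17 35 12 0 2 6 3 ∷
  tup 39 27 5 21 23 1 1 3 ∷ tup 20 0 35 29 5 0 5 0 ∷ tup 11 8 27 25 17 1 4 0 ∷ [])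

dd-55-valid : Valid dd-55
dd-55-valid = refl

dd-61 : Family
dd-61 = family 61 1 1 61 (
  tup 6 5 0 24 40 0 3 0 ∷ tup 23 9 0 31 11 0 4 0 ∷ tup 17 4 0 7 32 0 5 0 ∷ tup 55 56 0 37 21 0 0 0 ∷
  tup 38 52 0 30 50 0 1 0 ∷ tup 44 57 0 54 29 0 2 0 ∷ [])

dd-61-valid : Valid dd-61
dd-61-valid = refl

dd-65 : Family
dd-65 = family 13 5 1 65 (
  tup 15 13 45 14 17 2 9 0 ∷ tup 51 52 0 18 55 0 24 2 ∷ tup 1 2 5 13 21 0 18 0 ∷ tup 16 42 31 35 0 1 19 1 ∷
  tup 13 53 20 41 31 0 20 0 ∷ tup 48 36 13 2 49 0 21 0 ∷ tup 13 22 3 64 35 2 7 1 ∷ tup 40 61 0 13 36 1 6 2 ∷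
  tup 36 26 17 31 33 2 17 0 ∷ tup 21 39 0 38 41 0 0 2 ∷ tup 5 10 12 26 27 0 26 0 ∷ tup 28 15 64 58 0 1 27 1 ∷
  tup 26 44 35 23 64 0 28 0 ∷ tup 19 63 26 10 24 0 29 0 ∷ tup 26 32 2 47 58 2 15 1 ∷ tup 18 45 0 26 63 1 14 2 ∷
  tup 63 52 33 64 61 2 25 0 ∷ tup 27 13 0 60 23 0 8 2 ∷ tup 12 11 8 52 57 0 2 0 ∷ tup 62 36 47 43 0 1 3 1 ∷
  tup 52 25 58 37 47 0 4 0 ∷ tup 30 42 52 11 29 0 5 0 ∷ tup 52 56 10 14 43 2 23 1 ∷ tup 38 17 0 52 42 1 22 2 ∷
  tup 42 39 61 47 45 2 1 0 ∷ tup 57 26 0 40 37 0 16 2 ∷ tup 8 3 1 39 51 0 10 0 ∷ tup 50 63 14 20 0 1 11 1 ∷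
  tup 39 34 43 55 14 0 12 0 ∷ tup 59 15 39 3 54 0 13 0 ∷ tup 39 46 11 31 20 2 31 1 ∷ tup 60 33 0 39 15 1 30 2 ∷
  [])

dd-65-valid : Valid dd-65
dd-65-valid = refl

-- Each row is 20 times the preceding one modulo 71, and 20 has multiplicative order 7. A mate found
-- for one row is carried to all others by this multiplier. The orders 131, 191, 211 and 311 use the
-- multipliers 39, 5, 34 and 7 in the same way.
dd-71 : Family
dd-71 = family 71 1 1 71 (
  tup 0 13 5 20 19 0 4 2 ∷ tup 0 47 29 45 25 0 5 2 ∷ tup 0 17 12 48 3 0 6 2 ∷ tup 0 56 27 37 60 0 0 2 ∷
  tup 0 55 43 30 64 0 1 2 ∷ tup 0 35 8 32 2 0 2 2 ∷ tup 0 61 18 1 40 0 3 2 ∷ [])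

dd-71-valid : Valid dd-71
dd-71-valid = refl

dd-75 : Family
dd-75 = family 37 2 1 75 (
  tup 0 53 74 52 2 1 0 2 ∷ tup 55 13 37 14 12 1 9 1 ∷ tup 28 69 22 0 25 2 3 2 ∷ tup 14 37 0 22 18 2 2 2 ∷
  tup 72 0 5 73 19 2 10 1 ∷ tup 0 65 29 67 63 3 11 2 ∷ tup 16 5 64 71 0 0 8 2 ∷ tup 23 37 16 62 29 2 13 2 ∷
  tup 37 8 25 36 15 2 6 0 ∷ tup 0 44 20 47 57 1 1 1 ∷ tup 20 63 32 53 37 1 4 2 ∷ tup 37 53 67 71 42 2 5 3 ∷
  tup 37 11 35 60 43 3 14 1 ∷ tup 52 24 43 34 37 2 7 2 ∷ tup 48 40 57 0 72 1 12 3 ∷ [])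

dd-75-valid : Valid dd-75
dd-75-valid = refl

dd-81 : Family
dd-81 = family 81 1 1 81 (
  tup 28 0 20 31 29 0 4 0 ∷ tup 55 18 34 0 22 0 5 0 ∷ tup 0 36 74 23 17 0 6 0 ∷ tup 42 10 56 0 15 0 7 0 ∷
  tup 53 0 61 50 52 0 0 0 ∷ tup 26 63 47 0 59 0 1 0 ∷ tup 0 45 7 58 64 0 2 0 ∷ tup 39 71 25 0 66 0 3 0 ∷
  [])

dd-81-valid : Valid dd-81
dd-81-valid = refl

dd-85 : Family
dd-85 = family 17 5 1 85 (
  tup 19 20 11 28 45 2 1 2 ∷ tup 8 12 27 10 61 2 0 2 ∷ tup 62 3 2 45 11 1 9 0 ∷ tup 35 52 20 33 18 2 8 2 ∷
  tup 69 19 18 70 78 2 40 0 ∷ tup 15 83 79 11 81 1 7 3 ∷ tup 38 47 77 76 51 3 29 3 ∷ tup 55 53 37 69 73 3 5 1 ∷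
  tup 57 59 22 26 7 2 3 2 ∷ tup 7 8 33 46 37 0 2 1 ∷ tup 3 82 39 79 0 1 31 1 ∷ tup 14 71 46 74 0 0 11 3 ∷
  tup 73 17 29 54 78 1 13 1 ∷ tup 80 17 22 65 75 1 12 1 ∷ tup 0 73 35 24 30 3 15 3 ∷ tup 0 80 50 27 21 3 14 3 ∷
  tup 71 55 1 11 17 2 17 2 ∷ tup 82 64 16 6 17 2 16 2 ∷ tup 73 18 36 0 12 3 19 3 ∷ tup 80 33 49 0 5 3 18 3 ∷
  tup 59 31 17 4 71 0 25 0 ∷ tup 60 20 17 13 82 0 24 0 ∷ tup 38 0 20 44 48 2 36 0 ∷ tup 47 0 31 41 37 2 37 0 ∷
  tup 17 57 12 67 56 0 21 0 ∷ tup 17 62 5 52 63 0 20 0 ∷ tup 84 35 63 0 22 2 34 3 ∷ tup 69 50 56 0 29 2 35 3 ∷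
  tup 17 3 48 55 81 1 39 0 ∷ tup 17 14 37 64 72 3 6 3 ∷ tup 63 34 76 35 37 2 38 0 ∷ tup 56 34 77 50 48 1 10 1 ∷
  tup 51 55 83 63 48 0 33 0 ∷ tup 51 64 70 56 37 0 32 0 ∷ tup 42 0 60 11 57 3 26 2 ∷ tup 43 0 59 6 62 3 27 2 ∷
  tup 41 17 66 36 27 0 22 2 ∷ tup 44 17 53 49 24 0 23 2 ∷ tup 34 75 11 65 82 0 30 2 ∷ tup 34 6 78 71 54 0 28 1 ∷
  tup 79 27 39 73 51 2 41 2 ∷ tup 24 74 80 46 51 0 4 0 ∷ [])

dd-85-valid : Valid dd-85
dd-85-valid = refl

dd-91 : Family
dd-91 = family 91 1 1 91 (
  tup 47 48 9 46 0 1 7 3 ∷ tup 0 47 4 19 6 3 3 1 ∷ tup 35 0 14 25 10 0 8 1 ∷ tup 24 40 53 8 0 1 1 3 ∷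
  tup 0 24 64 31 5 3 6 1 ∷ tup 14 0 42 36 69 0 2 1 ∷ tup 20 3 29 37 0 1 4 3 ∷ tup 0 20 23 41 80 3 0 1 ∷
  tup 42 0 35 30 12 0 5 1 ∷ [])

dd-91-valid : Valid dd-91
dd-91-valid = refl

dd-95 : Family
dd-95 = family 47 2 1 95 (
  tup 36 88 94 4 93 0 14 1 ∷ tup 37 22 83 70 6 2 2 0 ∷ tup 65 78 74 69 48 0 1 2 ∷ tup 67 68 6 70 0 1 13 0 ∷
  tup 74 73 41 71 0 0 3 0 ∷ tup 76 51 0 58 66 0 6 0 ∷ tup 65 90 0 83 75 0 5 0 ∷ tup 57 0 2 51 71 3 8 3 ∷
  tup 0 84 45 90 70 3 7 3 ∷ tup 3 14 58 24 0 0 10 0 ∷ tup 44 33 83 23 0 0 9 0 ∷ tup 0 63 22 4 17 1 15 0 ∷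
  tup 0 78 25 43 30 1 16 0 ∷ tup 0 62 20 74 85 1 0 3 ∷ tup 0 79 27 67 56 0 4 1 ∷ tup 9 50 1 69 0 0 11 1 ∷
  tup 38 91 46 72 0 0 12 1 ∷ tup 85 19 54 7 0 2 18 2 ∷ tup 56 28 40 87 0 2 17 2 ∷ [])

dd-95-valid : Valid dd-95
dd-95-valid = refl

-- The last ten rows are copies of `dd-21`, one in each of the five columns; the other rows form a
-- group divisible design of type 21⁵ on these columns.
dd-105 : Family
dd-105 = family 21 5 1 105 (
  tup 57 78 103 40 18 0 1 2 ∷ tup 36 99 68 47 18 0 0 2 ∷ tup 64 28 84 0 42 0 22 2 ∷ tup 29 56 63 0 84 0 23 2 ∷
  tup 43 91 21 0 63 0 24 2 ∷ tup 92 77 42 0 21 0 25 2 ∷ tup 0 28 43 85 66 1 32 2 ∷ tup 0 56 92 71 24 1 33 2 ∷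
  tup 0 91 64 22 45 1 30 2 ∷ tup 0 77 29 50 87 1 31 2 ∷ tup 45 4 71 85 21 0 29 3 ∷ tup 87 11 22 71 42 0 26 3 ∷
  tup 66 4 50 22 84 0 27 3 ∷ tup 24 11 85 50 63 0 28 3 ∷ tup 79 21 7 86 45 0 37 0 ∷ tup 23 42 14 79 87 0 34 0 ∷
  tup 58 84 7 23 66 0 35 0 ∷ tup 86 63 14 58 24 0 36 0 ∷ tup 58 21 75 1 91 0 39 3 ∷ tup 86 42 33 8 77 0 40 3 ∷
  tup 79 84 54 1 28 0 41 3 ∷ tup 23 63 96 8 56 0 38 3 ∷ tup 60 6 21 78 95 2 2 0 ∷ tup 102 6 42 36 67 2 3 0 ∷
  tup 81 6 84 57 32 2 4 0 ∷ tup 39 6 63 99 46 2 5 0 ∷ tup 83 21 60 16 92 3 11 0 ∷ tup 34 42 102 2 64 3 12 0 ∷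
  tup 62 84 81 16 29 3 13 0 ∷ tup 97 63 39 2 43 3 10 0 ∷ tup 50 19 74 101 21 2 8 1 ∷ tup 85 5 25 73 42 2 9 1 ∷
  tup 71 19 53 38 84 2 6 1 ∷ tup 22 5 88 52 63 2 7 1 ∷ tup 61 21 71 2 90 2 19 3 ∷ tup 89 42 22 16 69 2 20 3 ∷
  tup 82 84 50 2 27 2 21 3 ∷ tup 26 63 85 16 48 2 18 3 ∷ tup 45 86 0 75 35 0 14 3 ∷ tup 87 79 0 33 49 0 15 3 ∷
  tup 66 23 0 54 98 0 16 3 ∷ tup 24 58 0 96 70 0 17 3 ∷ tup 7 20 0 17 5 0 43 0 ∷ tup 14 1 0 4 16 0 42 0 ∷
  tup 28 41 21 38 26 0 45 0 ∷ tup 35 22 21 25 37 0 44 0 ∷ tup 49 62 42 59 47 0 47 0 ∷ tup 56 43 42 46 58 0 46 0 ∷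
  tup 70 83 63 80 68 0 49 0 ∷ tup 77 64 63 67 79 0 48 0 ∷ tup 91 104 84 101 89 0 51 0 ∷ tup 98 85 84 88 100 0 50 0 ∷
  [])

dd-105-valid : Valid dd-105
dd-105-valid = refl

dd-111 : Family
dd-111 = family 111 1 1 111 (
  tup 78 80 0 76 77 2 8 3 ∷ tup 65 22 0 25 29 0 2 3 ∷ tup 63 73 9 68 0 3 1 0 ∷ tup 56 92 50 62 0 2 6 0 ∷
  tup 100 19 93 0 9 1 5 3 ∷ tup 45 58 66 0 37 3 4 1 ∷ tup 38 26 0 60 88 0 3 2 ∷ tup 28 15 0 93 79 3 9 3 ∷
  tup 0 87 15 32 67 1 10 3 ∷ tup 69 85 0 44 58 3 7 3 ∷ tup 87 16 70 39 0 2 0 1 ∷ [])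

dd-111-valid : Valid dd-111
dd-111-valid = refl

dd-115 : Family
dd-115 = family 57 2 1 115 (
  tup 90 28 114 79 27 3 14 1 ∷ tup 20 48 49 86 68 3 2 0 ∷ tup 58 76 67 90 101 0 1 3 ∷ tup 72 73 70 0 80 0 4 0 ∷
  tup 99 98 101 0 91 0 3 0 ∷ tup 2 100 104 80 0 1 6 1 ∷ tup 55 71 67 91 0 1 5 1 ∷ tup 69 95 0 57 74 0 8 0 ∷
  tup 102 76 57 0 97 0 7 0 ∷ tup 66 12 94 0 79 0 22 0 ∷ tup 105 45 77 0 92 0 21 0 ∷ tup 0 11 83 5 61 0 12 0 ∷
  tup 0 46 88 52 110 0 11 0 ∷ tup 54 0 62 68 35 1 0 0 ∷ tup 3 0 109 103 22 0 13 0 ∷ tup 112 4 85 0 20 3 16 3 ∷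
  tup 53 59 86 0 37 3 15 3 ∷ tup 0 26 85 17 101 0 18 0 ∷ tup 0 31 86 40 70 0 17 0 ∷ tup 74 10 18 0 42 1 20 1 ∷
  tup 97 47 39 0 15 1 19 1 ∷ tup 23 83 30 0 44 0 10 0 ∷ tup 34 88 27 0 13 0 9 0 ∷ [])

dd-115-valid : Valid dd-115
dd-115-valid = refl

-- Five copies of ℤ/25 carry the ascending lines x = a + b i and the descending parabolas x = a + b
-- i + i² for i = 0, ..., 4; then come five copies of `dd-25`. Differences of the values of i are
-- units modulo 25, so a line and a parabola meet at most twice. The residue t is written as 5 (t
-- mod 5) + t div 5, so that the rotation of order 5 adds 5 to t.
dd-125 : Family
dd-125 = family 5 25 1 125 (
  tup 0 25 50 75 100 0 49 3 ∷ tup 108 96 70 30 0 0 164 3 ∷ tup 0 30 60 90 120 0 1 3 ∷ tup 104 87 56 35 0 0 166 3 ∷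
  tup 0 35 70 81 116 0 3 3 ∷ tup 124 78 66 40 0 0 168 3 ∷ tup 0 40 56 96 112 0 5 3 ∷ tup 115 93 52 45 0 0 170 3 ∷
  tup 0 45 66 87 108 0 7 3 ∷ tup 111 84 62 26 0 0 172 3 ∷ tup 0 26 52 78 104 0 9 3 ∷ tup 107 99 72 31 0 0 174 3 ∷
  tup 0 31 62 93 124 0 11 3 ∷ tup 103 85 58 36 0 0 176 3 ∷ tup 0 36 72 84 115 0 13 3 ∷ tup 123 76 68 41 0 0 178 3 ∷
  tup 0 41 58 99 111 0 15 3 ∷ tup 119 91 54 46 0 0 180 3 ∷ tup 0 46 68 85 107 0 17 3 ∷ tup 110 82 64 27 0 0 182 3 ∷
  tup 0 27 54 76 103 0 19 3 ∷ tup 106 97 74 32 0 0 184 3 ∷ tup 0 32 64 91 123 0 21 3 ∷ tup 102 88 55 37 0 0 186 3 ∷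
  tup 0 37 74 82 119 0 23 3 ∷ tup 122 79 65 42 0 0 188 3 ∷ tup 0 42 55 97 110 0 25 3 ∷ tup 118 94 51 47 0 0 190 3 ∷
  tup 0 47 65 88 106 0 27 3 ∷ tup 114 80 61 28 0 0 192 3 ∷ tup 0 28 51 79 102 0 29 3 ∷ tup 105 95 71 33 0 0 194 3 ∷
  tup 0 33 61 94 122 0 31 3 ∷ tup 101 86 57 38 0 0 196 3 ∷ tup 0 38 71 80 118 0 33 3 ∷ tup 121 77 67 43 0 0 198 3 ∷
  tup 0 43 57 95 114 0 35 3 ∷ tup 117 92 53 48 0 0 150 3 ∷ tup 0 48 67 86 105 0 37 3 ∷ tup 113 83 63 29 0 0 152 3 ∷
  tup 0 29 53 77 101 0 39 3 ∷ tup 109 98 73 34 0 0 154 3 ∷ tup 0 34 63 92 121 0 41 3 ∷ tup 100 89 59 39 0 0 156 3 ∷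
  tup 0 39 73 83 117 0 43 3 ∷ tup 120 75 69 44 0 0 158 3 ∷ tup 0 44 59 98 113 0 45 3 ∷ tup 116 90 50 49 0 0 160 3 ∷
  tup 0 49 69 89 109 0 47 3 ∷ tup 112 81 60 25 0 0 162 3 ∷ tup 5 30 55 80 105 0 99 3 ∷ tup 113 77 51 35 5 0 214 3 ∷
  tup 5 35 65 95 101 0 51 3 ∷ tup 109 92 61 40 5 0 216 3 ∷ tup 5 40 51 86 121 0 53 3 ∷ tup 100 83 71 45 5 0 218 3 ∷
  tup 5 45 61 77 117 0 55 3 ∷ tup 120 98 57 26 5 0 220 3 ∷ tup 5 26 71 92 113 0 57 3 ∷ tup 116 89 67 31 5 0 222 3 ∷
  tup 5 31 57 83 109 0 59 3 ∷ tup 112 75 53 36 5 0 224 3 ∷ tup 5 36 67 98 100 0 61 3 ∷ tup 108 90 63 41 5 0 226 3 ∷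
  tup 5 41 53 89 120 0 63 3 ∷ tup 104 81 73 46 5 0 228 3 ∷ tup 5 46 63 75 116 0 65 3 ∷ tup 124 96 59 27 5 0 230 3 ∷
  tup 5 27 73 90 112 0 67 3 ∷ tup 115 87 69 32 5 0 232 3 ∷ tup 5 32 59 81 108 0 69 3 ∷ tup 111 78 50 37 5 0 234 3 ∷
  tup 5 37 69 96 104 0 71 3 ∷ tup 107 93 60 42 5 0 236 3 ∷ tup 5 42 50 87 124 0 73 3 ∷ tup 103 84 70 47 5 0 238 3 ∷
  tup 5 47 60 78 115 0 75 3 ∷ tup 123 99 56 28 5 0 240 3 ∷ tup 5 28 70 93 111 0 77 3 ∷ tup 119 85 66 33 5 0 242 3 ∷
  tup 5 33 56 84 107 0 79 3 ∷ tup 110 76 52 38 5 0 244 3 ∷ tup 5 38 66 99 103 0 81 3 ∷ tup 106 91 62 43 5 0 246 3 ∷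
  tup 5 43 52 85 123 0 83 3 ∷ tup 102 82 72 48 5 0 248 3 ∷ tup 5 48 62 76 119 0 85 3 ∷ tup 122 97 58 29 5 0 200 3 ∷
  tup 5 29 72 91 110 0 87 3 ∷ tup 118 88 68 34 5 0 202 3 ∷ tup 5 34 58 82 106 0 89 3 ∷ tup 114 79 54 39 5 0 204 3 ∷
  tup 5 39 68 97 102 0 91 3 ∷ tup 105 94 64 44 5 0 206 3 ∷ tup 5 44 54 88 122 0 93 3 ∷ tup 101 80 74 49 5 0 208 3 ∷
  tup 5 49 64 79 118 0 95 3 ∷ tup 121 95 55 25 5 0 210 3 ∷ tup 5 25 74 94 114 0 97 3 ∷ tup 117 86 65 30 5 0 212 3 ∷
  tup 10 35 60 85 110 0 149 3 ∷ tup 118 82 56 40 10 0 14 3 ∷ tup 10 40 70 76 106 0 101 3 ∷ tup 114 97 66 45 10 0 16 3 ∷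
  tup 10 45 56 91 102 0 103 3 ∷ tup 105 88 52 26 10 0 18 3 ∷ tup 10 26 66 82 122 0 105 3 ∷ tup 101 79 62 31 10 0 20 3 ∷
  tup 10 31 52 97 118 0 107 3 ∷ tup 121 94 72 36 10 0 22 3 ∷ tup 10 36 62 88 114 0 109 3 ∷ tup 117 80 58 41 10 0 24 3 ∷
  tup 10 41 72 79 105 0 111 3 ∷ tup 113 95 68 46 10 0 26 3 ∷ tup 10 46 58 94 101 0 113 3 ∷ tup 109 86 54 27 10 0 28 3 ∷
  tup 10 27 68 80 121 0 115 3 ∷ tup 100 77 64 32 10 0 30 3 ∷ tup 10 32 54 95 117 0 117 3 ∷ tup 120 92 74 37 10 0 32 3 ∷
  tup 10 37 64 86 113 0 119 3 ∷ tup 116 83 55 42 10 0 34 3 ∷ tup 10 42 74 77 109 0 121 3 ∷ tup 112 98 65 47 10 0 36 3 ∷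
  tup 10 47 55 92 100 0 123 3 ∷ tup 108 89 51 28 10 0 38 3 ∷ tup 10 28 65 83 120 0 125 3 ∷ tup 104 75 61 33 10 0 40 3 ∷
  tup 10 33 51 98 116 0 127 3 ∷ tup 124 90 71 38 10 0 42 3 ∷ tup 10 38 61 89 112 0 129 3 ∷ tup 115 81 57 43 10 0 44 3 ∷
  tup 10 43 71 75 108 0 131 3 ∷ tup 111 96 67 48 10 0 46 3 ∷ tup 10 48 57 90 104 0 133 3 ∷ tup 107 87 53 29 10 0 48 3 ∷
  tup 10 29 67 81 124 0 135 3 ∷ tup 103 78 63 34 10 0 0 3 ∷ tup 10 34 53 96 115 0 137 3 ∷ tup 123 93 73 39 10 0 2 3 ∷
  tup 10 39 63 87 111 0 139 3 ∷ tup 119 84 59 44 10 0 4 3 ∷ tup 10 44 73 78 107 0 141 3 ∷ tup 110 99 69 49 10 0 6 3 ∷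
  tup 10 49 59 93 103 0 143 3 ∷ tup 106 85 50 25 10 0 8 3 ∷ tup 10 25 69 84 123 0 145 3 ∷ tup 102 76 60 30 10 0 10 3 ∷
  tup 10 30 50 99 119 0 147 3 ∷ tup 122 91 70 35 10 0 12 3 ∷ tup 15 40 65 90 115 0 199 3 ∷ tup 123 87 61 45 15 0 64 3 ∷
  tup 15 45 51 81 111 0 151 3 ∷ tup 119 78 71 26 15 0 66 3 ∷ tup 15 26 61 96 107 0 153 3 ∷ tup 110 93 57 31 15 0 68 3 ∷
  tup 15 31 71 87 103 0 155 3 ∷ tup 106 84 67 36 15 0 70 3 ∷ tup 15 36 57 78 123 0 157 3 ∷ tup 102 99 53 41 15 0 72 3 ∷
  tup 15 41 67 93 119 0 159 3 ∷ tup 122 85 63 46 15 0 74 3 ∷ tup 15 46 53 84 110 0 161 3 ∷ tup 118 76 73 27 15 0 76 3 ∷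
  tup 15 27 63 99 106 0 163 3 ∷ tup 114 91 59 32 15 0 78 3 ∷ tup 15 32 73 85 102 0 165 3 ∷ tup 105 82 69 37 15 0 80 3 ∷
  tup 15 37 59 76 122 0 167 3 ∷ tup 101 97 50 42 15 0 82 3 ∷ tup 15 42 69 91 118 0 169 3 ∷ tup 121 88 60 47 15 0 84 3 ∷
  tup 15 47 50 82 114 0 171 3 ∷ tup 117 79 70 28 15 0 86 3 ∷ tup 15 28 60 97 105 0 173 3 ∷ tup 113 94 56 33 15 0 88 3 ∷
  tup 15 33 70 88 101 0 175 3 ∷ tup 109 80 66 38 15 0 90 3 ∷ tup 15 38 56 79 121 0 177 3 ∷ tup 100 95 52 43 15 0 92 3 ∷
  tup 15 43 66 94 117 0 179 3 ∷ tup 120 86 62 48 15 0 94 3 ∷ tup 15 48 52 80 113 0 181 3 ∷ tup 116 77 72 29 15 0 96 3 ∷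
  tup 15 29 62 95 109 0 183 3 ∷ tup 112 92 58 34 15 0 98 3 ∷ tup 15 34 72 86 100 0 185 3 ∷ tup 108 83 68 39 15 0 50 3 ∷
  tup 15 39 58 77 120 0 187 3 ∷ tup 104 98 54 44 15 0 52 3 ∷ tup 15 44 68 92 116 0 189 3 ∷ tup 124 89 64 49 15 0 54 3 ∷
  tup 15 49 54 83 112 0 191 3 ∷ tup 115 75 74 25 15 0 56 3 ∷ tup 15 25 64 98 108 0 193 3 ∷ tup 111 90 55 30 15 0 58 3 ∷
  tup 15 30 74 89 104 0 195 3 ∷ tup 107 81 65 35 15 0 60 3 ∷ tup 15 35 55 75 124 0 197 3 ∷ tup 103 96 51 40 15 0 62 3 ∷
  tup 20 45 70 95 120 0 249 3 ∷ tup 104 92 66 26 20 0 114 3 ∷ tup 20 26 56 86 116 0 201 3 ∷ tup 124 83 52 31 20 0 116 3 ∷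
  tup 20 31 66 77 112 0 203 3 ∷ tup 115 98 62 36 20 0 118 3 ∷ tup 20 36 52 92 108 0 205 3 ∷ tup 111 89 72 41 20 0 120 3 ∷
  tup 20 41 62 83 104 0 207 3 ∷ tup 107 75 58 46 20 0 122 3 ∷ tup 20 46 72 98 124 0 209 3 ∷ tup 103 90 68 27 20 0 124 3 ∷
  tup 20 27 58 89 115 0 211 3 ∷ tup 123 81 54 32 20 0 126 3 ∷ tup 20 32 68 75 111 0 213 3 ∷ tup 119 96 64 37 20 0 128 3 ∷
  tup 20 37 54 90 107 0 215 3 ∷ tup 110 87 74 42 20 0 130 3 ∷ tup 20 42 64 81 103 0 217 3 ∷ tup 106 78 55 47 20 0 132 3 ∷
  tup 20 47 74 96 123 0 219 3 ∷ tup 102 93 65 28 20 0 134 3 ∷ tup 20 28 55 87 119 0 221 3 ∷ tup 122 84 51 33 20 0 136 3 ∷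
  tup 20 33 65 78 110 0 223 3 ∷ tup 118 99 61 38 20 0 138 3 ∷ tup 20 38 51 93 106 0 225 3 ∷ tup 114 85 71 43 20 0 140 3 ∷
  tup 20 43 61 84 102 0 227 3 ∷ tup 105 76 57 48 20 0 142 3 ∷ tup 20 48 71 99 122 0 229 3 ∷ tup 101 91 67 29 20 0 144 3 ∷
  tup 20 29 57 85 118 0 231 3 ∷ tup 121 82 53 34 20 0 146 3 ∷ tup 20 34 67 76 114 0 233 3 ∷ tup 117 97 63 39 20 0 148 3 ∷
  tup 20 39 53 91 105 0 235 3 ∷ tup 113 88 73 44 20 0 100 3 ∷ tup 20 44 63 82 101 0 237 3 ∷ tup 109 79 59 49 20 0 102 3 ∷
  tup 20 49 73 97 121 0 239 3 ∷ tup 100 94 69 25 20 0 104 3 ∷ tup 20 25 59 88 117 0 241 3 ∷ tup 120 80 50 30 20 0 106 3 ∷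
  tup 20 30 69 79 113 0 243 3 ∷ tup 116 95 60 35 20 0 108 3 ∷ tup 20 35 50 94 109 0 245 3 ∷ tup 112 86 70 40 20 0 110 3 ∷
  tup 20 40 60 80 100 0 247 3 ∷ tup 108 77 56 45 20 0 112 3 ∷ tup 20 3 5 11 1 1 254 0 ∷ tup 18 2 7 5 15 0 259 1 ∷
  tup 24 23 5 7 12 1 258 1 ∷ tup 15 1 10 22 2 1 257 0 ∷ tup 6 4 14 10 5 0 250 1 ∷ tup 18 16 10 14 24 1 261 1 ∷
  tup 5 2 20 19 4 1 260 0 ∷ tup 12 3 23 20 10 0 253 1 ∷ tup 6 7 20 23 18 1 252 1 ∷ tup 10 4 15 8 3 1 251 0 ∷
  tup 24 1 16 15 20 0 256 1 ∷ tup 12 14 15 16 6 1 255 1 ∷ tup 45 28 30 36 26 1 266 0 ∷ tup 43 27 32 30 40 0 271 1 ∷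
  tup 49 48 30 32 37 1 270 1 ∷ tup 40 26 35 47 27 1 269 0 ∷ tup 31 29 39 35 30 0 262 1 ∷ tup 43 41 35 39 49 1 273 1 ∷
  tup 30 27 45 44 29 1 272 0 ∷ tup 37 28 48 45 35 0 265 1 ∷ tup 31 32 45 48 43 1 264 1 ∷ tup 35 29 40 33 28 1 263 0 ∷
  tup 49 26 41 40 45 0 268 1 ∷ tup 37 39 40 41 31 1 267 1 ∷ tup 70 53 55 61 51 1 278 0 ∷ tup 68 52 57 55 65 0 283 1 ∷
  tup 74 73 55 57 62 1 282 1 ∷ tup 65 51 60 72 52 1 281 0 ∷ tup 56 54 64 60 55 0 274 1 ∷ tup 68 66 60 64 74 1 285 1 ∷
  tup 55 52 70 69 54 1 284 0 ∷ tup 62 53 73 70 60 0 277 1 ∷ tup 56 57 70 73 68 1 276 1 ∷ tup 60 54 65 58 53 1 275 0 ∷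
  tup 74 51 66 65 70 0 280 1 ∷ tup 62 64 65 66 56 1 279 1 ∷ tup 95 78 80 86 76 1 290 0 ∷ tup 93 77 82 80 90 0 295 1 ∷
  tup 99 98 80 82 87 1 294 1 ∷ tup 90 76 85 97 77 1 293 0 ∷ tup 81 79 89 85 80 0 286 1 ∷ tup 93 91 85 89 99 1 297 1 ∷
  tup 80 77 95 94 79 1 296 0 ∷ tup 87 78 98 95 85 0 289 1 ∷ tup 81 82 95 98 93 1 288 1 ∷ tup 85 79 90 83 78 1 287 0 ∷
  tup 99 76 91 90 95 0 292 1 ∷ tup 87 89 90 91 81 1 291 1 ∷ tup 120 103 105 111 101 1 302 0 ∷
  tup 118 102 107 105 115 0 307 1 ∷ tup 124 123 105 107 112 1 306 1 ∷ tup 115 101 110 122 102 1 305 0 ∷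
  tup 106 104 114 110 105 0 298 1 ∷ tup 118 116 110 114 124 1 309 1 ∷ tup 105 102 120 119 104 1 308 0 ∷
  tup 112 103 123 120 110 0 301 1 ∷ tup 106 107 120 123 118 1 300 1 ∷ tup 110 104 115 108 103 1 299 0 ∷
  tup 124 101 116 115 120 0 304 1 ∷ tup 112 114 115 116 106 1 303 1 ∷ [])

dd-125-valid : Valid dd-125
dd-125-valid = refl

dd-131 : Family
dd-131 = family 131 1 1 131 (
  tup 0 23 54 13 24 2 8 3 ∷ tup 0 111 10 114 19 2 9 3 ∷ tup 0 6 128 123 86 2 10 3 ∷ tup 0 103 14 81 79 2 11 3 ∷
  tup 0 87 22 15 68 2 12 3 ∷ tup 0 118 72 61 32 2 0 3 ∷ tup 0 17 57 21 69 2 1 3 ∷ tup 0 8 127 33 71 2 2 3 ∷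
  tup 0 50 106 108 18 2 3 3 ∷ tup 0 116 73 20 47 2 4 3 ∷ tup 0 70 96 125 130 2 5 3 ∷ tup 0 110 76 28 92 2 6 3 ∷
  tup 0 98 82 44 51 2 7 3 ∷ [])

dd-131-valid : Valid dd-131
dd-131-valid = refl

dd-135 : Family
dd-135 = family 67 2 1 135 (
  tup 45 84 134 119 24 0 19 0 ∷ tup 26 47 97 110 3 2 2 2 ∷ tup 92 124 81 68 108 2 1 2 ∷ tup 24 0 72 25 22 0 4 0 ∷
  tup 43 0 129 42 45 0 3 0 ∷ tup 72 118 121 119 0 3 7 1 ∷ tup 129 83 80 82 0 3 8 1 ∷ tup 109 0 119 100 104 1 5 3 ∷
  tup 92 0 82 101 97 1 6 3 ∷ tup 4 112 126 100 0 0 16 1 ∷ tup 63 89 75 101 0 0 15 1 ∷ tup 37 26 86 31 0 3 12 3 ∷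
  tup 30 115 41 36 0 3 11 3 ∷ tup 0 27 73 35 17 1 24 1 ∷ tup 0 40 128 32 50 1 23 1 ∷ tup 19 73 47 0 111 1 10 0 ∷
  tup 48 128 20 0 90 1 9 0 ∷ tup 110 132 104 0 33 0 18 0 ∷ tup 91 69 97 0 34 0 17 0 ∷ tup 68 29 85 0 15 3 20 3 ∷
  tup 38 133 116 0 52 0 0 3 ∷ tup 7 58 125 0 94 1 22 1 ∷ tup 60 76 9 0 107 1 21 1 ∷ tup 22 97 9 67 90 1 14 1 ∷
  tup 45 104 58 67 111 1 13 1 ∷ tup 55 98 90 0 132 1 26 1 ∷ tup 12 103 111 0 69 1 25 1 ∷ [])

dd-135-valid : Valid dd-135
dd-135-valid = refl

dd-141 : Family
dd-141 = family 141 1 1 141 (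
  tup 0 9 22 23 25 0 7 0 ∷ tup 29 102 106 0 113 0 8 0 ∷ tup 0 83 21 59 51 0 9 0 ∷ tup 52 93 40 126 0 0 10 0 ∷
  tup 6 26 91 72 0 0 11 0 ∷ tup 87 92 0 45 123 0 12 0 ∷ tup 27 17 98 0 61 0 13 0 ∷ tup 0 132 119 118 116 0 0 0 ∷
  tup 112 39 35 0 28 0 1 0 ∷ tup 0 58 120 82 90 0 2 0 ∷ tup 89 48 101 15 0 0 3 0 ∷ tup 135 115 50 69 0 0 4 0 ∷
  tup 54 49 0 96 18 0 5 0 ∷ tup 114 124 43 0 80 0 6 0 ∷ [])

dd-141-valid : Valid dd-141
dd-141-valid = refl

dd-145 : Family
dd-145 = family 29 5 1 145 (
  tup 68 66 41 0 67 3 59 0 ∷ tup 120 125 86 0 137 3 56 0 ∷ tup 106 108 133 0 107 3 57 0 ∷ tup 54 49 88 0 37 3 58 0 ∷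
  tup 111 109 0 106 41 1 54 0 ∷ tup 56 32 0 54 86 1 55 0 ∷ tup 63 65 0 68 133 1 52 0 ∷ tup 118 142 0 120 88 1 53 0 ∷
  tup 84 87 80 29 77 2 33 0 ∷ tup 138 29 119 58 141 2 34 0 ∷ tup 90 58 94 116 97 2 35 0 ∷ tup 36 116 55 87 33 2 32 0 ∷
  tup 105 77 110 101 29 2 31 2 ∷ tup 42 141 44 52 58 2 28 2 ∷ tup 69 97 64 73 116 2 29 2 ∷ tup 132 33 130 122 87 2 30 2 ∷
  tup 58 66 55 29 122 3 18 3 ∷ tup 116 125 80 58 101 3 19 3 ∷ tup 87 108 119 116 52 3 16 3 ∷
  tup 29 49 94 87 73 3 17 3 ∷ tup 93 0 99 87 49 2 69 3 ∷ tup 43 0 57 29 66 2 70 3 ∷ tup 81 0 75 58 125 2 71 3 ∷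
  tup 131 0 117 116 108 2 68 3 ∷ tup 100 29 135 108 124 1 26 1 ∷ tup 40 58 112 49 96 1 27 1 ∷
  tup 74 116 39 66 50 1 24 1 ∷ tup 134 87 62 125 78 1 25 1 ∷ tup 76 33 37 29 131 2 13 2 ∷ tup 129 77 67 58 93 2 14 2 ∷
  tup 98 141 137 116 43 2 15 2 ∷ tup 45 97 107 87 81 2 12 2 ∷ tup 94 33 0 72 83 0 11 2 ∷ tup 55 77 0 139 126 0 8 2 ∷
  tup 80 141 0 102 91 0 9 2 ∷ tup 119 97 0 35 48 0 10 2 ∷ tup 0 74 63 92 33 0 46 0 ∷ tup 0 134 118 31 77 0 47 0 ∷
  tup 0 100 111 82 141 0 44 0 ∷ tup 0 40 56 143 97 0 45 0 ∷ tup 89 117 104 29 62 1 62 1 ∷ tup 53 99 30 58 135 1 63 1 ∷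
  tup 85 57 70 116 112 1 60 1 ∷ tup 121 75 144 87 39 1 61 1 ∷ tup 103 3 73 29 88 0 38 0 ∷ tup 47 7 122 58 41 0 39 0 ∷
  tup 71 26 101 116 86 0 36 0 ∷ tup 127 22 52 87 133 0 37 0 ∷ tup 0 47 132 3 8 1 50 1 ∷ tup 0 71 105 7 9 1 51 1 ∷
  tup 0 127 42 26 21 1 48 1 ∷ tup 0 103 69 22 20 1 49 1 ∷ tup 13 78 29 23 144 0 6 1 ∷ tup 11 124 58 15 104 0 7 1 ∷
  tup 16 96 116 6 30 0 4 1 ∷ tup 18 50 87 14 70 0 5 1 ∷ tup 130 22 81 29 89 0 1 3 ∷ tup 110 3 131 58 53 0 2 3 ∷
  tup 44 7 93 116 85 0 3 3 ∷ tup 64 26 43 87 121 0 0 3 ∷ tup 29 60 47 0 28 0 64 1 ∷ tup 58 140 71 0 17 0 65 1 ∷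
  tup 116 114 127 0 1 0 66 1 ∷ tup 87 34 103 0 12 0 67 1 ∷ tup 137 60 29 1 16 0 41 3 ∷ tup 107 140 58 12 18 0 42 3 ∷
  tup 37 114 116 28 13 0 43 3 ∷ tup 67 34 87 17 11 0 40 3 ∷ tup 0 44 13 135 136 3 23 2 ∷ tup 0 64 11 112 95 3 20 2 ∷
  tup 0 130 16 39 38 3 21 2 ∷ tup 0 110 18 62 79 3 22 2 ∷ [])

dd-145-valid : Valid dd-145
dd-145-valid = refl

-- Ascending lines and descending parabolas over ℤ/31, followed by five copies of `dd-31`. A line
-- and a parabola agree on two neighbouring values of i when their increments there agree, which
-- gives the mates. Orders 205 and 305 arise alike from 41 and 61.
dd-155 : Family
dd-155 = family 31 5 1 155 (
  tup 0 31 62 93 124 0 61 3 ∷ tup 140 102 66 32 0 0 14 3 ∷ tup 0 32 64 96 128 0 1 3 ∷ tup 144 105 68 33 0 0 16 3 ∷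
  tup 0 33 66 99 132 0 3 3 ∷ tup 148 108 70 34 0 0 18 3 ∷ tup 0 34 68 102 136 0 5 3 ∷ tup 152 111 72 35 0 0 20 3 ∷
  tup 0 35 70 105 140 0 7 3 ∷ tup 125 114 74 36 0 0 22 3 ∷ tup 0 36 72 108 144 0 9 3 ∷ tup 129 117 76 37 0 0 24 3 ∷
  tup 0 37 74 111 148 0 11 3 ∷ tup 133 120 78 38 0 0 26 3 ∷ tup 0 38 76 114 152 0 13 3 ∷ tup 137 123 80 39 0 0 28 3 ∷
  tup 0 39 78 117 125 0 15 3 ∷ tup 141 95 82 40 0 0 30 3 ∷ tup 0 40 80 120 129 0 17 3 ∷ tup 145 98 84 41 0 0 32 3 ∷
  tup 0 41 82 123 133 0 19 3 ∷ tup 149 101 86 42 0 0 34 3 ∷ tup 0 42 84 95 137 0 21 3 ∷ tup 153 104 88 43 0 0 36 3 ∷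
  tup 0 43 86 98 141 0 23 3 ∷ tup 126 107 90 44 0 0 38 3 ∷ tup 0 44 88 101 145 0 25 3 ∷ tup 130 110 92 45 0 0 40 3 ∷
  tup 0 45 90 104 149 0 27 3 ∷ tup 134 113 63 46 0 0 42 3 ∷ tup 0 46 92 107 153 0 29 3 ∷ tup 138 116 65 47 0 0 44 3 ∷
  tup 0 47 63 110 126 0 31 3 ∷ tup 142 119 67 48 0 0 46 3 ∷ tup 0 48 65 113 130 0 33 3 ∷ tup 146 122 69 49 0 0 48 3 ∷
  tup 0 49 67 116 134 0 35 3 ∷ tup 150 94 71 50 0 0 50 3 ∷ tup 0 50 69 119 138 0 37 3 ∷ tup 154 97 73 51 0 0 52 3 ∷
  tup 0 51 71 122 142 0 39 3 ∷ tup 127 100 75 52 0 0 54 3 ∷ tup 0 52 73 94 146 0 41 3 ∷ tup 131 103 77 53 0 0 56 3 ∷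
  tup 0 53 75 97 150 0 43 3 ∷ tup 135 106 79 54 0 0 58 3 ∷ tup 0 54 77 100 154 0 45 3 ∷ tup 139 109 81 55 0 0 60 3 ∷
  tup 0 55 79 103 127 0 47 3 ∷ tup 143 112 83 56 0 0 0 3 ∷ tup 0 56 81 106 131 0 49 3 ∷ tup 147 115 85 57 0 0 2 3 ∷
  tup 0 57 83 109 135 0 51 3 ∷ tup 151 118 87 58 0 0 4 3 ∷ tup 0 58 85 112 139 0 53 3 ∷ tup 124 121 89 59 0 0 6 3 ∷
  tup 0 59 87 115 143 0 55 3 ∷ tup 128 93 91 60 0 0 8 3 ∷ tup 0 60 89 118 147 0 57 3 ∷ tup 132 96 62 61 0 0 10 3 ∷
  tup 0 61 91 121 151 0 59 3 ∷ tup 136 99 64 31 0 0 12 3 ∷ tup 3 11 30 2 0 1 64 3 ∷ tup 15 24 26 10 0 1 62 3 ∷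
  tup 13 27 6 19 0 1 63 3 ∷ tup 34 42 61 33 31 1 67 3 ∷ tup 46 55 57 41 31 1 65 3 ∷ tup 44 58 37 50 31 1 66 3 ∷
  tup 65 73 92 64 62 1 70 3 ∷ tup 77 86 88 72 62 1 68 3 ∷ tup 75 89 68 81 62 1 69 3 ∷ tup 96 104 123 95 93 1 73 3 ∷
  tup 108 117 119 103 93 1 71 3 ∷ tup 106 120 99 112 93 1 72 3 ∷ tup 127 135 154 126 124 1 76 3 ∷
  tup 139 148 150 134 124 1 74 3 ∷ tup 137 151 130 143 124 1 75 3 ∷ [])

dd-155-valid : Valid dd-155
dd-155-valid = refl

dd-161 : Family
dd-161 = family 161 1 1 161 (
  tup 128 125 126 0 62 0 1 0 ∷ tup 33 36 35 0 99 0 0 0 ∷ tup 38 0 81 86 77 0 3 0 ∷ tup 123 0 80 75 84 0 2 0 ∷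
  tup 100 10 0 88 82 0 5 0 ∷ tup 61 151 0 73 79 0 4 0 ∷ tup 60 37 0 53 105 0 7 0 ∷ tup 101 124 0 108 56 0 6 0 ∷
  tup 8 59 40 25 0 0 9 0 ∷ tup 153 102 121 136 0 0 8 0 ∷ tup 96 26 0 67 47 0 11 0 ∷ tup 65 135 0 94 114 0 10 0 ∷
  tup 42 55 11 69 0 0 13 0 ∷ tup 119 106 150 92 0 0 12 0 ∷ tup 74 46 0 24 131 0 15 0 ∷ tup 87 115 0 137 30 0 14 0 ∷
  [])

dd-161-valid : Valid dd-161
dd-161-valid = refl

dd-165 : Family
dd-165 = family 33 5 1 165 (
  tup 152 104 92 14 56 2 8 2 ∷ tup 145 127 73 19 43 2 9 2 ∷ tup 161 160 70 0 163 1 41 0 ∷ tup 136 137 95 0 134 1 40 0 ∷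
  tup 17 33 25 13 115 3 33 0 ∷ tup 16 33 8 20 116 3 32 0 ∷ tup 66 34 52 163 35 2 35 1 ∷ tup 66 65 47 134 64 2 34 1 ∷
  tup 99 76 25 70 74 2 0 2 ∷ tup 99 89 8 95 91 2 1 2 ∷ tup 131 34 106 115 132 2 11 2 ∷ tup 100 65 125 116 132 2 10 2 ∷
  tup 1 156 0 162 70 1 61 2 ∷ tup 32 141 0 135 95 1 60 2 ∷ tup 37 30 21 115 33 1 15 1 ∷ tup 62 3 12 116 33 1 14 1 ∷
  tup 54 51 163 82 66 0 17 0 ∷ tup 45 48 134 83 66 0 16 0 ∷ tup 25 72 130 99 84 2 19 2 ∷ tup 8 93 101 99 81 2 18 2 ∷
  tup 132 157 34 105 123 1 29 0 ∷ tup 132 140 65 126 108 1 28 0 ∷ tup 97 100 99 0 46 2 23 2 ∷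
  tup 68 131 0 99 53 2 22 2 ∷ tup 124 132 33 85 136 1 25 1 ∷ tup 107 33 132 80 161 1 24 1 ∷ tup 66 0 109 16 133 0 27 0 ∷
  tup 0 66 122 17 164 0 26 0 ∷ tup 64 139 99 33 4 0 21 1 ∷ tup 35 158 33 99 29 0 20 1 ∷ tup 91 49 28 66 132 3 31 3 ∷
  tup 74 50 5 132 66 3 30 3 ∷ tup 129 0 139 144 68 0 5 3 ∷ tup 102 0 158 153 97 0 4 3 ∷ tup 15 153 33 28 107 1 7 2 ∷
  tup 18 144 33 5 124 1 6 2 ∷ tup 164 60 18 46 66 3 39 2 ∷ tup 133 39 15 53 66 3 38 2 ∷ tup 29 99 85 39 75 2 37 3 ∷
  tup 4 99 80 60 90 2 36 3 ∷ tup 90 132 50 109 102 0 3 1 ∷ tup 75 132 49 122 129 0 2 1 ∷ tup 0 151 2 74 41 1 80 0 ∷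
  tup 0 146 31 58 91 1 81 0 ∷ tup 33 41 98 10 131 0 45 0 ∷ tup 33 58 23 100 67 0 44 0 ∷ tup 40 66 161 128 98 2 47 2 ∷
  tup 59 66 103 136 67 2 46 2 ∷ tup 94 149 17 99 128 3 49 3 ∷ tup 16 71 148 99 103 3 48 3 ∷ tup 149 112 132 2 35 3 51 3 ∷
  tup 148 119 132 64 31 3 50 3 ∷ tup 63 74 67 15 0 1 53 1 ∷ tup 36 91 98 18 0 1 52 1 ∷ tup 103 87 131 60 33 1 74 0 ∷
  tup 128 78 100 39 33 1 75 0 ∷ tup 75 148 161 66 117 1 57 1 ∷ tup 90 149 136 66 114 1 56 1 ∷
  tup 102 99 17 138 31 0 59 0 ∷ tup 129 99 16 159 2 0 58 0 ∷ tup 144 35 24 132 58 2 13 1 ∷ tup 153 64 9 132 41 2 12 1 ∷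
  tup 0 67 117 11 6 3 63 3 ∷ tup 0 98 114 22 27 3 62 3 ∷ tup 57 33 103 44 138 0 65 0 ∷ tup 42 33 128 55 159 0 64 0 ∷
  tup 96 77 24 66 148 2 72 1 ∷ tup 69 88 9 66 149 2 73 1 ∷ tup 120 110 63 31 99 0 69 0 ∷ tup 111 121 36 2 99 0 68 0 ∷
  tup 87 58 150 143 132 2 71 2 ∷ tup 78 41 147 154 132 2 70 2 ∷ tup 52 75 0 64 59 1 66 2 ∷ tup 47 90 0 35 40 1 67 2 ∷
  tup 102 91 71 76 33 0 54 1 ∷ tup 129 74 94 89 33 0 55 1 ∷ tup 100 144 66 106 119 3 77 3 ∷ tup 131 153 66 125 112 3 76 3 ∷
  tup 99 146 136 15 160 1 79 1 ∷ tup 99 151 161 18 137 1 78 1 ∷ tup 16 132 13 23 60 0 42 1 ∷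
  tup 17 132 20 10 39 0 43 1 ∷ [])

dd-165-valid : Valid dd-165
dd-165-valid = refl

dd-185 : Family
dd-185 = family 37 5 1 185 (
  tup 154 165 128 175 166 1 1 1 ∷ tup 142 131 168 121 130 1 0 1 ∷ tup 131 47 0 132 134 3 14 0 ∷
  tup 165 64 0 164 162 3 15 0 ∷ tup 119 126 136 100 37 2 70 3 ∷ tup 177 170 160 85 37 2 71 3 ∷
  tup 139 74 113 1 117 2 21 2 ∷ tup 157 74 183 36 179 2 20 2 ∷ tup 100 98 97 0 47 0 9 0 ∷ tup 85 87 88 0 64 0 8 0 ∷
  tup 1 8 37 18 100 0 11 0 ∷ tup 36 29 37 19 85 0 10 0 ∷ tup 43 1 74 47 69 3 13 3 ∷ tup 68 36 74 64 42 3 12 3 ∷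
  tup 121 119 0 115 133 0 2 3 ∷ tup 175 177 0 181 163 0 3 3 ∷ tup 117 114 146 37 137 1 22 3 ∷
  tup 179 182 150 37 159 1 23 3 ∷ tup 128 74 141 112 134 0 24 0 ∷ tup 168 74 155 184 162 0 25 0 ∷
  tup 115 134 1 148 0 2 7 2 ∷ tup 181 162 36 111 0 2 6 2 ∷ tup 37 47 148 114 119 3 16 1 ∷ tup 37 64 111 182 177 3 17 1 ∷
  tup 100 117 141 74 148 0 18 0 ∷ tup 85 179 155 74 111 0 19 0 ∷ tup 82 8 86 0 76 3 45 3 ∷ tup 29 103 99 0 109 3 44 3 ∷
  tup 37 20 9 43 6 1 29 1 ∷ tup 37 17 28 31 68 1 28 1 ∷ tup 53 97 60 74 52 3 49 0 ∷ tup 58 51 88 74 59 3 48 0 ∷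
  tup 4 173 9 0 22 2 33 2 ∷ tup 33 123 28 0 15 2 32 2 ∷ tup 53 40 176 37 72 2 75 3 ∷ tup 58 71 120 37 39 2 74 3 ∷
  tup 86 104 91 169 74 0 37 0 ∷ tup 99 81 94 127 74 0 36 0 ∷ tup 151 18 111 37 12 3 76 1 ∷ tup 145 19 148 37 25 3 77 1 ∷
  tup 111 46 69 74 178 3 59 1 ∷ tup 148 65 42 74 118 3 58 1 ∷ tup 0 90 152 98 111 1 69 1 ∷ tup 0 95 144 87 148 1 68 1 ∷
  tup 140 94 149 109 0 3 27 3 ∷ tup 156 91 147 76 0 3 26 3 ∷ tup 158 17 142 37 15 1 51 2 ∷ tup 138 20 154 37 22 1 50 2 ∷
  tup 59 74 125 174 39 0 31 3 ∷ tup 52 74 171 122 72 0 30 3 ∷ tup 0 42 183 12 140 2 47 1 ∷ tup 0 69 113 25 156 2 46 1 ∷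
  tup 165 37 142 87 46 0 88 0 ∷ tup 131 37 154 98 65 0 89 0 ∷ tup 125 74 19 90 170 2 80 3 ∷ tup 171 74 18 95 126 2 81 3 ∷
  tup 84 40 1 111 166 1 65 2 ∷ tup 101 71 36 148 130 1 64 2 ∷ tup 47 111 104 26 180 1 41 3 ∷
  tup 64 148 81 11 116 1 40 3 ∷ tup 172 111 38 4 100 1 85 0 ∷ tup 124 148 73 33 85 1 84 0 ∷ tup 60 79 27 150 111 0 83 1 ∷
  tup 51 106 10 146 148 0 82 1 ∷ tup 111 82 13 48 168 2 57 1 ∷ tup 148 103 24 63 128 2 56 1 ∷
  tup 163 111 110 6 56 0 67 0 ∷ tup 133 148 75 31 55 0 66 0 ∷ tup 0 137 88 179 52 1 43 1 ∷ tup 0 159 97 117 59 1 42 1 ∷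
  tup 37 29 162 76 112 3 4 2 ∷ tup 37 8 134 109 184 3 5 2 ∷ tup 20 74 121 177 68 1 79 1 ∷ tup 17 74 175 119 43 1 78 1 ∷
  tup 159 90 0 41 124 3 35 2 ∷ tup 137 95 0 70 172 3 34 2 ∷ tup 184 12 37 77 130 1 38 3 ∷ tup 112 25 37 108 166 1 39 3 ∷
  tup 30 175 74 116 46 1 73 1 ∷ tup 7 121 74 180 65 1 72 1 ∷ tup 155 61 130 108 0 3 54 2 ∷ tup 141 50 166 77 0 3 55 2 ∷
  tup 7 92 37 181 116 1 63 0 ∷ tup 30 93 37 115 180 1 62 0 ∷ tup 70 182 32 124 74 0 61 1 ∷ tup 41 114 5 172 74 0 60 1 ∷
  tup 159 93 29 13 111 2 87 2 ∷ tup 137 92 8 24 148 2 86 2 ∷ tup 56 184 68 5 111 0 52 0 ∷ tup 55 112 43 32 148 0 53 0 ∷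
  tup 175 111 50 88 79 0 91 0 ∷ tup 121 148 61 97 106 0 90 0 ∷ [])

dd-185-valid : Valid dd-185
dd-185-valid = refl

dd-191 : Family
dd-191 = family 191 1 1 191 (
  tup 114 0 8 112 14 0 5 3 ∷ tup 188 0 40 178 70 0 6 3 ∷ tup 176 0 9 126 159 0 7 3 ∷ tup 116 0 45 57 31 0 8 3 ∷
  tup 7 0 34 94 155 0 9 3 ∷ tup 35 0 170 88 11 0 10 3 ∷ tup 175 0 86 58 55 0 11 3 ∷ tup 111 0 48 99 84 0 12 3 ∷
  tup 173 0 49 113 38 0 13 3 ∷ tup 101 0 54 183 190 0 14 3 ∷ tup 123 0 79 151 186 0 15 3 ∷ tup 42 0 13 182 166 0 16 3 ∷
  tup 19 0 65 146 66 0 17 3 ∷ tup 95 0 134 157 139 0 18 3 ∷ tup 93 0 97 21 122 0 0 3 ∷ tup 83 0 103 105 37 0 1 3 ∷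
  tup 33 0 133 143 185 0 2 3 ∷ tup 165 0 92 142 161 0 3 3 ∷ tup 61 0 78 137 41 0 4 3 ∷ [])

dd-191-valid : Valid dd-191
dd-191-valid = refl

dd-195 : Family
dd-195 = family 39 5 1 195 (
  tup 19 79 161 148 73 2 1 2 ∷ tup 20 116 151 164 44 2 0 2 ∷ tup 156 169 61 79 16 0 9 2 ∷ tup 117 143 56 116 23 0 8 2 ∷
  tup 188 65 123 17 92 3 68 1 ∷ tup 124 52 189 22 103 3 67 1 ∷ tup 185 66 24 146 114 1 51 3 ∷
  tup 127 51 15 166 81 1 52 3 ∷ tup 144 147 142 155 135 2 3 0 ∷ tup 168 165 170 157 177 2 2 0 ∷
  tup 78 89 163 121 103 0 17 1 ∷ tup 66 177 150 62 70 1 14 3 ∷ tup 18 150 159 8 28 3 18 3 ∷ tup 101 103 63 165 117 3 12 1 ∷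
  tup 94 32 0 139 166 1 20 3 ∷ tup 18 74 40 153 156 3 10 2 ∷ tup 8 35 45 76 80 2 11 3 ∷ tup 38 102 91 59 56 3 25 3 ∷
  tup 51 105 114 22 2 1 26 3 ∷ tup 44 66 61 186 136 1 15 1 ∷ tup 26 186 139 10 3 1 24 0 ∷ tup 106 194 135 107 105 3 13 0 ∷
  tup 40 164 150 147 167 3 21 1 ∷ tup 128 163 140 190 9 2 19 3 ∷ tup 129 176 167 138 94 2 30 0 ∷
  tup 58 130 181 76 40 1 32 1 ∷ tup 79 139 175 103 94 1 33 0 ∷ tup 16 118 187 10 22 3 16 0 ∷
  tup 136 189 26 2 11 0 22 1 ∷ tup 163 128 108 105 87 0 23 0 ∷ tup 137 166 54 48 60 3 36 1 ∷
  tup 186 117 93 13 17 0 27 1 ∷ tup 17 179 128 63 49 3 34 0 ∷ tup 188 152 97 87 53 2 35 2 ∷ tup 74 49 99 102 42 2 29 2 ∷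
  tup 31 22 80 90 85 0 28 3 ∷ tup 18 63 51 20 16 3 31 3 ∷ tup 159 126 128 0 127 0 38 0 ∷ tup 153 186 184 0 185 0 37 0 ∷
  tup 137 165 144 39 121 0 40 0 ∷ tup 175 147 168 39 191 0 39 0 ∷ tup 183 142 120 125 78 0 42 0 ∷
  tup 129 170 192 187 78 0 41 0 ∷ tup 39 0 22 126 21 0 44 0 ∷ tup 0 39 17 186 18 0 43 0 ∷ tup 40 78 39 144 63 1 46 1 ∷
  tup 77 39 78 168 54 1 45 1 ∷ tup 111 0 78 94 120 1 48 1 ∷ tup 84 78 0 101 192 1 47 1 ∷ tup 110 97 90 0 154 0 50 0 ∷
  tup 85 98 105 0 158 0 49 0 ∷ tup 5 124 31 36 39 3 6 1 ∷ tup 34 188 8 3 39 3 7 1 ∷ tup 78 151 69 67 41 0 59 2 ∷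
  tup 78 161 48 50 76 0 60 2 ∷ tup 3 160 154 150 0 1 56 1 ∷ tup 36 152 158 162 0 1 55 1 ∷ tup 48 181 39 124 138 0 72 3 ∷
  tup 69 131 39 188 174 0 71 3 ∷ tup 166 105 151 78 141 2 53 0 ∷ tup 146 90 161 78 171 2 54 0 ∷
  tup 137 28 99 41 0 2 82 2 ∷ tup 175 11 96 76 0 2 81 2 ∷ tup 39 58 24 125 110 2 80 2 ∷ tup 39 59 15 187 85 2 79 2 ∷
  tup 128 72 109 5 78 2 85 2 ∷ tup 184 45 86 34 78 2 86 2 ∷ tup 59 81 0 148 137 1 5 3 ∷ tup 58 114 0 164 175 1 4 3 ∷
  tup 86 125 9 145 39 0 87 0 ∷ tup 109 187 30 167 39 0 88 0 ∷ tup 11 78 136 128 66 3 58 0 ∷ tup 28 78 176 184 51 3 57 0 ∷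
  tup 40 0 134 128 174 3 74 3 ∷ tup 77 0 178 184 138 3 73 3 ∷ tup 39 155 137 94 171 1 96 3 ∷
  tup 39 157 175 101 141 1 95 3 ∷ tup 22 78 162 140 125 3 92 2 ∷ tup 17 78 150 172 187 3 91 2 ∷
  tup 106 182 172 0 50 2 64 2 ∷ tup 89 130 140 0 67 2 63 2 ∷ tup 19 182 39 98 178 2 62 2 ∷ tup 20 130 39 97 134 2 61 2 ∷
  tup 70 78 182 157 8 3 93 0 ∷ tup 47 78 130 155 31 3 94 0 ∷ tup 118 108 0 104 40 2 65 2 ∷ tup 194 87 0 91 77 2 66 2 ∷
  tup 133 94 39 26 12 0 69 0 ∷ tup 179 101 39 13 27 0 70 0 ∷ tup 78 139 22 65 75 3 90 3 ∷ tup 78 173 17 52 42 3 89 3 ∷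
  tup 53 0 167 191 87 2 78 3 ∷ tup 64 0 145 121 108 2 77 3 ∷ tup 27 176 39 107 170 0 83 3 ∷ tup 12 136 39 88 142 0 84 3 ∷
  tup 42 35 78 164 185 3 76 1 ∷ tup 75 4 78 148 127 3 75 1 ∷ [])

dd-195-valid : Valid dd-195
dd-195-valid = refl

dd-205 : Family
dd-205 = family 41 5 1 205 (
  tup 0 41 82 123 164 0 81 3 ∷ tup 180 132 86 42 0 0 14 3 ∷ tup 0 42 84 126 168 0 1 3 ∷ tup 184 135 88 43 0 0 16 3 ∷
  tup 0 43 86 129 172 0 3 3 ∷ tup 188 138 90 44 0 0 18 3 ∷ tup 0 44 88 132 176 0 5 3 ∷ tup 192 141 92 45 0 0 20 3 ∷
  tup 0 45 90 135 180 0 7 3 ∷ tup 196 144 94 46 0 0 22 3 ∷ tup 0 46 92 138 184 0 9 3 ∷ tup 200 147 96 47 0 0 24 3 ∷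
  tup 0 47 94 141 188 0 11 3 ∷ tup 204 150 98 48 0 0 26 3 ∷ tup 0 48 96 144 192 0 13 3 ∷ tup 167 153 100 49 0 0 28 3 ∷
  tup 0 49 98 147 196 0 15 3 ∷ tup 171 156 102 50 0 0 30 3 ∷ tup 0 50 100 150 200 0 17 3 ∷ tup 175 159 104 51 0 0 32 3 ∷
  tup 0 51 102 153 204 0 19 3 ∷ tup 179 162 106 52 0 0 34 3 ∷ tup 0 52 104 156 167 0 21 3 ∷ tup 183 124 108 53 0 0 36 3 ∷
  tup 0 53 106 159 171 0 23 3 ∷ tup 187 127 110 54 0 0 38 3 ∷ tup 0 54 108 162 175 0 25 3 ∷ tup 191 130 112 55 0 0 40 3 ∷
  tup 0 55 110 124 179 0 27 3 ∷ tup 195 133 114 56 0 0 42 3 ∷ tup 0 56 112 127 183 0 29 3 ∷ tup 199 136 116 57 0 0 44 3 ∷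
  tup 0 57 114 130 187 0 31 3 ∷ tup 203 139 118 58 0 0 46 3 ∷ tup 0 58 116 133 191 0 33 3 ∷ tup 166 142 120 59 0 0 48 3 ∷
  tup 0 59 118 136 195 0 35 3 ∷ tup 170 145 122 60 0 0 50 3 ∷ tup 0 60 120 139 199 0 37 3 ∷ tup 174 148 83 61 0 0 52 3 ∷
  tup 0 61 122 142 203 0 39 3 ∷ tup 178 151 85 62 0 0 54 3 ∷ tup 0 62 83 145 166 0 41 3 ∷ tup 182 154 87 63 0 0 56 3 ∷
  tup 0 63 85 148 170 0 43 3 ∷ tup 186 157 89 64 0 0 58 3 ∷ tup 0 64 87 151 174 0 45 3 ∷ tup 190 160 91 65 0 0 60 3 ∷
  tup 0 65 89 154 178 0 47 3 ∷ tup 194 163 93 66 0 0 62 3 ∷ tup 0 66 91 157 182 0 49 3 ∷ tup 198 125 95 67 0 0 64 3 ∷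
  tup 0 67 93 160 186 0 51 3 ∷ tup 202 128 97 68 0 0 66 3 ∷ tup 0 68 95 163 190 0 53 3 ∷ tup 165 131 99 69 0 0 68 3 ∷
  tup 0 69 97 125 194 0 55 3 ∷ tup 169 134 101 70 0 0 70 3 ∷ tup 0 70 99 128 198 0 57 3 ∷ tup 173 137 103 71 0 0 72 3 ∷
  tup 0 71 101 131 202 0 59 3 ∷ tup 177 140 105 72 0 0 74 3 ∷ tup 0 72 103 134 165 0 61 3 ∷ tup 181 143 107 73 0 0 76 3 ∷
  tup 0 73 105 137 169 0 63 3 ∷ tup 185 146 109 74 0 0 78 3 ∷ tup 0 74 107 140 173 0 65 3 ∷ tup 189 149 111 75 0 0 80 3 ∷
  tup 0 75 109 143 177 0 67 3 ∷ tup 193 152 113 76 0 0 0 3 ∷ tup 0 76 111 146 181 0 69 3 ∷ tup 197 155 115 77 0 0 2 3 ∷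
  tup 0 77 113 149 185 0 71 3 ∷ tup 201 158 117 78 0 0 4 3 ∷ tup 0 78 115 152 189 0 73 3 ∷ tup 164 161 119 79 0 0 6 3 ∷
  tup 0 79 117 155 193 0 75 3 ∷ tup 168 123 121 80 0 0 8 3 ∷ tup 0 80 119 158 197 0 77 3 ∷ tup 172 126 82 81 0 0 10 3 ∷
  tup 0 81 121 161 201 0 79 3 ∷ tup 176 129 84 41 0 0 12 3 ∷ tup 32 8 6 0 27 0 84 0 ∷ tup 1 31 13 0 38 0 85 0 ∷
  tup 9 33 35 0 14 0 82 0 ∷ tup 40 10 28 0 3 0 83 0 ∷ tup 73 49 47 41 68 0 88 0 ∷ tup 42 72 54 41 79 0 89 0 ∷
  tup 50 74 76 41 55 0 86 0 ∷ tup 81 51 69 41 44 0 87 0 ∷ tup 114 90 88 82 109 0 92 0 ∷ tup 83 113 95 82 120 0 93 0 ∷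
  tup 91 115 117 82 96 0 90 0 ∷ tup 122 92 110 82 85 0 91 0 ∷ tup 155 131 129 123 150 0 96 0 ∷
  tup 124 154 136 123 161 0 97 0 ∷ tup 132 156 158 123 137 0 94 0 ∷ tup 163 133 151 123 126 0 95 0 ∷
  tup 196 172 170 164 191 0 100 0 ∷ tup 165 195 177 164 202 0 101 0 ∷ tup 173 197 199 164 178 0 98 0 ∷
  tup 204 174 192 164 167 0 99 0 ∷ [])

dd-205-valid : Valid dd-205
dd-205-valid = refl

dd-211 : Family
dd-211 = family 211 1 1 211 (
  tup 87 9 0 72 65 2 5 3 ∷ tup 4 95 0 127 100 2 6 3 ∷ tup 136 65 0 98 24 2 7 3 ∷ tup 193 100 0 167 183 2 8 3 ∷
  tup 21 24 0 192 103 2 9 3 ∷ tup 81 183 0 198 126 2 10 3 ∷ tup 11 103 0 191 64 2 11 3 ∷ tup 163 126 0 164 66 2 12 3 ∷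
  tup 56 64 0 90 134 2 13 3 ∷ tup 5 66 0 106 125 2 14 3 ∷ tup 170 134 0 17 30 2 15 3 ∷ tup 83 125 0 156 176 2 16 3 ∷
  tup 79 30 0 29 76 2 17 3 ∷ tup 154 176 0 142 52 2 18 3 ∷ tup 172 76 0 186 80 2 19 3 ∷ tup 151 52 0 205 188 2 20 3 ∷
  tup 70 80 0 7 62 2 0 3 ∷ tup 59 188 0 27 209 2 1 3 ∷ tup 107 62 0 74 143 2 2 3 ∷ tup 51 209 0 195 9 2 3 3 ∷
  tup 46 143 0 89 95 2 4 3 ∷ [])

dd-211-valid : Valid dd-211
dd-211-valid = refl

dd-215 : Family
dd-215 = family 43 5 1 215 (
  tup 149 66 192 124 42 2 5 0 ∷ tup 195 63 152 91 1 0 18 0 ∷ tup 93 173 142 43 57 3 7 2 ∷ tup 151 192 27 15 64 2 6 3 ∷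
  tup 157 214 35 122 120 0 8 0 ∷ tup 95 206 156 94 96 0 0 2 ∷ tup 5 198 156 42 11 3 3 2 ∷ tup 194 157 75 61 68 2 2 3 ∷
  tup 176 162 148 190 126 0 4 0 ∷ tup 209 168 170 207 38 3 53 3 ∷ tup 144 175 156 206 52 3 55 0 ∷
  tup 17 15 182 14 129 0 12 0 ∷ tup 26 28 162 29 172 0 11 0 ∷ tup 47 59 129 84 189 2 103 1 ∷
  tup 82 70 172 45 155 2 104 1 ∷ tup 117 96 188 110 129 2 99 3 ∷ tup 98 119 156 105 172 2 100 3 ∷
  tup 46 129 48 0 45 3 54 0 ∷ tup 83 172 81 0 84 0 1 0 ∷ tup 116 104 129 98 43 0 20 0 ∷ tup 99 111 172 117 43 0 19 0 ∷
  tup 29 22 86 8 129 0 22 0 ∷ tup 14 21 86 35 172 0 21 0 ∷ tup 196 192 195 0 129 0 30 1 ∷ tup 148 152 149 0 172 0 29 1 ∷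
  tup 206 43 187 129 181 2 26 2 ∷ tup 138 43 157 172 163 2 25 2 ∷ tup 129 86 176 204 183 2 34 1 ∷
  tup 172 86 168 140 161 2 33 1 ∷ tup 11 142 138 137 0 1 24 0 ∷ tup 32 202 206 207 0 1 23 0 ∷
  tup 140 164 134 43 66 1 50 3 ∷ tup 204 180 210 43 63 1 49 3 ∷ tup 95 167 152 86 159 1 28 2 ∷
  tup 120 177 192 86 185 1 27 2 ∷ tup 57 53 0 66 144 0 36 0 ∷ tup 72 76 0 63 200 0 35 0 ∷ tup 95 133 127 43 103 2 74 0 ∷
  tup 120 211 88 43 112 2 73 0 ∷ tup 11 31 86 16 153 0 40 0 ∷ tup 32 12 86 27 191 0 39 0 ∷ tup 33 24 144 43 0 0 42 0 ∷
  tup 10 19 200 0 43 0 41 0 ∷ tup 43 86 58 133 69 2 71 1 ∷ tup 86 43 71 211 60 2 72 1 ∷ tup 153 86 0 90 113 1 46 1 ∷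
  tup 191 0 86 125 102 1 45 1 ∷ tup 0 182 191 46 177 0 63 2 ∷ tup 0 162 153 83 167 0 64 2 ∷ tup 43 200 104 189 202 3 32 1 ∷
  tup 43 144 111 155 142 3 31 1 ∷ tup 211 188 86 180 22 0 78 0 ∷ tup 133 156 86 164 21 0 77 0 ∷
  tup 49 8 168 0 212 3 9 3 ∷ tup 80 35 176 0 132 0 17 3 ∷ tup 43 197 48 148 122 0 10 3 ∷ tup 43 147 81 196 93 2 80 2 ∷
  tup 86 116 1 193 157 0 58 0 ∷ tup 86 99 42 151 187 0 57 0 ∷ tup 190 0 44 168 206 3 60 3 ∷ tup 154 0 85 176 138 3 59 3 ∷
  tup 148 92 43 204 194 1 83 3 ∷ tup 196 123 43 140 150 1 84 3 ∷ tup 157 86 175 36 192 2 47 0 ∷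
  tup 187 86 169 7 152 2 48 0 ∷ tup 0 56 48 88 39 3 87 0 ∷ tup 0 73 81 127 4 3 88 0 ∷ tup 43 116 12 121 62 1 106 3 ∷
  tup 43 99 31 94 67 1 105 3 ∷ tup 114 8 38 86 72 1 70 1 ∷ tup 101 35 5 86 57 1 69 1 ∷ tup 27 131 56 0 89 1 43 2 ∷
  tup 16 213 73 0 126 1 44 2 ∷ tup 76 121 18 43 141 0 38 2 ∷ tup 53 94 25 43 203 0 37 2 ∷ tup 112 158 86 38 65 3 91 0 ∷
  tup 103 186 86 5 64 3 92 0 ∷ tup 140 160 0 101 185 0 52 0 ∷ tup 204 184 0 114 159 0 51 0 ∷
  tup 4 207 143 43 152 3 56 1 ∷ tup 39 137 201 43 192 1 79 1 ∷ tup 138 170 86 67 210 2 102 0 ∷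
  tup 206 174 86 62 134 2 101 0 ∷ tup 50 0 130 71 120 3 61 1 ∷ tup 79 0 214 58 95 3 62 1 ∷ tup 32 43 128 125 135 2 86 2 ∷
  tup 11 43 87 90 209 2 85 2 ∷ tup 37 86 63 165 19 0 65 3 ∷ tup 6 86 66 179 24 0 66 3 ∷ tup 161 0 135 103 55 0 93 2 ∷
  tup 183 0 209 112 74 0 94 2 ∷ tup 43 16 149 165 115 0 75 3 ∷ tup 43 27 195 179 100 0 76 3 ∷
  tup 130 86 2 163 53 2 89 0 ∷ tup 214 86 41 181 76 2 90 0 ∷ tup 210 141 159 95 0 0 96 0 ∷ tup 134 203 185 120 0 0 95 0 ∷
  tup 185 158 43 137 11 0 98 0 ∷ tup 159 186 43 207 32 0 97 0 ∷ tup 131 66 134 86 207 3 15 2 ∷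
  tup 213 63 210 86 137 3 16 2 ∷ tup 65 89 99 158 0 0 82 2 ∷ tup 64 126 116 186 0 0 81 2 ∷ tup 89 43 131 18 35 1 13 2 ∷
  tup 126 43 213 25 8 1 14 2 ∷ tup 81 141 65 18 86 3 68 1 ∷ tup 48 203 64 25 86 3 67 1 ∷ [])

dd-215-valid : Valid dd-215
dd-215-valid = refl

dd-231 : Family
dd-231 = family 231 1 1 231 (
  tup 229 124 96 138 117 2 1 0 ∷ tup 154 112 56 217 203 1 2 1 ∷ tup 21 49 105 217 56 0 0 1 ∷
  tup 25 1 2 5 0 0 14 0 ∷ tup 104 0 134 58 67 1 11 0 ∷ tup 100 0 38 200 190 2 20 1 ∷ tup 0 106 129 149 5 3 17 0 ∷
  tup 0 50 96 104 172 3 12 1 ∷ tup 116 195 38 205 0 2 13 1 ∷ tup 128 0 85 116 199 3 18 3 ∷ tup 149 166 151 0 29 3 16 2 ∷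
  tup 184 50 0 95 34 0 4 1 ∷ tup 199 27 190 0 19 1 7 3 ∷ tup 0 192 25 166 118 1 8 2 ∷ tup 34 58 159 52 0 0 3 0 ∷
  tup 178 93 0 75 39 2 19 1 ∷ tup 225 72 174 145 0 2 10 3 ∷ tup 60 204 108 0 13 0 6 3 ∷ tup 219 3 40 0 148 3 9 3 ∷
  tup 0 214 139 201 120 1 15 2 ∷ tup 73 0 69 186 16 1 5 2 ∷ tup 77 220 0 187 55 0 22 0 ∷ tup 154 11 0 44 176 0 21 0 ∷
  [])

dd-231-valid : Valid dd-231
dd-231-valid = refl

dd-305 : Family
dd-305 = family 61 5 1 305 (
  tup 0 61 122 183 244 0 121 3 ∷ tup 260 192 126 62 0 0 14 3 ∷ tup 0 62 124 186 248 0 1 3 ∷ tup 264 195 128 63 0 0 16 3 ∷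
  tup 0 63 126 189 252 0 3 3 ∷ tup 268 198 130 64 0 0 18 3 ∷ tup 0 64 128 192 256 0 5 3 ∷ tup 272 201 132 65 0 0 20 3 ∷
  tup 0 65 130 195 260 0 7 3 ∷ tup 276 204 134 66 0 0 22 3 ∷ tup 0 66 132 198 264 0 9 3 ∷ tup 280 207 136 67 0 0 24 3 ∷
  tup 0 67 134 201 268 0 11 3 ∷ tup 284 210 138 68 0 0 26 3 ∷ tup 0 68 136 204 272 0 13 3 ∷ tup 288 213 140 69 0 0 28 3 ∷
  tup 0 69 138 207 276 0 15 3 ∷ tup 292 216 142 70 0 0 30 3 ∷ tup 0 70 140 210 280 0 17 3 ∷ tup 296 219 144 71 0 0 32 3 ∷
  tup 0 71 142 213 284 0 19 3 ∷ tup 300 222 146 72 0 0 34 3 ∷ tup 0 72 144 216 288 0 21 3 ∷ tup 304 225 148 73 0 0 36 3 ∷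
  tup 0 73 146 219 292 0 23 3 ∷ tup 247 228 150 74 0 0 38 3 ∷ tup 0 74 148 222 296 0 25 3 ∷ tup 251 231 152 75 0 0 40 3 ∷
  tup 0 75 150 225 300 0 27 3 ∷ tup 255 234 154 76 0 0 42 3 ∷ tup 0 76 152 228 304 0 29 3 ∷ tup 259 237 156 77 0 0 44 3 ∷
  tup 0 77 154 231 247 0 31 3 ∷ tup 263 240 158 78 0 0 46 3 ∷ tup 0 78 156 234 251 0 33 3 ∷ tup 267 243 160 79 0 0 48 3 ∷
  tup 0 79 158 237 255 0 35 3 ∷ tup 271 185 162 80 0 0 50 3 ∷ tup 0 80 160 240 259 0 37 3 ∷ tup 275 188 164 81 0 0 52 3 ∷
  tup 0 81 162 243 263 0 39 3 ∷ tup 279 191 166 82 0 0 54 3 ∷ tup 0 82 164 185 267 0 41 3 ∷ tup 283 194 168 83 0 0 56 3 ∷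
  tup 0 83 166 188 271 0 43 3 ∷ tup 287 197 170 84 0 0 58 3 ∷ tup 0 84 168 191 275 0 45 3 ∷ tup 291 200 172 85 0 0 60 3 ∷
  tup 0 85 170 194 279 0 47 3 ∷ tup 295 203 174 86 0 0 62 3 ∷ tup 0 86 172 197 283 0 49 3 ∷ tup 299 206 176 87 0 0 64 3 ∷
  tup 0 87 174 200 287 0 51 3 ∷ tup 303 209 178 88 0 0 66 3 ∷ tup 0 88 176 203 291 0 53 3 ∷ tup 246 212 180 89 0 0 68 3 ∷
  tup 0 89 178 206 295 0 55 3 ∷ tup 250 215 182 90 0 0 70 3 ∷ tup 0 90 180 209 299 0 57 3 ∷ tup 254 218 123 91 0 0 72 3 ∷
  tup 0 91 182 212 303 0 59 3 ∷ tup 258 221 125 92 0 0 74 3 ∷ tup 0 92 123 215 246 0 61 3 ∷ tup 262 224 127 93 0 0 76 3 ∷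
  tup 0 93 125 218 250 0 63 3 ∷ tup 266 227 129 94 0 0 78 3 ∷ tup 0 94 127 221 254 0 65 3 ∷ tup 270 230 131 95 0 0 80 3 ∷
  tup 0 95 129 224 258 0 67 3 ∷ tup 274 233 133 96 0 0 82 3 ∷ tup 0 96 131 227 262 0 69 3 ∷ tup 278 236 135 97 0 0 84 3 ∷
  tup 0 97 133 230 266 0 71 3 ∷ tup 282 239 137 98 0 0 86 3 ∷ tup 0 98 135 233 270 0 73 3 ∷ tup 286 242 139 99 0 0 88 3 ∷
  tup 0 99 137 236 274 0 75 3 ∷ tup 290 184 141 100 0 0 90 3 ∷ tup 0 100 139 239 278 0 77 3 ∷
  tup 294 187 143 101 0 0 92 3 ∷ tup 0 101 141 242 282 0 79 3 ∷ tup 298 190 145 102 0 0 94 3 ∷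
  tup 0 102 143 184 286 0 81 3 ∷ tup 302 193 147 103 0 0 96 3 ∷ tup 0 103 145 187 290 0 83 3 ∷
  tup 245 196 149 104 0 0 98 3 ∷ tup 0 104 147 190 294 0 85 3 ∷ tup 249 199 151 105 0 0 100 3 ∷
  tup 0 105 149 193 298 0 87 3 ∷ tup 253 202 153 106 0 0 102 3 ∷ tup 0 106 151 196 302 0 89 3 ∷
  tup 257 205 155 107 0 0 104 3 ∷ tup 0 107 153 199 245 0 91 3 ∷ tup 261 208 157 108 0 0 106 3 ∷
  tup 0 108 155 202 249 0 93 3 ∷ tup 265 211 159 109 0 0 108 3 ∷ tup 0 109 157 205 253 0 95 3 ∷
  tup 269 214 161 110 0 0 110 3 ∷ tup 0 110 159 208 257 0 97 3 ∷ tup 273 217 163 111 0 0 112 3 ∷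
  tup 0 111 161 211 261 0 99 3 ∷ tup 277 220 165 112 0 0 114 3 ∷ tup 0 112 163 214 265 0 101 3 ∷
  tup 281 223 167 113 0 0 116 3 ∷ tup 0 113 165 217 269 0 103 3 ∷ tup 285 226 169 114 0 0 118 3 ∷
  tup 0 114 167 220 273 0 105 3 ∷ tup 289 229 171 115 0 0 120 3 ∷ tup 0 115 169 223 277 0 107 3 ∷
  tup 293 232 173 116 0 0 0 3 ∷ tup 0 116 171 226 281 0 109 3 ∷ tup 297 235 175 117 0 0 2 3 ∷
  tup 0 117 173 229 285 0 111 3 ∷ tup 301 238 177 118 0 0 4 3 ∷ tup 0 118 175 232 289 0 113 3 ∷
  tup 244 241 179 119 0 0 6 3 ∷ tup 0 119 177 235 293 0 115 3 ∷ tup 248 183 181 120 0 0 8 3 ∷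
  tup 0 120 179 238 297 0 117 3 ∷ tup 252 186 122 121 0 0 10 3 ∷ tup 0 121 181 241 301 0 119 3 ∷
  tup 256 189 124 61 0 0 12 3 ∷ tup 6 5 0 24 40 0 125 0 ∷ tup 23 9 0 31 11 0 126 0 ∷ tup 17 4 0 7 32 0 127 0 ∷
  tup 55 56 0 37 21 0 122 0 ∷ tup 38 52 0 30 50 0 123 0 ∷ tup 44 57 0 54 29 0 124 0 ∷ tup 67 66 61 85 101 0 131 0 ∷
  tup 84 70 61 92 72 0 132 0 ∷ tup 78 65 61 68 93 0 133 0 ∷ tup 116 117 61 98 82 0 128 0 ∷ tup 99 113 61 91 111 0 129 0 ∷
  tup 105 118 61 115 90 0 130 0 ∷ tup 128 127 122 146 162 0 137 0 ∷ tup 145 131 122 153 133 0 138 0 ∷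
  tup 139 126 122 129 154 0 139 0 ∷ tup 177 178 122 159 143 0 134 0 ∷ tup 160 174 122 152 172 0 135 0 ∷
  tup 166 179 122 176 151 0 136 0 ∷ tup 189 188 183 207 223 0 143 0 ∷ tup 206 192 183 214 194 0 144 0 ∷
  tup 200 187 183 190 215 0 145 0 ∷ tup 238 239 183 220 204 0 140 0 ∷ tup 221 235 183 213 233 0 141 0 ∷
  tup 227 240 183 237 212 0 142 0 ∷ tup 250 249 244 268 284 0 149 0 ∷ tup 267 253 244 275 255 0 150 0 ∷
  tup 261 248 244 251 276 0 151 0 ∷ tup 299 300 244 281 265 0 146 0 ∷ tup 282 296 244 274 294 0 147 0 ∷
  tup 288 301 244 298 273 0 148 0 ∷ [])

dd-305-valid : Valid dd-305
dd-305-valid = refl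

dd-311 : Family
dd-311 = family 311 1 1 311 (
  tup 26 11 0 5 14 0 16 1 ∷ tup 182 77 0 35 98 0 17 1 ∷ tup 30 228 0 245 64 0 18 1 ∷ tup 210 41 0 160 137 0 19 1 ∷
  tup 226 287 0 187 26 0 20 1 ∷ tup 27 143 0 65 182 0 21 1 ∷ tup 189 68 0 144 30 0 22 1 ∷ tup 79 165 0 75 210 0 23 1 ∷
  tup 242 222 0 214 226 0 24 1 ∷ tup 139 310 0 254 27 0 25 1 ∷ tup 40 304 0 223 189 0 26 1 ∷
  tup 280 262 0 6 79 0 27 1 ∷ tup 94 279 0 42 242 0 28 1 ∷ tup 36 87 0 294 139 0 29 1 ∷ tup 252 298 0 192 40 0 30 1 ∷
  tup 209 220 0 100 280 0 0 1 ∷ tup 219 296 0 78 94 0 1 1 ∷ tup 289 206 0 235 36 0 2 1 ∷ tup 157 198 0 90 252 0 3 1 ∷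
  tup 166 142 0 8 209 0 4 1 ∷ tup 229 61 0 56 219 0 5 1 ∷ tup 48 116 0 81 289 0 6 1 ∷ tup 25 190 0 256 157 0 7 1 ∷
  tup 175 86 0 237 166 0 8 1 ∷ tup 292 291 0 104 229 0 9 1 ∷ tup 178 171 0 106 48 0 10 1 ∷ tup 2 264 0 120 25 0 11 1 ∷
  tup 14 293 0 218 175 0 12 1 ∷ tup 98 185 0 282 292 0 13 1 ∷ tup 64 51 0 108 178 0 14 1 ∷ tup 137 46 0 134 2 0 15 1 ∷
  [])

dd-311-valid : Valid dd-311
dd-311-valid = refl

-- Base blocks of group divisible designs

gdd-4-0 : Family
gdd-4-0 = family 1 20 4 20 (
  tup 16 4 12 2 8 0 15 2 ∷ tup 12 18 1 9 4 0 20 2 ∷ tup 4 0 18 11 13 3 13 1 ∷ tup 8 16 1 13 7 3 14 1 ∷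
  tup 9 1 16 14 5 0 1 2 ∷ tup 7 12 10 0 16 1 10 3 ∷ tup 8 6 12 19 3 1 11 3 ∷ tup 2 12 5 17 11 0 0 2 ∷
  tup 17 5 13 3 9 0 7 2 ∷ tup 13 19 0 8 5 0 28 2 ∷ tup 5 1 19 10 12 3 5 1 ∷ tup 9 17 0 12 6 3 6 1 ∷
  tup 8 0 17 15 4 0 9 2 ∷ tup 6 13 11 1 17 1 2 3 ∷ tup 9 7 13 18 2 1 3 3 ∷ tup 3 13 4 16 10 0 8 2 ∷
  tup 18 6 14 0 10 0 31 2 ∷ tup 14 16 3 11 6 0 4 2 ∷ tup 6 2 16 9 15 3 29 1 ∷ tup 10 18 3 15 5 3 30 1 ∷
  tup 11 3 18 12 7 0 17 2 ∷ tup 5 14 8 2 18 1 26 3 ∷ tup 10 4 14 17 1 1 27 3 ∷ tup 0 14 7 19 9 0 16 2 ∷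
  tup 19 7 15 1 11 0 23 2 ∷ tup 15 17 2 10 7 0 12 2 ∷ tup 7 3 17 8 14 3 21 1 ∷ tup 11 19 2 14 4 3 22 1 ∷
  tup 10 2 19 13 6 0 25 2 ∷ tup 4 15 9 3 19 1 18 3 ∷ tup 11 5 15 16 0 1 19 3 ∷ tup 1 15 6 18 8 0 24 2 ∷
  [])

gdd-4-0-valid : Valid gdd-4-0
gdd-4-0-valid = refl

gdd-4-4 : Family
gdd-4-4 = family 4 6 4 24 (
  tup 0 12 6 9 16 1 11 0 ∷ tup 0 20 13 4 19 0 2 1 ∷ tup 14 20 0 8 17 1 1 0 ∷ tup 10 16 12 5 3 0 4 1 ∷
  tup 4 16 10 1 20 1 3 0 ∷ tup 4 12 17 8 23 0 6 1 ∷ tup 18 12 4 0 21 1 5 0 ∷ tup 2 20 16 9 7 0 8 1 ∷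
  tup 8 20 2 5 12 1 7 0 ∷ tup 8 16 21 0 15 0 10 1 ∷ tup 22 16 8 4 13 1 9 0 ∷ tup 6 12 20 1 11 0 0 1 ∷
  [])

gdd-4-4-valid : Valid gdd-4-4
gdd-4-4-valid = refl

-- The group is trivial: with m = 1 each point is a column of its own, so no point counts as fixed
-- and the rows list all blocks.
gdd-4-2 : Family
gdd-4-2 = family 1 22 4 22 (
  tup 0 16 20 4 13 0 5 0 ∷ tup 20 8 0 12 5 0 2 2 ∷ tup 4 3 8 20 17 2 1 0 ∷ tup 13 21 2 17 8 2 39 1 ∷
  tup 8 16 6 14 21 1 7 0 ∷ tup 16 0 15 8 7 0 0 0 ∷ tup 4 10 15 1 16 3 38 3 ∷ tup 6 16 11 2 12 0 4 1 ∷
  tup 14 8 4 19 2 3 36 3 ∷ tup 12 18 1 7 8 1 33 2 ∷ tup 1 17 21 5 12 0 15 0 ∷ tup 21 9 1 13 4 0 12 2 ∷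
  tup 5 2 9 21 16 2 11 0 ∷ tup 12 20 3 16 9 2 29 1 ∷ tup 9 17 7 15 20 1 17 0 ∷ tup 17 1 14 9 6 0 10 0 ∷
  tup 5 11 14 0 17 3 28 3 ∷ tup 7 17 10 3 13 0 14 1 ∷ tup 15 9 5 18 3 3 26 3 ∷ tup 13 19 0 6 9 1 23 2 ∷
  tup 2 18 20 6 15 0 25 0 ∷ tup 20 10 2 14 7 0 22 2 ∷ tup 6 1 10 20 19 2 21 0 ∷ tup 15 21 0 19 10 2 19 1 ∷
  tup 10 18 4 12 21 1 27 0 ∷ tup 18 2 13 10 5 0 20 0 ∷ tup 6 8 13 3 18 3 18 3 ∷ tup 4 18 9 0 14 0 24 1 ∷
  tup 12 10 6 17 0 3 16 3 ∷ tup 14 16 3 5 10 1 13 2 ∷ tup 3 19 21 7 14 0 35 0 ∷ tup 21 11 3 15 6 0 32 2 ∷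
  tup 7 0 11 21 18 2 31 0 ∷ tup 14 20 1 18 11 2 9 1 ∷ tup 11 19 5 13 20 1 37 0 ∷ tup 19 3 12 11 4 0 30 0 ∷
  tup 7 9 12 2 19 3 8 3 ∷ tup 5 19 8 1 15 0 34 1 ∷ tup 13 11 7 16 1 3 6 3 ∷ tup 15 17 2 4 11 1 3 2 ∷
  [])

gdd-4-2-valid : Valid gdd-4-2
gdd-4-2-valid = refl

gdd-6-0 : Family
gdd-6-0 = family 6 5 6 30 (
  tup 0 12 29 18 11 1 5 2 ∷ tup 11 19 17 0 24 1 4 0 ∷ tup 12 21 27 0 6 3 3 1 ∷ tup 27 7 1 23 12 1 2 3 ∷
  tup 12 20 2 9 24 0 1 1 ∷ tup 18 6 26 15 2 2 0 1 ∷ tup 2 10 19 28 12 0 7 0 ∷ tup 11 3 12 28 22 0 6 0 ∷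
  tup 15 7 29 20 0 3 11 0 ∷ tup 28 14 9 0 21 2 10 2 ∷ tup 28 20 3 6 16 2 9 2 ∷ tup 0 20 27 14 10 0 8 3 ∷
  [])

gdd-6-0-valid : Valid gdd-6-0
gdd-6-0-valid = refl

gdd-6-6 : Family
gdd-6-6 = family 6 6 6 36 (
  tup 0 24 13 6 20 1 3 0 ∷ tup 26 1 30 6 12 2 14 1 ∷ tup 32 7 12 0 18 2 9 1 ∷ tup 15 26 20 0 7 0 0 1 ∷
  tup 6 26 13 32 3 1 8 3 ∷ tup 20 12 32 1 9 0 16 0 ∷ tup 18 1 17 29 32 3 15 1 ∷ tup 7 35 20 5 24 2 12 1 ∷
  tup 11 23 30 13 26 3 4 1 ∷ tup 29 2 14 30 18 1 2 2 ∷ tup 18 8 24 2 35 3 17 0 ∷ tup 30 24 14 23 8 1 13 0 ∷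
  tup 8 3 18 12 26 1 7 2 ∷ tup 14 24 0 9 32 0 11 1 ∷ tup 20 6 30 15 2 1 1 2 ∷ tup 5 35 26 9 18 1 6 3 ∷
  tup 15 23 32 11 24 0 5 0 ∷ tup 30 3 29 20 17 0 10 3 ∷ [])

gdd-6-6-valid : Valid gdd-6-6
gdd-6-6-valid = refl

gdd-6-2 : Family
gdd-6-2 = family 1 32 6 32 (
  tup 22 28 4 10 16 3 77 3 ∷ tup 7 19 25 1 13 2 82 3 ∷ tup 8 14 2 20 26 2 33 2 ∷ tup 17 29 23 11 5 2 28 3 ∷
  tup 0 12 30 19 10 1 8 2 ∷ tup 22 7 31 15 3 3 17 2 ∷ tup 18 25 30 6 16 1 27 3 ∷ tup 31 9 28 13 21 0 13 2 ∷
  tup 1 22 30 12 24 2 4 1 ∷ tup 15 19 4 31 27 0 49 3 ∷ tup 7 28 30 0 18 0 43 1 ∷ tup 3 21 10 31 25 1 63 1 ∷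
  tup 6 4 13 24 30 1 35 3 ∷ tup 1 27 9 31 16 2 7 0 ∷ tup 24 6 31 1 20 1 18 2 ∷ tup 23 9 30 27 4 2 21 0 ∷
  tup 12 0 31 7 26 1 22 3 ∷ tup 10 29 3 15 30 2 5 3 ∷ tup 2 13 31 6 18 2 14 1 ∷ tup 16 21 30 5 9 1 23 0 ∷
  tup 31 24 19 8 12 2 25 2 ∷ tup 27 30 15 22 11 0 15 2 ∷ tup 25 18 14 31 0 3 16 1 ∷ tup 30 21 17 3 28 0 19 1 ∷
  tup 11 31 29 22 2 3 36 2 ∷ tup 26 5 8 19 30 2 20 2 ∷ tup 8 28 31 5 17 0 38 2 ∷ tup 2 11 14 30 25 3 6 1 ∷
  tup 31 14 4 11 23 3 3 2 ∷ tup 17 20 30 1 8 0 30 1 ∷ tup 29 20 17 31 10 1 29 0 ∷ tup 30 26 23 7 14 1 32 2 ∷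
  tup 5 16 23 26 31 2 31 1 ∷ tup 30 13 20 2 29 2 2 2 ∷ tup 11 26 21 16 1 0 78 3 ∷ tup 18 29 8 13 4 3 12 1 ∷
  tup 7 17 2 22 27 2 24 3 ∷ tup 10 19 14 5 24 1 40 3 ∷ tup 23 13 28 8 3 2 26 0 ∷ tup 20 0 16 25 11 0 59 0 ∷
  tup 4 9 29 14 19 3 37 1 ∷ tup 22 1 17 6 26 3 61 2 ∷ tup 5 25 15 10 20 0 47 3 ∷ tup 2 28 7 23 12 1 10 0 ∷
  tup 26 13 10 0 22 1 53 0 ∷ tup 19 3 29 7 16 3 52 0 ∷ tup 16 19 6 28 2 2 81 1 ∷ tup 22 13 9 25 5 3 42 0 ∷
  tup 25 12 4 22 8 1 83 1 ∷ tup 28 1 11 19 15 3 9 0 ∷ tup 14 1 18 10 28 0 74 0 ∷ tup 17 4 25 21 7 0 75 2 ∷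
  tup 16 7 20 24 4 0 45 3 ∷ tup 10 13 27 1 23 0 44 1 ∷ tup 21 24 11 0 13 0 71 3 ∷ tup 16 3 8 27 18 2 73 3 ∷
  tup 6 27 17 19 0 2 80 2 ∷ tup 24 14 3 9 22 2 67 1 ∷ tup 6 12 25 3 23 0 68 0 ∷ tup 0 20 15 28 9 0 39 0 ∷
  tup 29 12 18 9 1 1 70 1 ∷ tup 21 4 26 6 15 2 41 3 ∷ tup 24 15 18 7 5 1 69 1 ∷ tup 27 10 21 12 2 1 11 1 ∷
  tup 9 0 23 17 24 3 72 3 ∷ tup 27 20 3 14 6 0 76 0 ∷ tup 23 15 0 29 6 2 79 3 ∷ tup 26 9 3 20 12 1 57 2 ∷
  tup 12 6 5 21 29 0 58 0 ∷ tup 9 18 15 26 2 1 62 1 ∷ tup 5 18 12 11 27 1 60 1 ∷ tup 2 8 15 24 21 3 54 0 ∷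
  tup 11 18 3 24 17 3 64 3 ∷ tup 0 21 14 27 8 3 55 2 ∷ tup 1 14 7 29 21 0 50 0 ∷ tup 10 26 4 17 18 2 51 0 ∷
  tup 20 27 5 13 7 0 65 0 ∷ tup 24 23 2 16 10 3 0 3 ∷ tup 3 13 19 26 11 3 34 0 ∷ tup 8 16 22 29 0 3 66 2 ∷
  tup 25 2 19 17 9 2 56 2 ∷ tup 5 28 6 22 14 1 46 2 ∷ tup 15 8 23 1 25 3 1 2 ∷ tup 11 4 12 28 20 1 48 1 ∷
  [])

gdd-6-2-valid : Valid gdd-6-2
gdd-6-2-valid = refl

-- Lines and parabolas with slopes in the field of order 8 where x³ = x + 1, elements being written
-- as binary numbers and i running through 0, ..., 4. The rotation of order 2 adds the element 1.
gdd-8-0 : Family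
gdd-8-0 = family 2 20 8 40 (
  tup 0 8 16 24 32 0 3 3 ∷ tup 38 29 20 9 0 0 62 3 ∷ tup 0 9 18 27 36 0 1 3 ∷ tup 34 30 22 8 0 0 60 3 ∷
  tup 0 10 20 30 35 0 7 3 ∷ tup 37 27 16 11 0 0 58 3 ∷ tup 0 11 22 29 39 0 5 3 ∷ tup 33 24 18 10 0 0 56 3 ∷
  tup 0 12 19 31 38 0 11 3 ∷ tup 32 26 23 13 0 0 54 3 ∷ tup 0 13 17 28 34 0 9 3 ∷ tup 36 25 21 12 0 0 52 3 ∷
  tup 0 14 23 25 37 0 15 3 ∷ tup 35 28 19 15 0 0 50 3 ∷ tup 0 15 21 26 33 0 13 3 ∷ tup 39 31 17 14 0 0 48 3 ∷
  tup 2 10 18 26 34 0 19 3 ∷ tup 36 31 22 11 2 0 46 3 ∷ tup 2 11 16 25 38 0 17 3 ∷ tup 32 28 20 10 2 0 44 3 ∷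
  tup 2 8 22 28 33 0 23 3 ∷ tup 39 25 18 9 2 0 42 3 ∷ tup 2 9 20 31 37 0 21 3 ∷ tup 35 26 16 8 2 0 40 3 ∷
  tup 2 14 17 29 36 0 27 3 ∷ tup 34 24 21 15 2 0 38 3 ∷ tup 2 15 19 30 32 0 25 3 ∷ tup 38 27 23 14 2 0 36 3 ∷
  tup 2 12 21 27 39 0 31 3 ∷ tup 33 30 17 13 2 0 34 3 ∷ tup 2 13 23 24 35 0 29 3 ∷ tup 37 29 19 12 2 0 32 3 ∷
  tup 4 12 20 28 36 0 35 3 ∷ tup 34 25 16 13 4 0 30 3 ∷ tup 4 13 22 31 32 0 33 3 ∷ tup 38 26 18 12 4 0 28 3 ∷
  tup 4 14 16 26 39 0 39 3 ∷ tup 33 31 20 15 4 0 26 3 ∷ tup 4 15 18 25 35 0 37 3 ∷ tup 37 28 22 14 4 0 24 3 ∷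
  tup 4 8 23 27 34 0 43 3 ∷ tup 36 30 19 9 4 0 22 3 ∷ tup 4 9 21 24 38 0 41 3 ∷ tup 32 29 17 8 4 0 20 3 ∷
  tup 4 10 19 29 33 0 47 3 ∷ tup 39 24 23 11 4 0 18 3 ∷ tup 4 11 17 30 37 0 45 3 ∷ tup 35 27 21 10 4 0 16 3 ∷
  tup 6 14 22 30 38 0 51 3 ∷ tup 32 27 18 15 6 0 14 3 ∷ tup 6 15 20 29 34 0 49 3 ∷ tup 36 24 16 14 6 0 12 3 ∷
  tup 6 12 18 24 37 0 55 3 ∷ tup 35 29 22 13 6 0 10 3 ∷ tup 6 13 16 27 33 0 53 3 ∷ tup 39 30 20 12 6 0 8 3 ∷
  tup 6 10 21 25 32 0 59 3 ∷ tup 38 28 17 11 6 0 6 3 ∷ tup 6 11 23 26 36 0 57 3 ∷ tup 34 31 19 10 6 0 4 3 ∷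
  tup 6 8 17 31 35 0 63 3 ∷ tup 37 26 21 9 6 0 2 3 ∷ tup 6 9 19 28 39 0 61 3 ∷ tup 33 25 23 8 6 0 0 3 ∷
  [])

gdd-8-0-valid : Valid gdd-8-0
gdd-8-0-valid = refl

gdd-8-8 : Family
gdd-8-8 = family 8 6 8 48 (
  tup 8 45 17 24 0 2 8 1 ∷ tup 32 1 29 8 16 0 6 2 ∷ tup 9 40 37 0 16 0 7 3 ∷ tup 16 32 15 0 24 1 14 0 ∷
  tup 23 0 8 40 32 2 5 3 ∷ tup 7 24 16 40 8 3 4 2 ∷ tup 13 24 1 32 43 2 1 0 ∷ tup 27 32 21 40 9 3 2 0 ∷
  tup 40 24 17 35 5 1 0 2 ∷ tup 44 14 18 29 0 3 20 3 ∷ tup 2 22 8 37 28 1 11 2 ∷ tup 6 45 10 16 36 2 10 1 ∷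
  tup 0 30 37 44 19 2 13 1 ∷ tup 28 45 38 8 3 1 12 2 ∷ tup 11 36 16 46 29 0 3 1 ∷ tup 46 0 27 36 10 0 18 1 ∷
  tup 35 8 18 44 30 1 22 1 ∷ tup 38 28 43 16 2 3 23 0 ∷ tup 28 0 46 34 13 1 15 0 ∷ tup 36 21 30 42 8 2 21 2 ∷
  tup 16 44 38 5 26 3 9 3 ∷ tup 10 0 43 31 21 2 19 2 ∷ tup 27 18 8 39 5 1 16 1 ∷ tup 2 16 13 35 47 0 17 3 ∷
  [])

gdd-8-8-valid : Valid gdd-8-8
gdd-8-8-valid = refl

gdd-8-2 : Family
gdd-8-2 = family 1 42 8 42 (
  tup 9 1 33 17 25 2 111 3 ∷ tup 27 11 35 3 19 1 121 3 ∷ tup 23 39 7 31 15 3 105 0 ∷ tup 21 29 37 5 13 0 27 0 ∷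
  tup 11 24 1 16 40 2 29 3 ∷ tup 26 3 13 18 40 3 20 2 ∷ tup 40 32 19 24 9 3 33 3 ∷ tup 15 5 28 40 20 0 116 2 ∷
  tup 40 21 11 26 34 1 117 1 ∷ tup 27 0 32 17 40 0 131 1 ∷ tup 22 9 40 7 30 3 41 3 ∷ tup 40 28 23 13 36 3 42 0 ∷
  tup 2 34 29 19 40 2 104 3 ∷ tup 40 35 0 8 25 2 124 3 ∷ tup 38 30 40 17 15 3 122 0 ∷ tup 4 21 36 31 40 2 48 3 ∷
  tup 40 27 2 37 10 1 25 3 ∷ tup 8 40 16 3 33 3 118 0 ∷ tup 25 23 40 6 38 0 107 0 ∷ tup 40 39 4 29 12 0 23 0 ∷
  tup 10 35 40 18 5 2 5 3 ∷ tup 6 33 14 40 31 0 55 1 ∷ tup 7 37 20 12 40 0 112 3 ∷ tup 39 40 22 14 1 0 19 0 ∷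
  tup 41 25 17 0 14 0 26 0 ∷ tup 8 41 19 2 27 3 16 1 ∷ tup 25 41 22 33 8 0 24 0 ∷ tup 29 21 41 10 4 0 3 0 ∷
  tup 35 16 10 27 41 0 109 3 ∷ tup 30 33 41 16 1 3 4 2 ∷ tup 41 31 6 12 23 2 90 1 ∷ tup 12 41 37 18 29 1 35 3 ∷
  tup 18 24 3 41 35 2 36 0 ∷ tup 1 41 38 9 24 3 6 3 ∷ tup 31 14 41 39 20 2 38 3 ∷ tup 20 5 26 37 41 3 31 1 ∷
  tup 41 3 26 32 11 0 32 2 ∷ tup 6 17 9 32 41 0 110 2 ∷ tup 7 28 22 39 41 3 34 2 ∷ tup 41 13 28 34 5 3 89 2 ∷
  tup 19 34 11 0 41 2 101 1 ∷ tup 41 36 15 30 7 3 10 3 ∷ tup 36 13 2 41 21 0 11 3 ∷ tup 15 4 38 23 41 0 96 0 ∷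
  tup 0 39 26 9 21 2 65 2 ∷ tup 11 23 2 28 33 3 119 0 ∷ tup 29 8 7 34 17 2 120 1 ∷ tup 35 4 17 13 30 0 94 0 ∷
  tup 1 10 19 31 36 3 15 2 ∷ tup 37 25 2 16 15 1 72 1 ∷ tup 15 24 37 19 6 1 113 2 ∷ tup 38 12 3 25 21 2 60 3 ∷
  tup 4 27 18 9 39 0 75 2 ∷ tup 33 5 24 23 10 2 100 1 ∷ tup 23 32 27 14 5 0 66 1 ∷ tup 29 33 6 11 20 1 21 0 ∷
  tup 17 26 35 12 7 2 79 1 ∷ tup 31 1 18 13 32 3 77 1 ∷ tup 13 0 35 22 31 2 78 0 ∷ tup 28 19 1 37 14 0 103 2 ∷
  tup 20 15 34 25 3 3 51 2 ∷ tup 21 30 3 8 39 3 73 1 ∷ tup 9 5 36 22 27 1 71 1 ∷ tup 7 16 11 38 29 2 83 0 ∷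
  tup 24 21 15 33 0 0 130 3 ∷ tup 2 35 9 26 23 2 44 2 ∷ tup 8 32 23 1 29 1 54 0 ∷ tup 17 37 28 4 11 3 142 3 ∷
  tup 17 3 34 31 10 2 126 0 ∷ tup 16 37 9 31 0 2 123 0 ∷ tup 6 39 30 19 13 2 127 0 ∷ tup 25 36 5 12 19 1 62 1 ∷
  tup 39 2 25 11 18 1 49 1 ∷ tup 17 39 8 24 5 1 61 3 ∷ tup 21 38 14 7 27 2 114 0 ∷ tup 20 13 27 4 33 2 52 0 ∷
  tup 19 7 10 26 33 3 132 2 ∷ tup 16 32 13 25 7 1 57 3 ∷ tup 22 35 6 29 15 0 58 2 ∷ tup 21 12 35 1 28 1 56 2 ∷
  tup 18 34 27 1 15 2 106 1 ∷ tup 14 37 23 3 30 2 108 3 ∷ tup 3 36 20 9 29 0 139 0 ∷ tup 38 11 31 22 5 0 63 2 ∷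
  tup 14 29 18 38 0 2 141 3 ∷ tup 32 2 20 8 31 1 140 3 ∷ tup 6 8 37 26 22 3 136 3 ∷ tup 4 22 10 25 34 2 128 3 ∷
  tup 39 0 28 10 16 2 125 0 ∷ tup 16 30 5 34 14 2 39 3 ∷ tup 27 12 6 16 36 1 30 2 ∷ tup 33 18 2 12 30 2 129 1 ∷
  tup 7 24 18 8 36 0 133 2 ∷ tup 24 22 2 13 38 3 143 0 ∷ tup 4 35 24 20 14 0 47 0 ∷ tup 26 38 10 20 1 3 115 2 ∷
  tup 4 15 32 16 26 0 43 0 ∷ tup 32 30 10 21 6 1 138 0 ∷ tup 22 28 32 3 12 1 137 0 ∷ tup 9 34 18 6 28 3 135 2 ∷
  tup 0 23 24 12 34 1 53 2 ∷ tup 20 0 11 30 36 1 40 2 ∷ tup 26 2 14 36 17 1 134 1 ∷ tup 38 4 19 28 8 2 59 0 ∷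
  tup 0 33 13 19 29 3 12 2 ∷ tup 15 31 35 21 2 0 2 3 ∷ tup 37 1 27 8 21 1 80 2 ∷ tup 23 25 9 4 37 0 18 0 ∷
  tup 10 29 39 3 23 3 81 2 ∷ tup 5 29 9 16 35 3 28 0 ∷ tup 11 39 17 6 27 2 37 0 ∷ tup 12 5 31 17 33 3 0 2 ∷
  tup 18 31 11 37 7 3 22 0 ∷ tup 13 3 37 24 17 2 50 1 ∷ tup 7 14 19 25 35 0 74 2 ∷ tup 25 13 1 20 39 2 95 3 ∷
  tup 26 19 5 15 39 2 7 0 ∷ tup 5 11 21 25 32 1 8 1 ∷ tup 33 3 15 27 22 0 17 3 ∷ tup 33 28 7 21 9 0 45 3 ∷
  tup 27 34 7 13 23 1 46 2 ∷ tup 1 30 23 35 11 3 1 1 ∷ tup 15 17 29 36 1 0 14 3 ∷ tup 31 9 19 3 38 0 69 2 ∷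
  tup 36 23 26 8 0 3 13 2 ∷ tup 10 28 17 38 2 0 88 2 ∷ tup 31 34 16 8 4 0 68 2 ∷ tup 19 30 12 32 4 0 70 2 ∷
  tup 36 6 18 25 10 3 87 2 ∷ tup 16 12 2 24 39 1 91 2 ∷ tup 14 6 34 21 24 3 64 0 ∷ tup 12 0 27 20 38 1 9 0 ∷
  tup 18 14 33 26 4 2 76 3 ∷ tup 20 10 24 7 32 2 92 0 ∷ tup 29 14 2 32 22 1 102 1 ∷ tup 8 20 28 6 35 2 99 3 ∷
  tup 1 34 12 22 26 3 86 3 ∷ tup 32 28 0 15 18 0 98 1 ∷ tup 10 30 22 0 37 0 97 1 ∷ tup 36 3 14 16 28 0 82 0 ∷
  tup 34 30 9 20 2 3 85 1 ∷ tup 5 8 30 38 18 3 84 2 ∷ tup 22 36 24 11 4 3 67 3 ∷ tup 38 13 26 16 6 0 93 3 ∷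
  [])

gdd-8-2-valid : Valid gdd-8-2
gdd-8-2-valid = refl

-- Adding 10 modulo 50 is a further automorphism, which permutes the groups; four blocks generate
-- all others.
gdd-10-0 : Family
gdd-10-0 = family 10 5 10 50 (
  tup 26 30 0 41 12 1 2 1 ∷ tup 33 0 43 22 19 1 19 1 ∷ tup 45 0 30 28 18 1 0 1 ∷ tup 25 0 17 31 44 1 5 1 ∷
  tup 36 40 10 1 22 1 6 1 ∷ tup 43 10 3 32 29 1 3 1 ∷ tup 5 10 40 38 28 1 4 1 ∷ tup 35 10 27 41 4 1 9 1 ∷
  tup 46 0 20 11 32 1 10 1 ∷ tup 3 20 13 42 39 1 7 1 ∷ tup 15 20 0 48 38 1 8 1 ∷ tup 45 20 37 1 14 1 13 1 ∷
  tup 6 10 30 21 42 1 14 1 ∷ tup 13 30 23 2 49 1 11 1 ∷ tup 25 30 10 8 48 1 12 1 ∷ tup 5 30 47 11 24 1 17 1 ∷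
  tup 16 20 40 31 2 1 18 1 ∷ tup 23 40 33 12 9 1 15 1 ∷ tup 35 40 20 18 8 1 16 1 ∷ tup 15 40 7 21 34 1 1 1 ∷
  [])

gdd-10-0-valid : Valid gdd-10-0
gdd-10-0-valid = refl

gdd-10-10 : Family
gdd-10-10 = family 10 6 10 60 (
  tup 0 37 41 58 11 1 16 0 ∷ tup 0 10 31 43 29 1 15 2 ∷ tup 0 52 22 40 16 1 17 1 ∷ tup 51 0 18 47 32 2 19 1 ∷
  tup 25 11 0 38 54 0 18 1 ∷ tup 35 0 50 42 15 1 20 1 ∷ tup 10 47 1 58 21 1 22 0 ∷ tup 10 20 41 3 39 1 21 2 ∷
  tup 10 52 32 0 26 1 23 1 ∷ tup 51 10 28 7 42 2 25 1 ∷ tup 35 21 10 48 54 0 24 1 ∷ tup 45 10 50 2 25 1 26 1 ∷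
  tup 20 7 11 58 31 1 28 0 ∷ tup 20 30 1 13 49 1 27 2 ∷ tup 20 52 42 10 36 1 29 1 ∷ tup 51 20 38 17 2 2 1 1 ∷
  tup 45 31 20 8 54 0 0 1 ∷ tup 5 20 50 12 35 1 2 1 ∷ tup 30 17 21 58 41 1 4 0 ∷ tup 30 40 11 23 9 1 3 2 ∷
  tup 30 52 2 20 46 1 5 1 ∷ tup 51 30 48 27 12 2 7 1 ∷ tup 5 41 30 18 54 0 6 1 ∷ tup 15 30 50 22 45 1 8 1 ∷
  tup 40 27 31 58 1 1 10 0 ∷ tup 40 0 21 33 19 1 9 2 ∷ tup 40 52 12 30 6 1 11 1 ∷ tup 51 40 8 37 22 2 13 1 ∷
  tup 15 1 40 28 54 0 12 1 ∷ tup 25 40 50 32 5 1 14 1 ∷ [])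

gdd-10-10-valid : Valid gdd-10-10
gdd-10-10-valid = refl

gdd-10-4 : Family
gdd-10-4 = family 5 10 10 54 (
  tup 45 16 29 37 8 3 25 0 ∷ tup 21 0 34 42 13 3 26 3 ∷ tup 12 23 34 1 40 3 13 1 ∷ tup 8 19 47 36 25 1 41 1 ∷
  tup 11 41 31 21 1 3 28 2 ∷ tup 38 28 18 8 48 1 11 1 ∷ tup 46 37 19 28 5 2 45 1 ∷ tup 12 3 21 30 44 0 42 1 ∷
  tup 0 25 10 36 51 1 36 1 ∷ tup 5 50 32 15 21 3 37 1 ∷ tup 20 51 10 35 46 0 12 1 ∷ tup 42 15 25 31 50 1 5 1 ∷
  tup 45 51 20 6 30 1 10 0 ∷ tup 50 41 2 25 35 1 2 3 ∷ tup 16 30 40 5 51 0 38 3 ∷ tup 1 45 35 12 50 2 39 0 ∷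
  tup 51 0 26 15 40 3 43 3 ∷ tup 22 50 45 5 11 3 35 2 ∷ tup 17 0 53 21 35 2 22 3 ∷ tup 52 5 31 26 13 1 29 2 ∷
  tup 27 45 10 53 31 3 24 0 ∷ tup 52 41 36 23 15 3 32 0 ∷ tup 41 5 37 20 53 3 18 2 ∷ tup 33 25 52 46 1 2 27 3 ∷
  tup 30 53 15 47 1 0 20 3 ∷ tup 6 35 43 11 52 0 0 3 ∷ tup 53 7 25 11 40 3 1 3 ∷ tup 21 3 16 45 52 3 23 2 ∷
  tup 47 35 0 20 16 2 4 3 ∷ tup 12 43 31 5 25 2 19 1 ∷ tup 30 10 7 45 26 2 44 2 ∷ tup 3 22 15 35 41 1 46 3 ∷
  tup 17 20 5 36 40 0 21 3 ∷ tup 45 32 13 1 25 2 47 2 ∷ tup 15 0 27 30 46 1 40 3 ∷ tup 42 23 11 5 35 2 17 3 ∷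
  tup 40 10 25 37 6 1 8 1 ∷ tup 45 21 15 2 33 1 9 3 ∷ tup 26 42 0 33 19 3 14 0 ∷ tup 10 38 5 22 47 0 15 2 ∷
  tup 36 43 10 29 2 3 34 1 ∷ tup 7 48 15 32 20 1 3 1 ∷ tup 39 3 12 46 20 1 7 0 ∷ tup 25 30 8 42 17 3 16 3 ∷
  tup 30 22 49 6 13 2 30 2 ∷ tup 35 27 18 40 2 1 6 2 ∷ tup 9 40 32 16 23 3 31 1 ∷ tup 28 37 0 12 45 2 33 2 ∷
  [])

gdd-10-4-valid : Valid gdd-10-4
gdd-10-4-valid = refl

-- Collecting the ingredients and searching the orders below 1810

bases : List Base
bases =
  (dd-21 , dd-21-valid , refl) ∷
  (dd-25 , dd-25-valid , refl) ∷
  (dd-31 , dd-31-valid , refl) ∷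
  (dd-35 , dd-35-valid , refl) ∷
  (dd-41 , dd-41-valid , refl) ∷
  (dd-45 , dd-45-valid , refl) ∷
  (dd-51 , dd-51-valid , refl) ∷
  (dd-55 , dd-55-valid , refl) ∷
  (dd-61 , dd-61-valid , refl) ∷
  (dd-65 , dd-65-valid , refl) ∷
  (dd-71 , dd-71-valid , refl) ∷
  (dd-75 , dd-75-valid , refl) ∷
  (dd-81 , dd-81-valid , refl) ∷
  (dd-85 , dd-85-valid , refl) ∷
  (dd-91 , dd-91-valid , refl) ∷
  (dd-95 , dd-95-valid , refl) ∷
  (dd-105 , dd-105-valid , refl) ∷
  (dd-111 , dd-111-valid , refl) ∷
  (dd-115 , dd-115-valid , refl) ∷
  (dd-125 , dd-125-valid , refl) ∷
  (dd-131 , dd-131-valid , refl) ∷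
  (dd-135 , dd-135-valid , refl) ∷
  (dd-141 , dd-141-valid , refl) ∷
  (dd-145 , dd-145-valid , refl) ∷
  (dd-155 , dd-155-valid , refl) ∷
  (dd-161 , dd-161-valid , refl) ∷
  (dd-165 , dd-165-valid , refl) ∷
  (dd-185 , dd-185-valid , refl) ∷
  (dd-191 , dd-191-valid , refl) ∷
  (dd-195 , dd-195-valid , refl) ∷
  (dd-205 , dd-205-valid , refl) ∷
  (dd-211 , dd-211-valid , refl) ∷
  (dd-215 , dd-215-valid , refl) ∷
  (dd-231 , dd-231-valid , refl) ∷
  (dd-305 , dd-305-valid , refl) ∷
  (dd-311 , dd-311-valid , refl) ∷ []

weights-4-0 : Ingredients 4 0
weights-4-0 = record
  { with-g = gdd gdd-4-4 gdd-4-4-valid 4 refl (ℕ.≤ᵇ⇒≤ 4 4 tt)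
  ; with-e = gdd gdd-4-0 gdd-4-0-valid 0 refl (ℕ.≤ᵇ⇒≤ 0 4 tt)
  ; with-0 = gdd gdd-4-0 gdd-4-0-valid 0 refl (ℕ.≤ᵇ⇒≤ 0 4 tt)
  }

weights-4-2 : Ingredients 4 2
weights-4-2 = record
  { with-g = gdd gdd-4-4 gdd-4-4-valid 4 refl (ℕ.≤ᵇ⇒≤ 4 4 tt)
  ; with-e = gdd gdd-4-2 gdd-4-2-valid 2 refl (ℕ.≤ᵇ⇒≤ 2 4 tt)
  ; with-0 = gdd gdd-4-0 gdd-4-0-valid 0 refl (ℕ.≤ᵇ⇒≤ 0 4 tt)
  }

weights-6-0 : Ingredients 6 0
weights-6-0 = record
  { with-g = gdd gdd-6-6 gdd-6-6-valid 6 refl (ℕ.≤ᵇ⇒≤ 6 6 tt)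
  ; with-e = gdd gdd-6-0 gdd-6-0-valid 0 refl (ℕ.≤ᵇ⇒≤ 0 6 tt)
  ; with-0 = gdd gdd-6-0 gdd-6-0-valid 0 refl (ℕ.≤ᵇ⇒≤ 0 6 tt)
  }

weights-6-2 : Ingredients 6 2
weights-6-2 = record
  { with-g = gdd gdd-6-6 gdd-6-6-valid 6 refl (ℕ.≤ᵇ⇒≤ 6 6 tt)
  ; with-e = gdd gdd-6-2 gdd-6-2-valid 2 refl (ℕ.≤ᵇ⇒≤ 2 6 tt)
  ; with-0 = gdd gdd-6-0 gdd-6-0-valid 0 refl (ℕ.≤ᵇ⇒≤ 0 6 tt)
  }

weights-8-0 : Ingredients 8 0
weights-8-0 = record
  { with-g = gdd gdd-8-8 gdd-8-8-valid 8 refl (ℕ.≤ᵇ⇒≤ 8 8 tt)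
  ; with-e = gdd gdd-8-0 gdd-8-0-valid 0 refl (ℕ.≤ᵇ⇒≤ 0 8 tt)
  ; with-0 = gdd gdd-8-0 gdd-8-0-valid 0 refl (ℕ.≤ᵇ⇒≤ 0 8 tt)
  }

weights-8-2 : Ingredients 8 2
weights-8-2 = record
  { with-g = gdd gdd-8-8 gdd-8-8-valid 8 refl (ℕ.≤ᵇ⇒≤ 8 8 tt)
  ; with-e = gdd gdd-8-2 gdd-8-2-valid 2 refl (ℕ.≤ᵇ⇒≤ 2 8 tt)
  ; with-0 = gdd gdd-8-0 gdd-8-0-valid 0 refl (ℕ.≤ᵇ⇒≤ 0 8 tt)
  }

weights-10-0 : Ingredients 10 0
weights-10-0 = record
  { with-g = gdd gdd-10-10 gdd-10-10-valid 10 refl (ℕ.≤ᵇ⇒≤ 10 10 tt)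
  ; with-e = gdd gdd-10-0 gdd-10-0-valid 0 refl (ℕ.≤ᵇ⇒≤ 0 10 tt)
  ; with-0 = gdd gdd-10-0 gdd-10-0-valid 0 refl (ℕ.≤ᵇ⇒≤ 0 10 tt)
  }

weights-10-4 : Ingredients 10 4
weights-10-4 = record
  { with-g = gdd gdd-10-10 gdd-10-10-valid 10 refl (ℕ.≤ᵇ⇒≤ 10 10 tt)
  ; with-e = gdd gdd-10-4 gdd-10-4-valid 4 refl (ℕ.≤ᵇ⇒≤ 4 10 tt)
  ; with-0 = gdd gdd-10-0 gdd-10-0-valid 0 refl (ℕ.≤ᵇ⇒≤ 0 10 tt)
  }

-- All weights g are even, so 5 g q is a multiple of 10 and the last digit of the new order is that
-- of g m + e + 1. The weight e thus decides which residue class a step can serve.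
schemes : List Scheme
schemes =
  scheme 10 0 weights-10-0 ∷
  scheme 10 4 weights-10-4 ∷
  scheme 4 0 weights-4-0 ∷
  scheme 4 2 weights-4-2 ∷
  scheme 6 0 weights-6-0 ∷
  scheme 6 2 weights-6-2 ∷
  scheme 8 0 weights-8-0 ∷
  scheme 8 2 weights-8-2 ∷ []

-- Multiples of all elements by 0, 1, 2, 3, 4 in the field of order 8 with x³ = x + 1, written in
-- base 2.
rows-8 : Vec (List ℕ) 5
rows-8 =
  (0 ∷ 0 ∷ 0 ∷ 0 ∷ 0 ∷ 0 ∷ 0 ∷ 0 ∷ []) ∷
  (0 ∷ 1 ∷ 2 ∷ 3 ∷ 4 ∷ 5 ∷ 6 ∷ 7 ∷ []) ∷
  (0 ∷ 2 ∷ 4 ∷ 6 ∷ 3 ∷ 1 ∷ 7 ∷ 5 ∷ []) ∷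
  (0 ∷ 3 ∷ 6 ∷ 5 ∷ 7 ∷ 4 ∷ 1 ∷ 2 ∷ []) ∷
  (0 ∷ 4 ∷ 3 ∷ 7 ∷ 6 ∷ 2 ∷ 5 ∷ 1 ∷ []) ∷ []

td-8 : TD 8
td-8 = Table.td 8 2 3 rows-8 refl

-- Multiples by 0, 1, 2, x, x + 1 in the field of order 9 with x² = -1, written in base 3.
rows-9 : Vec (List ℕ) 5
rows-9 =
  (0 ∷ 0 ∷ 0 ∷ 0 ∷ 0 ∷ 0 ∷ 0 ∷ 0 ∷ 0 ∷ []) ∷
  (0 ∷ 1 ∷ 2 ∷ 3 ∷ 4 ∷ 5 ∷ 6 ∷ 7 ∷ 8 ∷ []) ∷
  (0 ∷ 2 ∷ 1 ∷ 6 ∷ 8 ∷ 7 ∷ 3 ∷ 5 ∷ 4 ∷ []) ∷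
  (0 ∷ 3 ∷ 6 ∷ 2 ∷ 5 ∷ 8 ∷ 1 ∷ 4 ∷ 7 ∷ []) ∷
  (0 ∷ 4 ∷ 8 ∷ 5 ∷ 6 ∷ 1 ∷ 7 ∷ 2 ∷ 3 ∷ []) ∷ []

td-9 : TD 9
td-9 = Table.td 9 3 2 rows-9 refl

-- No field has 15 elements, and the linear construction fails because 3 is not a unit. The rows are
-- a difference matrix over ℤ/15 in which the differences of any two rows run through all residues.
rows-15 : Vec (List ℕ) 5
rows-15 =
  (0 ∷ 0 ∷ 0 ∷ 0 ∷ 0 ∷ 0 ∷ 0 ∷ 0 ∷ 0 ∷ 0 ∷ 0 ∷ 0 ∷ 0 ∷ 0 ∷ 0 ∷ []) ∷
  (0 ∷ 1 ∷ 2 ∷ 3 ∷ 4 ∷ 5 ∷ 6 ∷ 7 ∷ 8 ∷ 9 ∷ 10 ∷ 11 ∷ 12 ∷ 13 ∷ 14 ∷ []) ∷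
  (0 ∷ 2 ∷ 5 ∷ 7 ∷ 9 ∷ 12 ∷ 4 ∷ 1 ∷ 14 ∷ 11 ∷ 3 ∷ 6 ∷ 8 ∷ 10 ∷ 13 ∷ []) ∷
  (0 ∷ 6 ∷ 3 ∷ 14 ∷ 10 ∷ 7 ∷ 13 ∷ 4 ∷ 11 ∷ 2 ∷ 8 ∷ 5 ∷ 1 ∷ 12 ∷ 9 ∷ []) ∷
  (0 ∷ 10 ∷ 6 ∷ 1 ∷ 11 ∷ 2 ∷ 7 ∷ 12 ∷ 3 ∷ 8 ∷ 13 ∷ 4 ∷ 14 ∷ 9 ∷ 5 ∷ []) ∷ []

td-15 : TD 15
td-15 = Table.td 15 15 1 rows-15 refl

-- Multiples by 0, 1, 2, 3, 4 in the field of order 16 with x⁴ = x + 1, written in base 2.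
rows-16 : Vec (List ℕ) 5
rows-16 =
  (0 ∷ 0 ∷ 0 ∷ 0 ∷ 0 ∷ 0 ∷ 0 ∷ 0 ∷ 0 ∷ 0 ∷ 0 ∷ 0 ∷ 0 ∷ 0 ∷ 0 ∷ 0 ∷ []) ∷
  (0 ∷ 1 ∷ 2 ∷ 3 ∷ 4 ∷ 5 ∷ 6 ∷ 7 ∷ 8 ∷ 9 ∷ 10 ∷ 11 ∷ 12 ∷ 13 ∷ 14 ∷ 15 ∷ []) ∷
  (0 ∷ 2 ∷ 4 ∷ 6 ∷ 8 ∷ 10 ∷ 12 ∷ 14 ∷ 3 ∷ 1 ∷ 7 ∷ 5 ∷ 11 ∷ 9 ∷ 15 ∷ 13 ∷ []) ∷
  (0 ∷ 3 ∷ 6 ∷ 5 ∷ 12 ∷ 15 ∷ 10 ∷ 9 ∷ 11 ∷ 8 ∷ 13 ∷ 14 ∷ 7 ∷ 4 ∷ 1 ∷ 2 ∷ []) ∷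
  (0 ∷ 4 ∷ 8 ∷ 12 ∷ 3 ∷ 7 ∷ 11 ∷ 15 ∷ 6 ∷ 2 ∷ 14 ∷ 10 ∷ 5 ∷ 1 ∷ 13 ∷ 9 ∷ []) ∷ []

td-16 : TD 16
td-16 = Table.td 16 2 4 rows-16 refl

-- The first four orders have a factor 2 or 3 and come from tables; the linear construction adds 5,
-- 11, ..., 59 and 7, 13, ..., 61.
orders : List Transversal
orders = transversal 8 td-8 ∷ transversal 9 td-9 ∷ transversal 15 td-15 ∷ transversal 16 td-16
  ∷ map (λ t → transversal (6 * t + 5) (linear₅ t)) (downFrom 10)
  ++ map (λ t → transversal (6 * suc t + 1) (linear₁ (suc t))) (downFrom 10)

small-orders : all (Plan.planned bases schemes orders) (downFrom 1810) ≡ true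
small-orders = refl

theorem3p5 : (v : ℕ) → (v % 10 ≡ 1 ⊎ v % 10 ≡ 5) →
    v ≢ 5 → v ≢ 15 → v ≢ 11 → v ≢ 91 →
    Σ (Collection v) (λ D → IsDD D × SuperSimple D × fAtLeastHalf D)
theorem3p5 v residue v≢5 v≢15 v≢11 _ = Final.witness
  (Main.good-all bases schemes orders weights-10-0 weights-10-4 1810 ℕ.≤-refl small-orders v
    (complete ([ (λ p → ends-in-one v p v≢11) , (λ p → ends-in-five v p v≢5 v≢15) ]′ residue)))
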